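{- Fix a graph $H$, an even integer $m\ge2$, and an edge $e\in E(T_{m,d})$. If $f$ is chosen uniformly at random from $\mathrm{Hom}(T_{m,d},H)$, then $$\Pr(e\text{ is not ideal with respect to }f)\le 2^{ -\Omega(d)}.$$
   Context: For $d\ge1$ and even $m\ge 2$, the even discrete torus $T_{m,d}$ is the graph with vertex set $V=\{0,1,\dots,m-1\}^d$ in which two strings are adjacent iff they differ by exactly $1$ (mod $m$) in exactly one coordinate and agree in all others. It is bipartite with classes $\mathcal{E}$ (even coordinate sum) and $\mathcal{O}$ (odd coordinate sum); $N_x$ is the neighborhood of $x$. $H$ is a finite graph without multiple edges, possibly with loops; $\mathrm{Hom}(G,H)$ is the set of maps $f:V(G)\to V(H)$ with $f(u)f(v)\in E(H)$ whenever $uv\in E(G)$. For $A,B\subseteq V(H)$, $A\sim B$ means every vertex of $A$ is adjacent in $H$ to every vertex of $B$. Let $\eta(H)=\max\{|A||B|:A,B\subseteq V(H),A\sim B\}$ and $\mathcal{M}(H)=\{(A,B):A\sim B,|A||B|=\eta(H)\}$. An edge $e=uv$ of $T_{m,d}$ with $u\in\mathcal{E}$ is ideal with respect to $f$ if $f(N_u)=B$ and $f(N_v)=A$ for some $(A,B)\in\mathcal{M}(H)$. $2^{ -\Omega(d)}$ denotes a quantity at most $2^{ -cd}$ for some constant $c>0$ depending only on $m$ and $H$, for all sufficiently large $d$. -}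

module Defs where

open import Data.Bool using (Bool; true; false; _∧_; _∨_; not; if_then_else_)
open import Data.Nat using (ℕ; zero; suc; _+_; _*_; _^_; _≤_; _⊔_; _%_; _≡ᵇ_)
open import Data.Fin using (Fin; toℕ; funToFin; finToFun)
open import Data.Fin.Subset using (Subset; ∣_∣)
open import Data.List using (List; []; _∷_; map; concatMap; length; allFin; foldr)
open import Data.Bool.ListAction using (any; all)
open import Data.Vec using (Vec; []; _∷_; tabulate)
open import Relation.Binary.PropositionalEquality using (_≡_)
open import Data.Fin using (_≟_)
open import Relation.Nullary.Decidable using (⌊_⌋)

boolFilter : ∀ {A : Set} → (A → Bool) → List A → List A
boolFilter p []       = []
boolFilter p (x ∷ xs) = if p x then x ∷ boolFilter p xs else boolFilter p xs

-- A finite graph H without multiple edges, loops allowed: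
-- vertex set Fin n, symmetric Boolean adjacency (adj x x = true is a loop).

record Graph : Set where
  field
    n    : ℕ
    adj  : Fin n → Fin n → Bool
    sym  : ∀ x y → adj x y ≡ adj y x
open Graph public

Vtx : ℕ → ℕ → Set
Vtx m d = Fin d → Fin m

allVtx : (m d : ℕ) → List (Vtx m d)
allVtx m d = map finToFun (allFin (m ^ d))

succMod : (m : ℕ) → Fin m → Fin m → Bool
succMod zero    a b = false
succMod (suc k) a b = ((toℕ b + 1) % suc k) ≡ᵇ toℕ a

diff1 : (m : ℕ) → Fin m → Fin m → Bool
diff1 m a b = succMod m a b ∨ succMod m b a

eqF : ∀ {m} → Fin m → Fin m → Bool
eqF a b = ⌊ a ≟ b ⌋

adjT : (m d : ℕ) → Vtx m d → Vtx m d → Bool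
adjT m d u v =
  any (λ i → diff1 m (u i) (v i) ∧ all (λ j → eqF j i ∨ eqF (u j) (v j)) (allFin d)) (allFin d)

coordSum : ∀ {m d} → Vtx m d → ℕ
coordSum {m} {d} x = foldr (λ i s → toℕ (x i) + s) 0 (allFin d)

isEven : ∀ {m d} → Vtx m d → Bool
isEven x = (coordSum x % 2) ≡ᵇ 0

-- every map f : Vtx m d → Fin n arises exactly once as g ∘ funToFin
-- with g : Fin (m ^ d) → Fin n; enumerate all such g.
allFuns : (N k : ℕ) → List (Fin N → Fin k)
allFuns zero    k = (λ ()) ∷ []
allFuns (suc N) k =
  concatMap (λ a → map (λ g → λ { Fin.zero → a ; (Fin.suc i) → g i }) (allFuns N k)) (allFin k)

allMaps : (m d k : ℕ) → List (Vtx m d → Fin k)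
allMaps m d k = map (λ g → λ x → g (funToFin x)) (allFuns (m ^ d) k)

isHom : (H : Graph) (m d : ℕ) → (Vtx m d → Fin (n H)) → Bool
isHom H m d f =
  all (λ u → all (λ v → not (adjT m d u v) ∨ adj H (f u) (f v)) (allVtx m d)) (allVtx m d)

Homs : (H : Graph) (m d : ℕ) → List (Vtx m d → Fin (n H))
Homs H m d = boolFilter (isHom H m d) (allMaps m d (n H))

allSubsets : (k : ℕ) → List (Subset k)
allSubsets zero    = [] ∷ []
allSubsets (suc k) = concatMap (λ b → map (b ∷_) (allSubsets k)) (true ∷ false ∷ [])

memb : ∀ {k} → Fin k → Subset k → Bool
memb i A = Data.Vec.lookup A i

compl : (H : Graph) → Subset (n H) → Subset (n H) → Bool
compl H A B =
  all (λ a → all (λ b → not (memb a A ∧ memb b B) ∨ adj H a b) (allFin (n H))) (allFin (n H))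

η : Graph → ℕ
η H = foldr _⊔_ 0
  (concatMap (λ A → map (λ B → if compl H A B then ∣ A ∣ * ∣ B ∣ else 0) (allSubsets (n H)))
             (allSubsets (n H)))

inM : (H : Graph) → Subset (n H) → Subset (n H) → Bool
inM H A B = compl H A B ∧ (∣ A ∣ * ∣ B ∣ ≡ᵇ η H)

imgN : (H : Graph) (m d : ℕ) → (Vtx m d → Fin (n H)) → Vtx m d → Subset (n H)
imgN H m d f x = tabulate (λ i → any (λ w → adjT m d x w ∧ eqF (f w) i) (allVtx m d))

-- edge uv with u ∈ ℰ is ideal w.r.t. f iff f(N_u) = B and f(N_v) = A for some
-- (A , B) ∈ 𝓜(H), i.e. iff (f(N_v) , f(N_u)) ∈ 𝓜(H)
ideal : (H : Graph) (m d : ℕ) → (Vtx m d → Fin (n H)) → Vtx m d → Vtx m d → Bool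
ideal H m d f u v = inM H (imgN H m d f v) (imgN H m d f u)

numNonIdeal : (H : Graph) (m d : ℕ) → Vtx m d → Vtx m d → ℕ
numNonIdeal H m d u v = length (boolFilter (λ f → not (ideal H m d f u v)) (Homs H m d))

numHom : (H : Graph) (m d : ℕ) → ℕ
numHom H m d = length (Homs H m d)

{-# OPTIONS --safe #-}
module Submission where

open import Defs hiding (sym; n)
open import Data.Bool as Bool using (Bool; true; false; not; if_then_else_; _∧_; _∨_; _xor_)
open import Data.Bool.ListAction using (any; all)
open import Data.Bool.Properties using (not-involutive; not-injective; T-≡; ∨-zeroʳ)
open import Data.Empty using (⊥-elim)
open import Data.Fin as Fin using (Fin; zero; suc; toℕ; fromℕ; fromℕ<; inject₁; finToFun; funToFin; combine)
open import Data.Fin.Properties as Fin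
  using (_≟_; all?; any?; injective⇒≤; toℕ-fromℕ<; toℕ-fromℕ; toℕ-inject₁; toℕ-injective; toℕ<n; toℕ≤pred[n];
         funToFin-finToFin; finToFun-funToFin)
open import Data.Fin.Subset using (Subset; ∣_∣)
open import Data.List using (List; []; _∷_; _++_; map; concatMap; length; allFin; filter; foldr)
open import Data.List.Properties using (length-map; map-tabulate; length-tabulate)
open import Data.List.Membership.Propositional using (_∈_)
open import Data.List.Membership.Propositional.Properties
  using (∈-allFin; ∈-concatMap⁺; ∈-concatMap⁻; ∈-map⁺; ∈-map⁻)
open import Data.List.Membership.Propositional.Properties.WithK using (unique∧set⇒bag)
open import Data.List.Relation.Binary.BagAndSetEquality using (∼bag⇒↭)
open import Data.List.Relation.Binary.Permutation.Propositional as Perm using (_↭_; ↭-sym)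
open import Data.List.Relation.Binary.Permutation.Propositional.Properties using (All-resp-↭)
open import Data.List.Relation.Unary.All as All using (All; []; _∷_)
import Data.List.Relation.Unary.All.Properties as All
open import Data.List.Relation.Unary.AllPairs as AllPairs using (AllPairs; []; _∷_)
import Data.List.Relation.Unary.AllPairs.Properties as AllPairs
open import Data.List.Relation.Unary.Any as Any using (here; there)
open import Data.List.Relation.Unary.Sorted.TotalOrder.Properties using (Sorted⇒AllPairs)
open import Data.List.Relation.Unary.Unique.Propositional using (Unique)
import Data.List.Relation.Unary.Unique.Propositional.Properties as Unique
import Data.List.Sort
open import Data.Nat hiding (_≟_)
import Data.Nat as ℕ
open import Data.Nat.DivMod using (m<n⇒m%n≡m; n%n≡0; m≡m%n+[m/n]*n; m%n<n; m/n*n≤m)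
open import Data.Nat.Properties hiding (_≟_)
open import Data.Nat.Tactic.RingSolver using (solve-∀)
open import Data.Product using (Σ; _×_; _,_; proj₁; proj₂; ∃; ∃₂)
open import Data.Sum using (_⊎_; inj₁; inj₂)
open import Data.Vec as Vec using (Vec; []; _∷_; lookup; tabulate; _[_]≔_)
open import Data.Vec.Properties
  using (∷-injective; lookup∘tabulate; tabulate∘lookup; tabulate-cong; lookup∘update; lookup∘update′;
         lookup-replicate; []≔-idempotent)
open import Function using (_∘_; id; mk⇔)
open import Function.Bundles using (Equivalence)
open import Relation.Binary.Bundles using (DecTotalOrder)
import Relation.Binary.Construct.Flip.EqAndOrd as Flip
import Relation.Binary.Construct.On as On
open import Relation.Binary.PropositionalEquality hiding (J)
open import Relation.Nullary using (Dec; yes; no; ¬_; does)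
open import Relation.Nullary.Decidable using (map′; _→-dec_; _×-dec_; _⊎-dec_; ¬?; decidable-stable)

-- Reveal a uniformly random homomorphism f along an order that is compatible with the coordinatewise one, and pair the
-- sites into the edges {u, e i u} of direction i. Let X and Y be the sets of colours already seen around the two ends.
-- The colour of u lies in the set of common neighbours of X; predict that of e i u to be a common neighbour of Y lying
-- in X. If the prediction holds there are at most η choices for the two colours, since X is complete to its common
-- neighbours, and strictly fewer unless the pair is tight. There are at least η^(N/2) homomorphisms, so the tight pairs
-- with correct predictions account for almost everything: up to an error 2^(-g), the frequency of loose pairs is at most
-- O(g) times that of failed predictions.
--
-- By translation invariance the order can be randomised while the observer o stays fixed. A colour carried by k
-- neighbours of o is missed by the past with probability exponentially small in k, so that predictions fail with
-- frequency O(1/d) and only around bad sites, those with a colour carried by few neighbours. Resampling the neighbours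
-- of o shows that such a colour is, up to an exponentially small probability, forbidden at many neighbours of o, and
-- this produces loose pairs. Hence P(bad) ≤ O(g/d) P(bad) + 2^(-Ω(d)), which for g = c d with c small makes bad sites
-- exponentially rare. Around good sites the edges are ideal.

-- Good ends alone do not make `uv` ideal: the two image sizes must also have product `η`. Two
-- further defects can prevent this. Either the colours around `u` and those allowed at `u` have
-- product below `η`; patterns that reveal the whole neighbourhood of `u` then give pairs that are
-- not tight. Or a colour allowed at `u` is absent around `v`; giving it to `u` makes `v` bad.
--
-- The factor `O(g/d)` balances two counts. An error `2^(-g)` forces the weight `F` to be of order
-- `2^g`, so that a failed prediction costs about `g` bits. Yet over all `d` directions only a
-- bounded number of predictions fails on average: a colour on `μ` neighbours is missed with
-- probability at most `(1 - 1/m)^μ`, and `μ (1 - 1/m)^μ` is bounded. A colour that is seen but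
-- widely forbidden, in contrast, spoils at least `ℓ - 1` directions, each with probability at least
-- `m^(-3)`, and `ℓ` is linear in `d`.
--
-- Probabilities are integer counts with the denominators multiplied out, and products of weights
-- stand in for entropies, so no logarithm occurs.

private variable
  A B : Set

-- Finite sums, products and indicators

∑ : {A : Set} → List A → (A → ℕ) → ℕ
∑ []       φ = 0
∑ (x ∷ xs) φ = φ x + ∑ xs φ

∏ : {A : Set} → List A → (A → ℕ) → ℕ
∏ []       φ = 1
∏ (x ∷ xs) φ = φ x * ∏ xs φ


∑-cong : ∀ (xs : List A) {φ ψ : A → ℕ} → (∀ x → φ x ≡ ψ x) → ∑ xs φ ≡ ∑ xs ψ
∑-cong []       h = refl
∑-cong (x ∷ xs) h = cong₂ _+_ (h x) (∑-cong xs h)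

∏-cong : ∀ (xs : List A) {φ ψ : A → ℕ} → (∀ x → φ x ≡ ψ x) → ∏ xs φ ≡ ∏ xs ψ
∏-cong []       h = refl
∏-cong (x ∷ xs) h = cong₂ _*_ (h x) (∏-cong xs h)

∑-mono : ∀ (xs : List A) {φ ψ : A → ℕ} → (∀ x → φ x ≤ ψ x) → ∑ xs φ ≤ ∑ xs ψ
∑-mono []       h = z≤n
∑-mono (x ∷ xs) h = +-mono-≤ (h x) (∑-mono xs h)

∏-mono-All : ∀ {xs : List A} {φ ψ : A → ℕ} → All (λ x → φ x ≤ ψ x) xs → ∏ xs φ ≤ ∏ xs ψ
∏-mono-All []       = ≤-refl
∏-mono-All (p ∷ ps) = *-mono-≤ p (∏-mono-All ps)

∏-mono : ∀ (xs : List A) {φ ψ : A → ℕ} → (∀ x → φ x ≤ ψ x) → ∏ xs φ ≤ ∏ xs ψ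
∏-mono xs h = ∏-mono-All (All.universal h xs)

+-interchange : ∀ a b c d → (a + b) + (c + d) ≡ (a + c) + (b + d)
+-interchange = solve-∀

*-interchange : ∀ a b c d → (a * b) * (c * d) ≡ (a * c) * (b * d)
*-interchange = solve-∀

∑-+ : ∀ (xs : List A) (φ ψ : A → ℕ) → ∑ xs (λ x → φ x + ψ x) ≡ ∑ xs φ + ∑ xs ψ
∑-+ []       φ ψ = refl
∑-+ (x ∷ xs) φ ψ rewrite ∑-+ xs φ ψ = +-interchange (φ x) (ψ x) (∑ xs φ) (∑ xs ψ)

∏-* : ∀ (xs : List A) (φ ψ : A → ℕ) → ∏ xs (λ x → φ x * ψ x) ≡ ∏ xs φ * ∏ xs ψ
∏-* []       φ ψ = refl
∏-* (x ∷ xs) φ ψ rewrite ∏-* xs φ ψ = *-interchange (φ x) (ψ x) (∏ xs φ) (∏ xs ψ)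

∑-*ˡ : ∀ (xs : List A) k (φ : A → ℕ) → ∑ xs (λ x → k * φ x) ≡ k * ∑ xs φ
∑-*ˡ []       k φ = sym (*-zeroʳ k)
∑-*ˡ (x ∷ xs) k φ rewrite ∑-*ˡ xs k φ = sym (*-distribˡ-+ k (φ x) (∑ xs φ))

∑-const : ∀ (xs : List A) k → ∑ xs (λ _ → k) ≡ length xs * k
∑-const []       k = refl
∑-const (x ∷ xs) k = cong (k +_) (∑-const xs k)

∑-zero : ∀ (xs : List A) → ∑ xs (λ _ → 0) ≡ 0
∑-zero xs = trans (∑-const xs 0) (*-zeroʳ (length xs))

∏-const : ∀ (xs : List A) k → ∏ xs (λ _ → k) ≡ k ^ length xs
∏-const []       k = refl
∏-const (x ∷ xs) k = cong (k *_) (∏-const xs k)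

∏-^ : ∀ (xs : List A) k (φ : A → ℕ) → ∏ xs (λ x → k ^ φ x) ≡ k ^ ∑ xs φ
∏-^ []       k φ = refl
∏-^ (x ∷ xs) k φ rewrite ∏-^ xs k φ = sym (^-distribˡ-+-* k (φ x) (∑ xs φ))

^-distribʳ-* : ∀ k a b → (a * b) ^ k ≡ a ^ k * b ^ k
^-distribʳ-* zero    a b = refl
^-distribʳ-* (suc k) a b rewrite ^-distribʳ-* k a b = *-interchange a b (a ^ k) (b ^ k)

∑-++ : ∀ (xs ys : List A) (φ : A → ℕ) → ∑ (xs ++ ys) φ ≡ ∑ xs φ + ∑ ys φ
∑-++ []       ys φ = refl
∑-++ (x ∷ xs) ys φ rewrite ∑-++ xs ys φ = sym (+-assoc (φ x) (∑ xs φ) (∑ ys φ))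

∑-map : ∀ (g : B → A) (xs : List B) (φ : A → ℕ) → ∑ (map g xs) φ ≡ ∑ xs (φ ∘ g)
∑-map g []       φ = refl
∑-map g (x ∷ xs) φ = cong (φ (g x) +_) (∑-map g xs φ)

∏-map : ∀ (g : B → A) (xs : List B) (φ : A → ℕ) → ∏ (map g xs) φ ≡ ∏ xs (φ ∘ g)
∏-map g []       φ = refl
∏-map g (x ∷ xs) φ = cong (φ (g x) *_) (∏-map g xs φ)

∑-concatMap : ∀ (g : B → List A) (xs : List B) (φ : A → ℕ) →
  ∑ (concatMap g xs) φ ≡ ∑ xs (λ x → ∑ (g x) φ)
∑-concatMap g []       φ = refl
∑-concatMap g (x ∷ xs) φ = trans (∑-++ (g x) (concatMap g xs) φ) (cong (∑ (g x) φ +_) (∑-concatMap g xs φ))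

∑-swap : ∀ (xs : List A) (ys : List B) (φ : A → B → ℕ) →
  ∑ xs (λ x → ∑ ys (φ x)) ≡ ∑ ys (λ y → ∑ xs (λ x → φ x y))
∑-swap []       ys φ = sym (∑-zero ys)
∑-swap (x ∷ xs) ys φ rewrite ∑-swap xs ys φ = sym (∑-+ ys (φ x) (λ y → ∑ xs (λ x → φ x y)))

∑-↭ : ∀ {xs ys : List A} (φ : A → ℕ) → xs ↭ ys → ∑ xs φ ≡ ∑ ys φ
∑-↭ φ Perm.refl         = refl
∑-↭ φ (Perm.prep x p)   = cong (φ x +_) (∑-↭ φ p)
∑-↭ φ (Perm.swap {xs} {ys} x y p) rewrite ∑-↭ φ p = lemma (φ x) (φ y) (∑ ys φ)
  where
  lemma : ∀ a b c → a + (b + c) ≡ b + (a + c)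
  lemma = solve-∀
∑-↭ φ (Perm.trans p q)  = trans (∑-↭ φ p) (∑-↭ φ q)

∑-∈ : ∀ {xs : List A} {x} (φ : A → ℕ) → x ∈ xs → φ x ≤ ∑ xs φ
∑-∈ φ (here refl) = m≤m+n _ _
∑-∈ {xs = y ∷ _} φ (there p) = ≤-trans (∑-∈ φ p) (m≤n+m _ (φ y))

allFin-suc : ∀ n → allFin (suc n) ≡ zero ∷ map suc (allFin n)
allFin-suc n = cong (zero ∷_) (sym (map-tabulate id suc))

length-allFin : ∀ n → length (allFin n) ≡ n
length-allFin n = length-tabulate id

∑-ones : ∀ n → ∑ (allFin n) (λ _ → 1) ≡ n
∑-ones n = trans (∑-const (allFin n) 1) (trans (*-identityʳ _) (length-allFin n))

∑-allFin-suc : ∀ n (φ : Fin (suc n) → ℕ) → ∑ (allFin (suc n)) φ ≡ φ zero + ∑ (allFin n) (φ ∘ suc)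
∑-allFin-suc n φ = trans (cong (λ xs → ∑ xs φ) (allFin-suc n)) (cong (φ zero +_) (∑-map suc (allFin n) φ))

∏-allFin-suc : ∀ n (φ : Fin (suc n) → ℕ) → ∏ (allFin (suc n)) φ ≡ φ zero * ∏ (allFin n) (φ ∘ suc)
∏-allFin-suc n φ = trans (cong (λ xs → ∏ xs φ) (allFin-suc n)) (cong (φ zero *_) (∏-map suc (allFin n) φ))

𝟙 : {P : Set} → Dec P → ℕ
𝟙 (yes _) = 1
𝟙 (no _)  = 0

𝟙-yes : {P : Set} (d : Dec P) → P → 𝟙 d ≡ 1
𝟙-yes (yes _) p = refl
𝟙-yes (no ¬p) p = ⊥-elim (¬p p)

𝟙-no : {P : Set} (d : Dec P) → ¬ P → 𝟙 d ≡ 0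
𝟙-no (yes p) ¬p = ⊥-elim (¬p p)
𝟙-no (no _)  ¬p = refl

𝟙-mono : {P Q : Set} (d : Dec P) (e : Dec Q) → (P → Q) → 𝟙 d ≤ 𝟙 e
𝟙-mono (yes p) e h rewrite 𝟙-yes e (h p) = ≤-refl
𝟙-mono (no _)  e h = z≤n

𝟙-cong : {P Q : Set} (d : Dec P) (e : Dec Q) → (P → Q) → (Q → P) → 𝟙 d ≡ 𝟙 e
𝟙-cong d e f g = ≤-antisym (𝟙-mono d e f) (𝟙-mono e d g)

𝟙≤1 : {P : Set} (d : Dec P) → 𝟙 d ≤ 1
𝟙≤1 (yes _) = ≤-refl
𝟙≤1 (no _)  = z≤n

𝟙-≤ : {P : Set} (d : Dec P) {k : ℕ} → (P → 1 ≤ k) → 𝟙 d ≤ k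
𝟙-≤ (yes p) h = h p
𝟙-≤ (no _)  h = z≤n

𝟙-*-mono : {P : Set} (d : Dec P) {a b : ℕ} → (P → a ≤ b) → 𝟙 d * a ≤ 𝟙 d * b
𝟙-*-mono (yes p) h = *-monoʳ-≤ 1 (h p)
𝟙-*-mono (no _)  h = z≤n

𝟙*-≤ : {P : Set} (d : Dec P) (a : ℕ) → 𝟙 d * a ≤ a
𝟙*-≤ (yes p) a = ≤-reflexive (*-identityˡ a)
𝟙*-≤ (no _)  a = z≤n

-- Powers and means

-- The convex function `t ^ suc k` lies above its tangent at `y`, with the negative term moved
-- across. AM-GM and both estimates of powers of `1 + 1/n` come from this inequality.
young : ∀ k z y → (suc k) * (z * y ^ k) ≤ z ^ suc k + k * y ^ suc k
young zero    z y = ≤-reflexive (lemma z)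
  where
  lemma : ∀ z → z * 1 + 0 ≡ z * 1 + 0
  lemma z = refl
young (suc k) z y = +-cancelˡ-≤ (z * (k * y ^ suc k)) _ _ (begin
    z * (k * y ^ suc k) + suc (suc k) * (z * (y ^ suc k))
      ≡⟨ l₁ z y k (y ^ k) ⟩
    suc k * (y ^ k * (2 * (z * y)))
      ≤⟨ *-monoʳ-≤ (suc k) (*-monoʳ-≤ (y ^ k) (sq z y)) ⟩
    suc k * (y ^ k * (z * z + y * y))
      ≡⟨ l₂ z y k (y ^ k) ⟩
    z * (suc k * (z * y ^ k)) + suc k * y ^ suc (suc k)
      ≤⟨ +-monoˡ-≤ _ (*-monoʳ-≤ z (young k z y)) ⟩
    z * (z ^ suc k + k * y ^ suc k) + suc k * y ^ suc (suc k)
      ≡⟨ l₃ z (z ^ suc k) (k * y ^ suc k) (suc k * y ^ suc (suc k)) ⟩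
    z * (k * y ^ suc k) + (z ^ suc (suc k) + suc k * y ^ suc (suc k)) ∎)
  where
  open ≤-Reasoning
  sq-aux : ∀ a e → 2 * (a * (a + e)) ≤ a * a + (a + e) * (a + e)
  sq-aux a e = ≤-trans (m≤m+n _ (e * e)) (≤-reflexive (r a e))
    where
    r : ∀ a e → 2 * (a * (a + e)) + e * e ≡ a * a + (a + e) * (a + e)
    r = solve-∀
  sq : ∀ a b → 2 * (a * b) ≤ a * a + b * b
  sq a b with ≤-total a b
  ... | inj₁ a≤b with e , refl ← m≤n⇒∃[o]m+o≡n a≤b = sq-aux a e
  ... | inj₂ b≤a with e , refl ← m≤n⇒∃[o]m+o≡n b≤a =
        ≤-trans (≤-reflexive (cong (2 *_) (*-comm (b + e) b)))
          (≤-trans (sq-aux b e) (≤-reflexive (+-comm (b * b) _)))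
  l₁ : ∀ z y k p → z * (k * (y * p)) + suc (suc k) * (z * (y * p)) ≡ suc k * (p * (2 * (z * y)))
  l₁ = solve-∀
  l₂ : ∀ z y k p → suc k * (p * (z * z + y * y)) ≡ z * (suc k * (z * p)) + suc k * (y * (y * p))
  l₂ = solve-∀
  l₃ : ∀ z a b c → z * (a + b) + c ≡ z * b + (z * a + c)
  l₃ = solve-∀

-- Young's inequality at the new mean `(s + x)/(k + 1)` and the old mean `s/k`, both scaled by
-- `k (k + 1)` to stay natural numbers.
am-gm-step : ∀ k x s → suc k ^ suc k * (x * s ^ k) ≤ k ^ k * (s + x) ^ suc k
am-gm-step zero x s = ≤-trans (≤-reflexive (l₀ x)) (≤-trans (m≤n+m x s) (≤-reflexive (sym (l₀ (s + x)))))
  where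
  l₀ : ∀ x → 1 * (x * 1) ≡ x
  l₀ = solve-∀
am-gm-step k@(suc k′) x s = *-cancelˡ-≤ k (+-cancelʳ-≤ (k * (suc k * s) ^ suc k) _ _ (begin
    k * (suc k ^ suc k * (x * s ^ k)) + k * (suc k * s) ^ suc k
      ≡⟨ cong (λ t → k * (suc k ^ suc k * (x * s ^ k)) + k * (suc k * s * t)) (^-distribʳ-* k (suc k) s) ⟩
    k * (suc k ^ suc k * (x * s ^ k)) + k * (suc k * s * (suc k ^ k * s ^ k))
      ≡⟨ l₁ k x s (suc k ^ k) (s ^ k) ⟩
    suc k * (k * (s + x) * (suc k ^ k * s ^ k))
      ≡⟨ cong (λ t → suc k * (k * (s + x) * t)) (^-distribʳ-* k (suc k) s) ⟨
    suc k * (k * (s + x) * (suc k * s) ^ k)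
      ≤⟨ young k (k * (s + x)) (suc k * s) ⟩
    (k * (s + x)) ^ suc k + k * (suc k * s) ^ suc k
      ≡⟨ cong (_+ k * (suc k * s) ^ suc k) (^-distribʳ-* (suc k) k (s + x)) ⟩
    k ^ suc k * (s + x) ^ suc k + k * (suc k * s) ^ suc k
      ≡⟨ cong (_+ k * (suc k * s) ^ suc k) (*-assoc k (k ^ k) ((s + x) ^ suc k)) ⟩
    k * (k ^ k * (s + x) ^ suc k) + k * (suc k * s) ^ suc k ∎))
  where
  open ≤-Reasoning
  l₁ : ∀ k x s p q → k * ((suc k * p) * (x * q)) + k * (suc k * s * (p * q))
       ≡ suc k * (k * (s + x) * (p * q))
  l₁ = solve-∀

am-gm : ∀ (xs : List A) (φ : A → ℕ) → length xs ^ length xs * ∏ xs φ ≤ ∑ xs φ ^ length xs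
am-gm []            φ = ≤-refl
am-gm (x ∷ [])      φ = ≤-reflexive (lemma (φ x))
  where
  lemma : ∀ a → 1 * 1 * (a * 1) ≡ (a + 0) * 1
  lemma = solve-∀
am-gm (x ∷ xs@(_ ∷ _)) φ = *-cancelˡ-≤ (l ^ l) {{m^n≢0 l l}} (begin
    l ^ l * (suc l ^ suc l * (φ x * ∏ xs φ)) ≡⟨ l₁ (l ^ l) (suc l ^ suc l) (φ x) (∏ xs φ) ⟩
    suc l ^ suc l * (φ x * (l ^ l * ∏ xs φ)) ≤⟨ *-monoʳ-≤ (suc l ^ suc l) (*-monoʳ-≤ (φ x) (am-gm xs φ)) ⟩
    suc l ^ suc l * (φ x * ∑ xs φ ^ l)       ≤⟨ am-gm-step l (φ x) (∑ xs φ) ⟩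
    l ^ l * (∑ xs φ + φ x) ^ suc l           ≡⟨ cong (λ t → l ^ l * t ^ suc l) (+-comm (∑ xs φ) (φ x)) ⟩
    l ^ l * (φ x + ∑ xs φ) ^ suc l ∎)
  where
  open ≤-Reasoning
  l = length xs
  l₁ : ∀ a b c d → a * (b * (c * d)) ≡ b * (c * (a * d))
  l₁ = solve-∀

-- Bernoulli's inequality for `(1 + 1/n) ^ n` with `n = suc k`, multiplied out.
double-pow : ∀ k → 2 * suc k ^ suc k ≤ suc (suc k) ^ suc k
double-pow k = +-cancelʳ-≤ (k * suc k ^ suc k) _ _ (begin
    2 * suc k ^ suc k + k * suc k ^ suc k ≡⟨ l₁ k (suc k ^ k) ⟩
    suc k * (suc (suc k) * suc k ^ k)     ≤⟨ young k (suc (suc k)) (suc k) ⟩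
    suc (suc k) ^ suc k + k * suc k ^ suc k ∎)
  where
  open ≤-Reasoning
  l₁ : ∀ k p → 2 * (suc k * p) + k * (suc k * p) ≡ suc k * (suc (suc k) * p)
  l₁ = solve-∀

-- Configurations as vectors, and resampling of sites

vecs : (n k : ℕ) → List (Vec (Fin k) n)
vecs zero    k = [] ∷ []
vecs (suc n) k = concatMap (λ a → map (a ∷_) (vecs n k)) (allFin k)

∑-vecs-suc : ∀ n k (Φ : Vec (Fin k) (suc n) → ℕ) →
  ∑ (vecs (suc n) k) Φ ≡ ∑ (allFin k) (λ a → ∑ (vecs n k) (λ v → Φ (a ∷ v)))
∑-vecs-suc n k Φ = trans (∑-concatMap _ (allFin k) Φ)
  (∑-cong (allFin k) (λ a → ∑-map (a ∷_) (vecs n k) Φ))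

length-vecs : ∀ n k → ∑ (vecs n k) (λ _ → 1) ≡ k ^ n
length-vecs zero    k = refl
length-vecs (suc n) k = begin
  ∑ (vecs (suc n) k) (λ _ → 1)                        ≡⟨ ∑-vecs-suc n k _ ⟩
  ∑ (allFin k) (λ _ → ∑ (vecs n k) (λ _ → 1))         ≡⟨ ∑-const (allFin k) _ ⟩
  length (allFin k) * ∑ (vecs n k) (λ _ → 1)          ≡⟨ cong₂ _*_ (length-allFin k) (length-vecs n k) ⟩
  k * k ^ n ∎
  where open ≡-Reasoning

∑-vecs-∏ : ∀ {k} n (g : Fin n → Fin k → ℕ) →
  ∑ (vecs n k) (λ v → ∏ (allFin n) (λ j → g j (lookup v j))) ≡ ∏ (allFin n) (λ j → ∑ (allFin k) (g j))
∑-vecs-∏         zero    g = refl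
∑-vecs-∏ {k} (suc n) g = begin
  ∑ (vecs (suc n) k) (λ v → ∏ (allFin (suc n)) (λ j → g j (lookup v j)))
    ≡⟨ ∑-vecs-suc n k _ ⟩
  ∑ (allFin k) (λ a → ∑ (vecs n k) (λ v → ∏ (allFin (suc n)) (λ j → g j (lookup (a ∷ v) j))))
    ≡⟨ ∑-cong (allFin k) (λ a → trans (∑-cong (vecs n k) (λ v → ∏-allFin-suc n (λ j → g j (lookup (a ∷ v) j))))
         (∑-*ˡ (vecs n k) (g zero a) (λ v → ∏ (allFin n) (λ j → g (suc j) (lookup v j))))) ⟩
  ∑ (allFin k) (λ a → g zero a * ∑ (vecs n k) (λ v → ∏ (allFin n) (λ j → g (suc j) (lookup v j))))
    ≡⟨ ∑-cong (allFin k) (λ a → trans (cong (g zero a *_) (∑-vecs-∏ n (g ∘ suc))) (*-comm (g zero a) _)) ⟩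
  ∑ (allFin k) (λ a → ∏ (allFin n) (λ j → ∑ (allFin k) (g (suc j))) * g zero a)
    ≡⟨ ∑-*ˡ (allFin k) (∏ (allFin n) (λ j → ∑ (allFin k) (g (suc j)))) (g zero) ⟩
  ∏ (allFin n) (λ j → ∑ (allFin k) (g (suc j))) * ∑ (allFin k) (g zero)
    ≡⟨ *-comm _ (∑ (allFin k) (g zero)) ⟩
  ∑ (allFin k) (g zero) * ∏ (allFin n) (λ j → ∑ (allFin k) (g (suc j)))
    ≡⟨ ∏-allFin-suc n (λ j → ∑ (allFin k) (g j)) ⟨
  ∏ (allFin (suc n)) (λ j → ∑ (allFin k) (g j)) ∎
  where open ≡-Reasoning

∈-vecs : ∀ {k n} (v : Vec (Fin k) n) → v ∈ vecs n k
∈-vecs []      = here refl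
∈-vecs {k} (a ∷ v) = ∈-concatMap⁺ (λ a → map (a ∷_) (vecs _ k)) (lemma (∈-allFin a))
  where
  lemma : ∀ {xs} → a ∈ xs → Any.Any (λ b → (a ∷ v) ∈ map (b ∷_) (vecs _ k)) xs
  lemma = Any.map (λ { refl → ∈-map⁺ (a ∷_) (∈-vecs v) })

unique-vecs : ∀ n k → Unique (vecs n k)
unique-vecs zero    k = [] ∷ []
unique-vecs (suc n) k = Unique.concat⁺
  (All.map⁺ (All.universal (λ a → Unique.map⁺ (λ e → proj₂ (∷-injective e)) (unique-vecs n k)) (allFin k)))
  (AllPairs.map⁺ (AllPairs.map disjoint (Unique.allFin⁺ k)))
  where
  disjoint : ∀ {a b : Fin k} → a ≢ b → ∀ {v} → ¬ (v ∈ map (a ∷_) (vecs n k) × v ∈ map (b ∷_) (vecs n k))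
  disjoint a≢b (p , q) with ∈-map⁻ _ p | ∈-map⁻ _ q
  ... | _ , _ , e | _ , _ , e′ = a≢b (proj₁ (∷-injective (trans (sym e) e′)))

∑-bijection : ∀ {xs : List A} {ys : List B} → Unique xs → Unique ys →
  (∀ x → x ∈ xs) → (∀ y → y ∈ ys) → (g : A → B) (h : B → A) →
  (∀ x → h (g x) ≡ x) → (∀ y → g (h y) ≡ y) →
  (φ : B → ℕ) → ∑ xs (φ ∘ g) ≡ ∑ ys φ
∑-bijection {xs = xs} {ys} ux uy cx cy g h hg gh φ = trans (sym (∑-map g xs φ)) (∑-↭ φ (∼bag⇒↭
  (unique∧set⇒bag (Unique.map⁺ (λ {x} {y} e → trans (sym (hg x)) (trans (cong h e) (hg y))) ux) uy
    (λ {y} → mk⇔ (λ _ → cy y) (λ _ → subst (_∈ map g xs) (gh y) (∈-map⁺ g (cx (h y))))))))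

-- Uniform recolouring of one site preserves the counting measure: each configuration arises exactly
-- `k` times as `f [ x ]≔ c`.
exchange : ∀ {n k} (x : Fin n) (Φ : Vec (Fin k) n → ℕ) →
  k * ∑ (vecs n k) Φ ≡ ∑ (vecs n k) (λ f → ∑ (allFin k) (λ c → Φ (f [ x ]≔ c)))
exchange {suc n} {k} zero Φ = begin
  k * ∑ (vecs (suc n) k) Φ
    ≡⟨ cong₂ _*_ (sym (length-allFin k)) (trans (∑-vecs-suc n k Φ) (∑-swap (allFin k) (vecs n k) _)) ⟩
  length (allFin k) * ∑ (vecs n k) (λ v → ∑ (allFin k) (λ c → Φ (c ∷ v)))
    ≡⟨ ∑-const (allFin k) _ ⟨
  ∑ (allFin k) (λ _ → ∑ (vecs n k) (λ v → ∑ (allFin k) (λ c → Φ (c ∷ v))))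
    ≡⟨ ∑-vecs-suc n k _ ⟨
  ∑ (vecs (suc n) k) (λ f → ∑ (allFin k) (λ c → Φ (f [ zero ]≔ c))) ∎
  where
  open ≡-Reasoning
exchange {suc n} {k} (suc x) Φ = begin
  k * ∑ (vecs (suc n) k) Φ
    ≡⟨ cong (k *_) (∑-vecs-suc n k Φ) ⟩
  k * ∑ (allFin k) (λ a → ∑ (vecs n k) (λ v → Φ (a ∷ v)))
    ≡⟨ ∑-*ˡ (allFin k) k _ ⟨
  ∑ (allFin k) (λ a → k * ∑ (vecs n k) (λ v → Φ (a ∷ v)))
    ≡⟨ ∑-cong (allFin k) (λ a → exchange x (λ v → Φ (a ∷ v))) ⟩
  ∑ (allFin k) (λ a → ∑ (vecs n k) (λ v → ∑ (allFin k) (λ c → Φ (a ∷ (v [ x ]≔ c)))))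
    ≡⟨ ∑-vecs-suc n k _ ⟨
  ∑ (vecs (suc n) k) (λ f → ∑ (allFin k) (λ c → Φ (f [ suc x ]≔ c))) ∎
  where open ≡-Reasoning

∑upd : ∀ {n k} → List (Fin n) → (Vec (Fin k) n → ℕ) → Vec (Fin k) n → ℕ
∑upd []               Φ f = Φ f
∑upd {k = k} (x ∷ xs) Φ f = ∑ (allFin k) (λ c → ∑upd xs Φ (f [ x ]≔ c))

exchanges : ∀ {n k} (xs : List (Fin n)) (Φ : Vec (Fin k) n → ℕ) →
  k ^ length xs * ∑ (vecs n k) Φ ≡ ∑ (vecs n k) (∑upd xs Φ)
exchanges []       Φ = *-identityˡ _
exchanges {n} {k} (x ∷ xs) Φ = begin
  k * k ^ length xs * ∑ (vecs n k) Φ   ≡⟨ *-assoc k _ _ ⟩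
  k * (k ^ length xs * ∑ (vecs n k) Φ) ≡⟨ cong (k *_) (exchanges xs Φ) ⟩
  k * ∑ (vecs n k) (∑upd xs Φ)         ≡⟨ exchange x (∑upd xs Φ) ⟩
  ∑ (vecs n k) (∑upd (x ∷ xs) Φ) ∎
  where open ≡-Reasoning

Indep : ∀ {n k} → Fin n → (Vec (Fin k) n → ℕ) → Set
Indep {k = k} x Φ = ∀ f (c : Fin k) → Φ (f [ x ]≔ c) ≡ Φ f

∑upd-indep : ∀ {n k} (xs : List (Fin n)) (h Ψ : Vec (Fin k) n → ℕ) → All (λ x → Indep x Ψ) xs →
  ∀ f → ∑upd xs (λ f → Ψ f * h f) f ≡ Ψ f * ∑upd xs h f
∑upd-indep []       h Ψ []       f = refl
∑upd-indep {k = k} (x ∷ xs) h Ψ (i ∷ is) f = trans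
  (∑-cong (allFin k) (λ c → trans (∑upd-indep xs h Ψ is (f [ x ]≔ c)) (cong (_* ∑upd xs h (f [ x ]≔ c)) (i f c))))
  (∑-*ˡ (allFin k) (Ψ f) _)

-- After averaging over the sites xs the factor Ψ, which does not see them, comes out of the sum.
eliminate-step : ∀ {k n} .{{_ : NonZero k}} (xs : List (Fin n)) (h Ψ ω : Vec (Fin k) n → ℕ) (D E : ℕ) →
  All (λ x → Indep x Ψ) xs →
  (∀ f → D * ∑upd xs (λ f → ω f * h f) f ≤ E * ∑upd xs h f) →
  D * ∑ (vecs n k) (λ f → Ψ f * (ω f * h f)) ≤ E * ∑ (vecs n k) (λ f → Ψ f * h f)
eliminate-step {k = k} {n = n} xs h Ψ ω D E ind step = *-cancelˡ-≤ K {{m^n≢0 k (length xs)}} (begin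
  K * (D * ∑ V (λ f → Ψ f * (ω f * h f)))      ≡⟨ x∙yz≈y∙xz K D _ ⟩
  D * (K * ∑ V (λ f → Ψ f * (ω f * h f)))      ≡⟨ cong (D *_) (exchanges xs _) ⟩
  D * ∑ V (∑upd xs (λ f → Ψ f * (ω f * h f)))  ≡⟨ ∑-*ˡ V D _ ⟨
  ∑ V (λ f → D * ∑upd xs (λ f → Ψ f * (ω f * h f)) f)
    ≤⟨ ∑-mono V (λ f → ≤-trans (≤-reflexive (trans (cong (D *_) (∑upd-indep xs _ Ψ ind f)) (x∙yz≈y∙xz D (Ψ f) _)))
         (≤-trans (*-monoʳ-≤ (Ψ f) (step f))
           (≤-reflexive (trans (x∙yz≈y∙xz (Ψ f) E _) (cong (E *_) (sym (∑upd-indep xs h Ψ ind f))))))) ⟩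
  ∑ V (λ f → E * ∑upd xs (λ f → Ψ f * h f) f)  ≡⟨ ∑-*ˡ V E _ ⟩
  E * ∑ V (∑upd xs (λ f → Ψ f * h f))          ≡⟨ cong (E *_) (exchanges xs _) ⟨
  E * (K * ∑ V (λ f → Ψ f * h f))              ≡⟨ x∙yz≈y∙xz E K _ ⟩
  K * (E * ∑ V (λ f → Ψ f * h f)) ∎)
  where
  open ≤-Reasoning
  V = vecs n k
  K = k ^ length xs
  x∙yz≈y∙xz : ∀ a b c → a * (b * c) ≡ b * (a * c)
  x∙yz≈y∙xz = solve-∀

-- The head of `bs` is averaged out first, so the later factors must not see its sites, while its
-- own factor may depend on every site. With `h = 1` this bounds the total weight of the code; with
-- `h` the indicator of homomorphisms it is a supermartingale bound for a random homomorphism.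
eliminate : ∀ {k n} .{{_ : NonZero k}} (bs : List B) (sites : B → List (Fin n))
  (h : Vec (Fin k) n → ℕ) (ω : B → Vec (Fin k) n → ℕ) (D E : ℕ) →
  AllPairs (λ b b′ → All (λ x → Indep x (ω b′)) (sites b)) bs →
  All (λ b → ∀ f → D * ∑upd (sites b) (λ f → ω b f * h f) f ≤ E * ∑upd (sites b) h f) bs →
  D ^ length bs * ∑ (vecs n k) (λ f → ∏ bs (λ b → ω b f) * h f) ≤ E ^ length bs * ∑ (vecs n k) h
eliminate [] sites h ω D E ps steps =
  ≤-reflexive (cong (1 *_) (∑-cong (vecs _ _) (λ f → *-identityˡ (h f))))
eliminate {k = k} {n = n} (b ∷ bs) sites h ω D E (p ∷ ps) (step ∷ steps) = begin
  D * D ^ l * ∑ V (λ f → ω b f * Ψ f * h f)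
    ≡⟨ r₁ D (D ^ l) _ ⟩
  D ^ l * (D * ∑ V (λ f → ω b f * Ψ f * h f))
    ≡⟨ cong (λ t → D ^ l * (D * t)) (∑-cong V (λ f → r₂ (ω b f) (Ψ f) (h f))) ⟩
  D ^ l * (D * ∑ V (λ f → Ψ f * (ω b f * h f)))
    ≤⟨ *-monoʳ-≤ (D ^ l) (eliminate-step (sites b) h Ψ (ω b) D E ind step) ⟩
  D ^ l * (E * ∑ V (λ f → Ψ f * h f))
    ≡⟨ r₃ (D ^ l) E _ ⟩
  E * (D ^ l * ∑ V (λ f → Ψ f * h f))
    ≤⟨ *-monoʳ-≤ E (eliminate bs sites h ω D E ps steps) ⟩
  E * (E ^ l * ∑ V h)
    ≡⟨ *-assoc E (E ^ l) _ ⟨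
  E * E ^ l * ∑ V h ∎
  where
  open ≤-Reasoning
  V = vecs n k
  l = length bs
  Ψ : Vec (Fin k) n → ℕ
  Ψ f = ∏ bs (λ b → ω b f)
  indep-∏ : ∀ (bs : List _) x → All (λ b′ → Indep x (ω b′)) bs → Indep x (λ f → ∏ bs (λ b → ω b f))
  indep-∏ []       x []       f c = refl
  indep-∏ (b ∷ bs) x (q ∷ qs) f c = cong₂ _*_ (q f c) (indep-∏ bs x qs f c)
  transpose : ∀ {xs : List (Fin n)} {bs : List _} → All (λ b′ → All (λ x → Indep x (ω b′)) xs) bs →
    All (λ x → All (λ b′ → Indep x (ω b′)) bs) xs
  transpose {[]}     qs = []
  transpose {x ∷ xs} qs = All.map All.head qs ∷ transpose (All.map All.tail qs)
  ind : All (λ x → Indep x Ψ) (sites b)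
  ind = All.map (λ {x} q → indep-∏ bs x q) (transpose p)
  r₁ : ∀ a b c → a * b * c ≡ b * (a * c)
  r₁ = solve-∀
  r₂ : ∀ a b c → a * b * c ≡ b * (a * c)
  r₂ = solve-∀
  r₃ : ∀ a b c → a * (b * c) ≡ b * (a * c)
  r₃ = solve-∀

sets : ∀ {n k} → List (Fin n × Fin k) → Vec (Fin k) n → Vec (Fin k) n
sets []             s = s
sets ((j , a) ∷ ps) s = sets ps (s [ j ]≔ a)

-- Pinning a coordinate costs a factor `k`, since the pinned value is one term of the sum over all
-- values. An event forced by pinned coordinates thus has frequency at least `1/k` to their number.
∑-sets : ∀ {n k} (ps : List (Fin n × Fin k)) (Φ : Vec (Fin k) n → ℕ) →
  ∑ (vecs n k) (Φ ∘ sets ps) ≤ k ^ length ps * ∑ (vecs n k) Φ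
∑-sets []             Φ = ≤-reflexive (sym (*-identityˡ _))
∑-sets {n} {k} ((j , a) ∷ ps) Φ = begin
  ∑ (vecs n k) (λ s → Φ (sets ps (s [ j ]≔ a)))
    ≤⟨ ∑-mono (vecs n k) (λ s → ∑-∈ (λ c → Φ (sets ps (s [ j ]≔ c))) (∈-allFin a)) ⟩
  ∑ (vecs n k) (λ s → ∑ (allFin k) (λ c → Φ (sets ps (s [ j ]≔ c))))
    ≡⟨ exchange j (Φ ∘ sets ps) ⟨
  k * ∑ (vecs n k) (Φ ∘ sets ps)
    ≤⟨ *-monoʳ-≤ k (∑-sets ps Φ) ⟩
  k * (k ^ length ps * ∑ (vecs n k) Φ)
    ≡⟨ *-assoc k _ _ ⟨
  k * k ^ length ps * ∑ (vecs n k) Φ ∎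
  where open ≤-Reasoning

-- Parity of natural numbers

ev : ℕ → Bool
ev zero    = true
ev (suc n) = not (ev n)

ev-+ : ∀ a b → ev (a + b) ≡ not (ev a xor ev b)
ev-+ zero    b = sym (not-involutive (ev b))
ev-+ (suc a) b rewrite ev-+ a b with ev a | ev b
... | true  | true  = refl
... | true  | false = refl
... | false | true  = refl
... | false | false = refl

-- The cycle ℤ/(k+1)

module Cycle (k : ℕ) (ev-m : ev (suc k) ≡ true) where

  m = suc k

  σ σ⁻ : Fin m → Fin m
  σ b = fromℕ< (m%n<n (toℕ b + 1) m)
  σ⁻ zero    = fromℕ k
  σ⁻ (suc b) = inject₁ b

  shift : Bool → Fin m → Fin m
  shift true  = σ
  shift false = σ⁻

  top : Fin m
  top = fromℕ k

  toℕ-top : toℕ top ≡ k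
  toℕ-top = toℕ-fromℕ k

  ev-k : ev k ≡ false
  ev-k = not-injective ev-m

  k≥1 : 1 ≤ k
  k≥1 = odd⇒≥1 k ev-k
    where
    odd⇒≥1 : ∀ k → ev k ≡ false → 1 ≤ k
    odd⇒≥1 (suc _) _ = s≤s z≤n

  toℕ-σ-< : ∀ {b : Fin m} → toℕ b < k → toℕ (σ b) ≡ suc (toℕ b)
  toℕ-σ-< {b} lt = trans (toℕ-fromℕ< _) (trans (cong (_% m) (+-comm (toℕ b) 1)) (m<n⇒m%n≡m (s≤s lt)))

  toℕ-σ-top : ∀ {b : Fin m} → toℕ b ≡ k → toℕ (σ b) ≡ 0
  toℕ-σ-top {b} e = trans (toℕ-fromℕ< _) (trans (cong (_% m) (trans (+-comm (toℕ b) 1) (cong suc e))) (n%n≡0 m))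

  toℕ-cases : ∀ (b : Fin m) → toℕ b < k ⊎ toℕ b ≡ k
  toℕ-cases b = m≤n⇒m<n∨m≡n (toℕ≤pred[n] b)

  σσ⁻ : ∀ b → σ (σ⁻ b) ≡ b
  σσ⁻ zero    = toℕ-injective (toℕ-σ-top (toℕ-fromℕ k))
  σσ⁻ (suc b) = toℕ-injective (trans (toℕ-σ-< (subst (_< k) (sym (toℕ-inject₁ b)) (toℕ<n b))) (cong suc (toℕ-inject₁ b)))

  σ⁻-suc : ∀ (a b : Fin m) → toℕ a ≡ suc (toℕ b) → σ⁻ a ≡ b
  σ⁻-suc (suc a) b e = toℕ-injective (trans (toℕ-inject₁ a) (suc-injective e))

  σ⁻-zero : ∀ (a b : Fin m) → toℕ a ≡ 0 → toℕ b ≡ k → σ⁻ a ≡ b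
  σ⁻-zero zero b _ e = toℕ-injective (trans (toℕ-fromℕ k) (sym e))

  σ⁻σ : ∀ b → σ⁻ (σ b) ≡ b
  σ⁻σ b with toℕ-cases b
  ... | inj₁ lt = σ⁻-suc (σ b) b (toℕ-σ-< lt)
  ... | inj₂ e  = σ⁻-zero (σ b) b (toℕ-σ-top e) e

  shift-not : ∀ s b → shift (not s) (shift s b) ≡ b
  shift-not true  = σ⁻σ
  shift-not false = σσ⁻

  shift-comm : ∀ s t b → shift s (shift t b) ≡ shift t (shift s b)
  shift-comm true  true  b = refl
  shift-comm true  false b = trans (σσ⁻ b) (sym (σ⁻σ b))
  shift-comm false true  b = trans (σ⁻σ b) (sym (σσ⁻ b))
  shift-comm false false b = refl

  ev-σ : ∀ b → ev (toℕ (σ b)) ≡ not (ev (toℕ b))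
  ev-σ b with toℕ-cases b
  ... | inj₁ lt = cong ev (toℕ-σ-< lt)
  ... | inj₂ e  = trans (cong ev (toℕ-σ-top e)) (sym (cong not (trans (cong ev e) ev-k)))

  ev-shift : ∀ s b → ev (toℕ (shift s b)) ≡ not (ev (toℕ b))
  ev-shift true  b = ev-σ b
  ev-shift false b = trans (sym (not-involutive _)) (cong not (trans (sym (ev-σ (σ⁻ b))) (cong (ev ∘ toℕ) (σσ⁻ b))))

  -- The forward step wraps to 0, which is smaller because the cycle has at least two residues.
  shift-top : ∀ s {b} → toℕ b ≡ k → toℕ (shift s b) < toℕ b
  shift-top true  e = subst₂ _<_ (sym (toℕ-σ-top e)) (sym e) k≥1
  shift-top false {zero}  e = ⊥-elim (<⇒≢ k≥1 e)
  shift-top false {suc b} e = s≤s (≤-reflexive (toℕ-inject₁ b))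

  -- As `k` is odd, `b` is the last even residue, and two steps wrap it to 0. On the cycle of length
  -- two they lead back to `b` instead, which `σσ-two` covers.
  σσ-pen : ∀ {b} → suc (toℕ b) ≡ k → 2 ≤ k → toℕ (σ (σ b)) < toℕ b
  σσ-pen {b} e k≥2 = subst (_< toℕ b) (sym (toℕ-σ-top (trans (toℕ-σ-< (≤-reflexive e)) e)))
    (s≤s⁻¹ (subst (2 ≤_) (sym e) k≥2))

  σσ-two : k ≡ 1 → ∀ b → σ (σ b) ≡ b
  σσ-two k≡1 b with toℕ-cases b
  ... | inj₁ lt = toℕ-injective (trans (toℕ-σ-top (trans (toℕ-σ-< lt) (trans (cong suc b≡0) (sym k≡1)))) (sym b≡0))
    where
    b≡0 : toℕ b ≡ 0
    b≡0 = n≤0⇒n≡0 (s≤s⁻¹ (subst (toℕ b <_) k≡1 lt))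
  ... | inj₂ e  = toℕ-injective (trans (toℕ-σ-< (subst₂ _<_ (sym (toℕ-σ-top e)) refl k≥1))
                    (trans (cong suc (toℕ-σ-top e)) (sym (trans e k≡1))))

  iter : (Fin m → Fin m) → ℕ → Fin m → Fin m
  iter g zero    b = b
  iter g (suc n) b = g (iter g n b)

  iter-comm : ∀ (g h : Fin m → Fin m) → (∀ b → g (h b) ≡ h (g b)) → ∀ n b → iter g n (h b) ≡ h (iter g n b)
  iter-comm g h c zero    b = refl
  iter-comm g h c (suc n) b = trans (cong g (iter-comm g h c n b)) (c _)

  iter-inv : ∀ s n b → iter (shift s) n (iter (shift (not s)) n b) ≡ b
  iter-inv s zero    b = refl
  iter-inv s (suc n) b = begin
    shift s (iter (shift s) n (shift (not s) (iter (shift (not s)) n b)))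
      ≡⟨ cong (shift s) (iter-comm (shift s) (shift (not s)) (shift-comm s (not s)) n _) ⟩
    shift s (shift (not s) (iter (shift s) n (iter (shift (not s)) n b)))
      ≡⟨ cong (shift s ∘ shift (not s)) (iter-inv s n b) ⟩
    shift s (shift (not s) b)
      ≡⟨ cong (λ t → shift t (shift (not s) b)) (not-involutive s) ⟨
    shift (not (not s)) (shift (not s) b)
      ≡⟨ shift-not (not s) b ⟩
    b ∎
    where open ≡-Reasoning

  toℕ-iter : ∀ n → n ≤ k → toℕ (iter σ n zero) ≡ n
  toℕ-iter zero    le = refl
  toℕ-iter (suc n) le = trans (toℕ-σ-< (subst (_< k) (sym ih) le)) (cong suc ih)
    where
    ih : toℕ (iter σ n zero) ≡ n
    ih = toℕ-iter n (<⇒≤ le)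

  iter-reach : ∀ b → iter σ (toℕ b) zero ≡ b
  iter-reach b = toℕ-injective (toℕ-iter (toℕ b) (toℕ≤pred[n] b))

  iter-unreach : ∀ b → iter σ⁻ (toℕ b) b ≡ zero
  iter-unreach b = trans (cong (iter σ⁻ (toℕ b)) (sym (iter-reach b))) (iter-inv false (toℕ b) zero)

funToFin-cong : ∀ {n p} {f g : Fin n → Fin p} → (∀ i → f i ≡ g i) → funToFin f ≡ funToFin g
funToFin-cong {zero}  h = refl
funToFin-cong {suc n} h = cong₂ combine (h zero) (funToFin-cong (h ∘ suc))

∑-allFin-differ : ∀ d (φ ψ : Fin d → ℕ) j → (∀ i → i ≢ j → φ i ≡ ψ i) →
  ∑ (allFin d) φ + ψ j ≡ ∑ (allFin d) ψ + φ j
∑-allFin-differ (suc d) φ ψ zero h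
  rewrite ∑-allFin-suc d φ | ∑-allFin-suc d ψ | ∑-cong (allFin d) {φ ∘ suc} {ψ ∘ suc} (λ i → h (suc i) (λ ()))
  = lemma (φ zero) (ψ zero) (∑ (allFin d) (ψ ∘ suc))
  where
  lemma : ∀ a b c → a + c + b ≡ b + c + a
  lemma = solve-∀
∑-allFin-differ (suc d) φ ψ (suc j) h
  rewrite ∑-allFin-suc d φ | ∑-allFin-suc d ψ | h zero (λ ()) = begin
    ψ zero + ∑ (allFin d) (φ ∘ suc) + ψ (suc j)   ≡⟨ +-assoc (ψ zero) _ _ ⟩
    ψ zero + (∑ (allFin d) (φ ∘ suc) + ψ (suc j))
      ≡⟨ cong (ψ zero +_) (∑-allFin-differ d (φ ∘ suc) (ψ ∘ suc) j (λ i ne → h (suc i) (ne ∘ Fin.suc-injective))) ⟩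
    ψ zero + (∑ (allFin d) (ψ ∘ suc) + φ (suc j)) ≡⟨ +-assoc (ψ zero) _ _ ⟨
    ψ zero + ∑ (allFin d) (ψ ∘ suc) + φ (suc j) ∎
  where open ≡-Reasoning

xnor-cancel : ∀ p q r → not (p xor q) ≡ not (r xor not q) → p ≡ not r
xnor-cancel true  true  true  ()
xnor-cancel true  true  false e = refl
xnor-cancel true  false true  ()
xnor-cancel true  false false e = refl
xnor-cancel false true  true  e = refl
xnor-cancel false true  false ()
xnor-cancel false false true  e = refl
xnor-cancel false false false ()

≢-not : ∀ b → b ≢ not b
≢-not true  ()
≢-not false ()

-- The torus of side k+1 and dimension d

module Torus (k : ℕ) (ev-m : ev (suc k) ≡ true) (d : ℕ) where

  open Cycle k ev-m public

  Site : Set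
  Site = Fin (m ^ d)

  coord : Site → Fin d → Fin m
  coord = finToFun

  point : (Fin d → Fin m) → Site
  point = funToFin

  coord-point : ∀ φ i → coord (point φ) i ≡ φ i
  coord-point = finToFun-funToFin

  site-ext : ∀ {x y} → (∀ i → coord x i ≡ coord y i) → x ≡ y
  site-ext {x} {y} h = trans (sym (funToFin-finToFin {d} {m} x)) (trans (funToFin-cong {d} {m} h) (funToFin-finToFin {d} {m} y))

  update : (Fin d → Fin m) → Fin d → (Fin m → Fin m) → Fin d → Fin m
  update φ j h i with i ≟ j
  ... | yes _ = h (φ i)
  ... | no  _ = φ i

  Move : Set
  Move = Fin d × Bool

  mv : Move → Site → Site
  mv (j , s) x = point (update (coord x) j (shift s))

  coord-mv-same : ∀ j s x → coord (mv (j , s) x) j ≡ shift s (coord x j)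
  coord-mv-same j s x = trans (coord-point _ j) lemma
    where
    lemma : update (coord x) j (shift s) j ≡ shift s (coord x j)
    lemma with j ≟ j
    ... | yes _  = refl
    ... | no j≢j = ⊥-elim (j≢j refl)

  coord-mv-other : ∀ j s x {i} → i ≢ j → coord (mv (j , s) x) i ≡ coord x i
  coord-mv-other j s x {i} i≢j = trans (coord-point _ i) lemma
    where
    lemma : update (coord x) j (shift s) i ≡ coord x i
    lemma with i ≟ j
    ... | yes i≡j = ⊥-elim (i≢j i≡j)
    ... | no  _   = refl

  mv-char : ∀ j s x y → coord y j ≡ shift s (coord x j) → (∀ i → i ≢ j → coord y i ≡ coord x i) → y ≡ mv (j , s) x
  mv-char j s x y same other = site-ext lemma
    where
    lemma : ∀ i → coord y i ≡ coord (mv (j , s) x) i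
    lemma i with i ≟ j
    ... | yes refl = trans same (sym (coord-mv-same j s x))
    ... | no  i≢j  = trans (other i i≢j) (sym (coord-mv-other j s x i≢j))

  mv-comm : ∀ δ ε x → mv δ (mv ε x) ≡ mv ε (mv δ x)
  mv-comm (j , s) (i , t) x = site-ext lemma
    where
    open ≡-Reasoning
    lemma : ∀ l → coord (mv (j , s) (mv (i , t) x)) l ≡ coord (mv (i , t) (mv (j , s) x)) l
    lemma l with l ≟ j | l ≟ i
    ... | yes refl | yes refl = begin
      coord (mv (l , s) (mv (l , t) x)) l ≡⟨ trans (coord-mv-same l s _) (cong (shift s) (coord-mv-same l t x)) ⟩
      shift s (shift t (coord x l))       ≡⟨ shift-comm s t _ ⟩
      shift t (shift s (coord x l))       ≡⟨ trans (coord-mv-same l t _) (cong (shift t) (coord-mv-same l s x)) ⟨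
      coord (mv (l , t) (mv (l , s) x)) l ∎
    ... | yes refl | no l≢i =
      trans (coord-mv-same l s _) (trans (cong (shift s) (coord-mv-other i t x l≢i))
        (sym (trans (coord-mv-other i t _ l≢i) (coord-mv-same l s x))))
    ... | no l≢j | yes refl =
      trans (coord-mv-other j s _ l≢j) (trans (coord-mv-same l t x)
        (sym (trans (coord-mv-same l t _) (cong (shift t) (coord-mv-other j s x l≢j)))))
    ... | no l≢j | no l≢i =
      trans (coord-mv-other j s _ l≢j) (trans (coord-mv-other i t x l≢i)
        (sym (trans (coord-mv-other i t _ l≢i) (coord-mv-other j s x l≢j))))

  inverse : Move → Move
  inverse (j , s) = j , not s

  mv-inverse : ∀ δ x → mv (inverse δ) (mv δ x) ≡ x
  mv-inverse (j , s) x = sym (mv-char j (not s) (mv (j , s) x) x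
    (sym (trans (cong (shift (not s)) (coord-mv-same j s x)) (shift-not s _)))
    (λ i i≢j → sym (coord-mv-other j s x i≢j)))

  mv-inverse′ : ∀ δ x → mv δ (mv (inverse δ) x) ≡ x
  mv-inverse′ δ@(j , s) x = trans (cong (λ t → mv (j , t) (mv (inverse δ) x)) (sym (not-involutive s))) (mv-inverse (inverse δ) x)

  mv-injective : ∀ δ {x y} → mv δ x ≡ mv δ y → x ≡ y
  mv-injective δ {x} {y} e = trans (sym (mv-inverse δ x)) (trans (cong (mv (inverse δ)) e) (mv-inverse δ y))

  weight : (Fin d → ℕ) → Site → ℕ
  weight w x = ∑ (allFin d) (λ j → w j * toℕ (coord x j))

  weight-mv : ∀ w j s x → weight w (mv (j , s) x) + w j * toℕ (coord x j) ≡ weight w x + w j * toℕ (shift s (coord x j))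
  weight-mv w j s x = trans
    (∑-allFin-differ d (λ i → w i * toℕ (coord (mv (j , s) x) i)) (λ i → w i * toℕ (coord x i)) j
      (λ i i≢j → cong (λ t → w i * toℕ t) (coord-mv-other j s x i≢j)))
    (cong (λ t → weight w x + w j * toℕ t) (coord-mv-same j s x))

  par : Site → Bool
  par x = ev (weight (λ _ → 1) x)

  par-mv : ∀ δ x → par (mv δ x) ≡ not (par x)
  par-mv (j , s) x = xnor-cancel (par (mv (j , s) x)) (ev (toℕ (coord x j))) (par x) (begin
    not (par (mv (j , s) x) xor ev (toℕ (coord x j)))
      ≡⟨ ev-+ (weight (λ _ → 1) (mv (j , s) x)) _ ⟨
    ev (weight (λ _ → 1) (mv (j , s) x) + toℕ (coord x j))
      ≡⟨ cong (λ t → ev (weight (λ _ → 1) (mv (j , s) x) + t)) (*-identityˡ _) ⟨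
    ev (weight (λ _ → 1) (mv (j , s) x) + 1 * toℕ (coord x j))
      ≡⟨ cong ev (weight-mv (λ _ → 1) j s x) ⟩
    ev (weight (λ _ → 1) x + 1 * toℕ (shift s (coord x j)))
      ≡⟨ cong (λ t → ev (weight (λ _ → 1) x + t)) (*-identityˡ _) ⟩
    ev (weight (λ _ → 1) x + toℕ (shift s (coord x j)))
      ≡⟨ ev-+ (weight (λ _ → 1) x) _ ⟩
    not (par x xor ev (toℕ (shift s (coord x j))))
      ≡⟨ cong (λ t → not (par x xor t)) (ev-shift s _) ⟩
    not (par x xor not (ev (toℕ (coord x j)))) ∎)
    where open ≡-Reasoning

  mv≢ : ∀ δ x → mv δ x ≢ x
  mv≢ δ x e = ≢-not (par x) (trans (cong par (sym e)) (par-mv δ x))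

  mv-mv≢mv : ∀ δ ε ε′ x → mv δ (mv ε x) ≢ mv ε′ x
  mv-mv≢mv δ ε ε′ x e = ≢-not (par (mv ε′ x)) (trans (trans (par-mv ε′ x) (sym (par-mv ε x))) (trans (sym (not-involutive _))
    (cong not (trans (sym (par-mv δ (mv ε x))) (cong par e)))))

  e : Fin d → Site → Site
  e j = mv (j , true)

  e-distinct : ∀ {i j} x → e i x ≡ e j x → i ≡ j
  e-distinct {i} {j} x eq with i ≟ j
  ... | yes i≡j = i≡j
  ... | no  i≢j = ⊥-elim (≢-not (ev (toℕ (coord x i))) (trans
          (cong (ev ∘ toℕ) (trans (sym (coord-mv-other j true x i≢j)) (trans (cong (λ y → coord y i) (sym eq)) (coord-mv-same i true x))))
          (ev-σ (coord x i))))

  -- The low sites are the lower ends of the edges {x, e i x} of a perfect matching.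
  Low : Fin d → Site → Set
  Low i x = ev (toℕ (coord x i)) ≡ true

  Low? : ∀ i x → Dec (Low i x)
  Low? i x = Bool._≟_ (ev (toℕ (coord x i))) true

  -- An even coordinate differs from the odd number `k`; hence the step `e i` from a low site does
  -- not wrap.
  low-< : ∀ i x → Low i x → toℕ (coord x i) < k
  low-< i x l with toℕ-cases (coord x i)
  ... | inj₁ lt = lt
  ... | inj₂ eq with () ← trans (sym ev-k) (trans (cong ev (sym eq)) l)

  ev-coord-e : ∀ i x → ev (toℕ (coord (e i x) i)) ≡ not (ev (toℕ (coord x i)))
  ev-coord-e i x = trans (cong (ev ∘ toℕ) (coord-mv-same i true x)) (ev-σ (coord x i))

  -- The order of revelation for direction i: the i-th coordinate counts least.
  rankWeight : Fin d → Fin d → ℕ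
  rankWeight i j with i ≟ j
  ... | yes _ = 1
  ... | no  _ = m

  rank : Fin d → Site → ℕ
  rank i = weight (rankWeight i)

  rankWeight-same : ∀ i → rankWeight i i ≡ 1
  rankWeight-same i with i ≟ i
  ... | yes _ = refl
  ... | no ne = ⊥-elim (ne refl)

  rankWeight-other : ∀ {i j} → i ≢ j → rankWeight i j ≡ m
  rankWeight-other {i} {j} i≢j with i ≟ j
  ... | yes i≡j = ⊥-elim (i≢j i≡j)
  ... | no _ = refl

  rankWeight≥1 : ∀ i j → 1 ≤ rankWeight i j
  rankWeight≥1 i j with i ≟ j
  ... | yes _ = ≤-refl
  ... | no  _ = s≤s z≤n

  rank-decrease : ∀ i j s x → toℕ (shift s (coord x j)) < toℕ (coord x j) → rank i (mv (j , s) x) + rankWeight i j ≤ rank i x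
  rank-decrease i j s x lt = +-cancelʳ-≤ (w * toℕ (shift s (coord x j))) _ _ (begin
    rank i (mv (j , s) x) + w + w * toℕ (shift s (coord x j))   ≡⟨ lemma (rank i (mv (j , s) x)) w _ ⟩
    rank i (mv (j , s) x) + w * suc (toℕ (shift s (coord x j))) ≤⟨ +-monoʳ-≤ _ (*-monoʳ-≤ w lt) ⟩
    rank i (mv (j , s) x) + w * toℕ (coord x j)                 ≡⟨ weight-mv (rankWeight i) j s x ⟩
    rank i x + w * toℕ (shift s (coord x j)) ∎)
    where
    open ≤-Reasoning
    w = rankWeight i j
    lemma : ∀ a w b → a + w + w * b ≡ a + w * suc b
    lemma = solve-∀

  rank-e-≤ : ∀ i x → rank i (e i x) ≤ rank i x + k
  rank-e-≤ i x = begin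
    rank i (e i x) ≤⟨ m≤m+n _ _ ⟩
    rank i (e i x) + rankWeight i i * toℕ (coord x i) ≡⟨ weight-mv (rankWeight i) i true x ⟩
    rank i x + rankWeight i i * toℕ (σ (coord x i))   ≡⟨ cong (λ t → rank i x + t * toℕ (σ (coord x i))) (rankWeight-same i) ⟩
    rank i x + 1 * toℕ (σ (coord x i))                ≡⟨ cong (rank i x +_) (*-identityˡ _) ⟩
    rank i x + toℕ (σ (coord x i))                    ≤⟨ +-monoʳ-≤ (rank i x) (toℕ≤pred[n] (σ (coord x i))) ⟩
    rank i x + k ∎
    where open ≤-Reasoning

  -- The absence of a wrap keeps the upper end from preceding the lower one, so neither end of a
  -- block lies in the past of that block.
  rank-e-≥ : ∀ i x → Low i x → rank i x ≤ rank i (e i x)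
  rank-e-≥ i x l = +-cancelʳ-≤ (rankWeight i i * toℕ (coord x i)) _ _ (begin
    rank i x + rankWeight i i * toℕ (coord x i)
      ≤⟨ +-monoʳ-≤ (rank i x) (*-monoʳ-≤ (rankWeight i i) (≤-trans (n≤1+n _) (≤-reflexive (sym (toℕ-σ-< (low-< i x l)))))) ⟩
    rank i x + rankWeight i i * toℕ (σ (coord x i))
      ≡⟨ weight-mv (rankWeight i) i true x ⟨
    rank i (e i x) + rankWeight i i * toℕ (coord x i) ∎)
    where open ≤-Reasoning

  top-past : ∀ i j s x → toℕ (coord x j) ≡ k → rank i (mv (j , s) x) < rank i x
  top-past i j s x eq = ≤-trans (≤-reflexive (+-comm 1 _)) (≤-trans (+-monoʳ-≤ _ (rankWeight≥1 i j))
    (rank-decrease i j s x (shift-top s eq)))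

  -- The origin of the weight `m`: a descent in direction `j` lowers the rank by at least `m`, more
  -- than the `k` that the step `e i` can gain. Such neighbours of `e i x` precede even `x`.
  top-past-e : ∀ i j s x → i ≢ j → toℕ (coord x j) ≡ k → rank i (mv (j , s) (e i x)) < rank i x
  top-past-e i j s x i≢j eq = +-cancelʳ-≤ k _ _ (begin
    suc (rank i (mv (j , s) (e i x))) + k  ≡⟨ +-suc (rank i (mv (j , s) (e i x))) k ⟨
    rank i (mv (j , s) (e i x)) + m        ≡⟨ cong (rank i (mv (j , s) (e i x)) +_) (rankWeight-other i≢j) ⟨
    rank i (mv (j , s) (e i x)) + rankWeight i j
      ≤⟨ rank-decrease i j s (e i x) (shift-top s (trans (cong toℕ (coord-mv-other i true x (i≢j ∘ sym))) eq)) ⟩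
    rank i (e i x) ≤⟨ rank-e-≤ i x ⟩
    rank i x + k ∎)
    where open ≤-Reasoning

  pen-past : ∀ i x → suc (toℕ (coord x i)) ≡ k → 2 ≤ k → rank i (e i (e i x)) < rank i x
  pen-past i x eq k≥2 = +-cancelʳ-< (1 * toℕ (coord x i) + 1 * toℕ (σ (coord x i))) _ _ (begin-strict
    rank i (e i (e i x)) + (1 * a + 1 * b)   ≡⟨ lemma (rank i (e i (e i x))) (1 * a) (1 * b) ⟩
    rank i (e i (e i x)) + 1 * b + 1 * a     ≡⟨ cong (λ t → rank i (e i (e i x)) + 1 * toℕ t + 1 * a) (coord-mv-same i true x) ⟨
    rank i (e i (e i x)) + 1 * toℕ (coord (e i x) i) + 1 * a ≡⟨ cong (_+ 1 * a) (step (e i x)) ⟩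
    rank i (e i x) + 1 * toℕ (σ (coord (e i x) i)) + 1 * a   ≡⟨ cong (λ t → rank i (e i x) + 1 * toℕ (σ t) + 1 * a) (coord-mv-same i true x) ⟩
    rank i (e i x) + 1 * c + 1 * a           ≡⟨ lemma′ (rank i (e i x)) (1 * c) (1 * a) ⟩
    rank i (e i x) + 1 * a + 1 * c           ≡⟨ cong (_+ 1 * c) (step x) ⟩
    rank i x + 1 * b + 1 * c                 <⟨ +-monoʳ-< (rank i x + 1 * b) (*-monoʳ-< 1 (σσ-pen eq k≥2)) ⟩
    rank i x + 1 * b + 1 * a                 ≡⟨ lemma (rank i x) (1 * a) (1 * b) ⟨
    rank i x + (1 * a + 1 * b) ∎)
    where
    open ≤-Reasoning
    a = toℕ (coord x i)
    b = toℕ (σ (coord x i))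
    c = toℕ (σ (σ (coord x i)))
    lemma : ∀ p q r → p + (q + r) ≡ p + r + q
    lemma = solve-∀
    lemma′ : ∀ p q r → p + q + r ≡ p + r + q
    lemma′ = solve-∀
    step : ∀ y → rank i (e i y) + 1 * toℕ (coord y i) ≡ rank i y + 1 * toℕ (σ (coord y i))
    step y = subst (λ w → rank i (e i y) + w * toℕ (coord y i) ≡ rank i y + w * toℕ (σ (coord y i)))
      (rankWeight-same i) (weight-mv (rankWeight i) i true y)

  ee-two : k ≡ 1 → ∀ i x → e i (e i x) ≡ x
  ee-two k≡1 i x = sym (mv-char i true (e i x) x
    (sym (trans (cong σ (coord-mv-same i true x)) (σσ-two k≡1 _)))
    (λ j j≢i → sym (coord-mv-other i true x j≢i)))

  -- The translation by `p - o`, built from unit shifts so that it commutes with `mv` because the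
  -- shifts commute.
  translate : Site → Site → Site → Site
  translate o p x = point (λ j → iter σ (toℕ (coord p j)) (iter σ⁻ (toℕ (coord o j)) (coord x j)))

  translate-base : ∀ o p → translate o p o ≡ p
  translate-base o p = site-ext (λ j → trans (coord-point _ j)
    (trans (cong (iter σ (toℕ (coord p j))) (iter-unreach (coord o j))) (iter-reach (coord p j))))

  translate-inverse : ∀ o p x → translate p o (translate o p x) ≡ x
  translate-inverse o p x = site-ext λ j → begin
    coord (translate p o (translate o p x)) j
      ≡⟨ coord-point _ j ⟩
    iter σ (toℕ (coord o j)) (iter σ⁻ (toℕ (coord p j)) (coord (translate o p x) j))
      ≡⟨ cong (λ t → iter σ (toℕ (coord o j)) (iter σ⁻ (toℕ (coord p j)) t)) (coord-point _ j) ⟩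
    iter σ (toℕ (coord o j)) (iter σ⁻ (toℕ (coord p j)) (iter σ (toℕ (coord p j)) (iter σ⁻ (toℕ (coord o j)) (coord x j))))
      ≡⟨ cong (iter σ (toℕ (coord o j))) (iter-inv false (toℕ (coord p j)) _) ⟩
    iter σ (toℕ (coord o j)) (iter σ⁻ (toℕ (coord o j)) (coord x j))
      ≡⟨ iter-inv true (toℕ (coord o j)) _ ⟩
    coord x j ∎
    where open ≡-Reasoning

  translate-mv : ∀ o p δ x → translate o p (mv δ x) ≡ mv δ (translate o p x)
  translate-mv o p (j , s) x = mv-char j s (translate o p x) (translate o p (mv (j , s) x))
    (begin
      coord (translate o p (mv (j , s) x)) j ≡⟨ coord-point _ j ⟩
      t j (coord (mv (j , s) x) j)           ≡⟨ cong (t j) (coord-mv-same j s x) ⟩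
      t j (shift s (coord x j))              ≡⟨ cong (iter σ (toℕ (coord p j))) (iter-comm σ⁻ (shift s) (shift-comm false s) (toℕ (coord o j)) _) ⟩
      iter σ (toℕ (coord p j)) (shift s (iter σ⁻ (toℕ (coord o j)) (coord x j)))
        ≡⟨ iter-comm σ (shift s) (shift-comm true s) (toℕ (coord p j)) _ ⟩
      shift s (t j (coord x j))              ≡⟨ cong (shift s) (coord-point _ j) ⟨
      shift s (coord (translate o p x) j) ∎)
    (λ i i≢j → trans (coord-point _ i) (trans (cong (t i) (coord-mv-other j s x i≢j)) (sym (coord-point _ i))))
    where
    open ≡-Reasoning
    t : Fin d → Fin m → Fin m
    t j a = iter σ (toℕ (coord p j)) (iter σ⁻ (toℕ (coord o j)) a)

  abstract
    anyMove? : {P : Move → Set} → (∀ δ → Dec (P δ)) → Dec (∃ P)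
    anyMove? P? = map′
      (λ { (j , inj₁ p) → (j , true) , p ; (j , inj₂ p) → (j , false) , p })
      (λ { ((j , true) , p) → j , inj₁ p ; ((j , false) , p) → j , inj₂ p })
      (any? (λ j → P? (j , true) ⊎-dec P? (j , false)))

-- Boolean reflection and maxima of lists

all-true : ∀ (p : A → Bool) xs → all p xs ≡ true → ∀ {x} → x ∈ xs → p x ≡ true
all-true p (x ∷ xs) eq (here refl) with p x
... | true = refl
all-true p (x ∷ xs) eq (there i) with p x
... | true = all-true p xs eq i

true-all : ∀ (p : A → Bool) xs → (∀ x → p x ≡ true) → all p xs ≡ true
true-all p []       h = refl
true-all p (x ∷ xs) h rewrite h x = true-all p xs h

any-true : ∀ (p : A → Bool) xs → any p xs ≡ true → ∃ λ x → p x ≡ true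
any-true p (x ∷ xs) eq with p x in px
... | true  = x , px
... | false = any-true p xs eq

true-any : ∀ (p : A → Bool) xs {x} → x ∈ xs → p x ≡ true → any p xs ≡ true
true-any p (x ∷ xs) (here refl) px rewrite px = refl
true-any p (x ∷ xs) (there i)   px with p x
... | true  = refl
... | false = true-any p xs i px

∧-true : ∀ {a b} → a ∧ b ≡ true → a ≡ true × b ≡ true
∧-true {true} {true} _ = refl , refl

imp-true : ∀ {a b} → not a ∨ b ≡ true → a ≡ true → b ≡ true
imp-true {true} eq refl = eq

true-imp : ∀ {a b} → (a ≡ true → b ≡ true) → not a ∨ b ≡ true
true-imp {false} h = refl
true-imp {true}  h = h refl

max : List ℕ → ℕ
max = foldr _⊔_ 0

∈⇒≤max : ∀ {x xs} → x ∈ xs → x ≤ max xs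
∈⇒≤max {xs = y ∷ ys} (here refl) = m≤m⊔n y (max ys)
∈⇒≤max {xs = y ∷ ys} (there i)   = ≤-trans (∈⇒≤max i) (m≤n⊔m y (max ys))

max-attained : ∀ xs → max xs ≡ 0 ⊎ max xs ∈ xs
max-attained []       = inj₁ refl
max-attained (x ∷ xs) with ⊔-sel x (max xs)
... | inj₁ e = inj₂ (here e)
... | inj₂ e with max-attained xs
...   | inj₁ z = inj₁ (trans e z)
...   | inj₂ i = inj₂ (there (subst (_∈ xs) (sym e) i))

∈-allSubsets : ∀ {k} (A : Subset k) → A ∈ allSubsets k
∈-allSubsets []      = here refl
∈-allSubsets {suc k} (b ∷ A) = ∈-concatMap⁺ (λ b → map (b ∷_) (allSubsets k)) (lemma b)
  where
  lemma : ∀ b → Any.Any (λ b′ → (b ∷ A) ∈ map (b′ ∷_) (allSubsets k)) (true ∷ false ∷ [])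
  lemma true  = here (∈-map⁺ _ (∈-allSubsets A))
  lemma false = there (here (∈-map⁺ _ (∈-allSubsets A)))

-- Counting colours

# : ∀ {n} {P : Fin n → Set} → (∀ c → Dec (P c)) → ℕ
# {n} P? = ∑ (allFin n) (λ c → 𝟙 (P? c))

#-mono : ∀ {n} {P Q : Fin n → Set} (P? : ∀ c → Dec (P c)) (Q? : ∀ c → Dec (Q c)) →
  (∀ c → P c → Q c) → # P? ≤ # Q?
#-mono P? Q? h = ∑-mono (allFin _) (λ c → 𝟙-mono (P? c) (Q? c) (h c))

#-cong : ∀ {n} {P Q : Fin n → Set} (P? : ∀ c → Dec (P c)) (Q? : ∀ c → Dec (Q c)) →
  (∀ c → P c → Q c) → (∀ c → Q c → P c) → # P? ≡ # Q?
#-cong P? Q? h h′ = ≤-antisym (#-mono P? Q? h) (#-mono Q? P? h′)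

#≤n : ∀ {n} {P : Fin n → Set} (P? : ∀ c → Dec (P c)) → # P? ≤ n
#≤n {n} P? = ≤-trans (∑-mono (allFin n) (λ c → 𝟙≤1 (P? c)))
  (≤-reflexive (∑-ones n))

#≥1 : ∀ {n} {P : Fin n → Set} (P? : ∀ c → Dec (P c)) {c} → P c → 1 ≤ # P?
#≥1 P? {c} p = ≤-trans (≤-reflexive (sym (𝟙-yes (P? c) p))) (∑-∈ (λ c → 𝟙 (P? c)) (∈-allFin c))

#-single : ∀ {n} (b : Fin n) → # (λ c → c ≟ b) ≡ 1
#-single {suc n} zero = trans (∑-allFin-suc n (λ c → 𝟙 (c ≟ zero))) (cong suc (trans (∑-cong (allFin n) (λ c → 𝟙-no (suc c ≟ zero) (λ ()))) (∑-zero (allFin n))))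
#-single {suc n} (suc b) = trans (∑-allFin-suc n (λ c → 𝟙 (c ≟ suc b)))
  (trans (cong₂ _+_ (𝟙-no (zero ≟ suc b) (λ ())) (∑-cong (allFin n) (λ c → 𝟙-cong (suc c ≟ suc b) (c ≟ b) (λ { refl → refl }) (cong suc))))
    (#-single b))

#-strict : ∀ {n} {P Q : Fin n → Set} (P? : ∀ c → Dec (P c)) (Q? : ∀ c → Dec (Q c)) →
  (∀ c → P c → Q c) → ∀ {b} → Q b → ¬ P b → # P? < # Q?
#-strict {n} P? Q? h {b} q ¬p = begin
  suc (# P?)                                     ≡⟨ cong (_+ # P?) (#-single b) ⟨
  # (λ c → c ≟ b) + # P?                         ≡⟨ ∑-+ (allFin n) _ _ ⟨
  ∑ (allFin n) (λ c → 𝟙 (c ≟ b) + 𝟙 (P? c))      ≤⟨ ∑-mono (allFin n) pointwise ⟩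
  # Q? ∎
  where
  open ≤-Reasoning
  pointwise : ∀ c → 𝟙 (c ≟ b) + 𝟙 (P? c) ≤ 𝟙 (Q? c)
  pointwise c with c ≟ b | P? c
  ... | yes refl | yes p = ⊥-elim (¬p p)
  ... | yes refl | no _  = ≤-reflexive (sym (𝟙-yes (Q? c) q))
  ... | no _     | yes p = ≤-reflexive (sym (𝟙-yes (Q? c) (h c p)))
  ... | no _     | no _  = z≤n

#-suc : ∀ {n} {P : Fin (suc n) → Set} (P? : ∀ c → Dec (P c)) → # P? ≡ 𝟙 (P? zero) + # (P? ∘ suc)
#-suc {n} P? = ∑-allFin-suc n (λ c → 𝟙 (P? c))

bit : Bool → ℕ
bit true  = 1
bit false = 0

∣∷∣ : ∀ {n} b (A : Subset n) → ∣ b ∷ A ∣ ≡ bit b + ∣ A ∣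
∣∷∣ true  A = refl
∣∷∣ false A = refl

bit-does : {P : Set} (d : Dec P) → bit (does d) ≡ 𝟙 d
bit-does (yes _) = refl
bit-does (no _)  = refl

bit-≟ : ∀ b → bit b ≡ 𝟙 (Bool._≟_ b true)
bit-≟ true  = refl
bit-≟ false = refl

∣tabulate∣ : ∀ {n} {P : Fin n → Set} (P? : ∀ c → Dec (P c)) → ∣ tabulate (λ c → does (P? c)) ∣ ≡ # P?
∣tabulate∣ {zero}  P? = refl
∣tabulate∣ {suc n} P? = trans (∣∷∣ (does (P? zero)) (tabulate (λ c → does (P? (suc c)))))
  (trans (cong₂ _+_ (bit-does (P? zero)) (∣tabulate∣ (P? ∘ suc))) (sym (#-suc P?)))

-- Complete pairs of colour sets and the weight of a block

module Colours (H : Graph) where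

  q : ℕ
  q = Graph.n H

  Colour : Set
  Colour = Fin q

  Adj : Colour → Colour → Set
  Adj a b = adj H a b ≡ true

  Adj? : ∀ a b → Dec (Adj a b)
  Adj? a b = Bool._≟_ (adj H a b) true

  Adj-sym : ∀ {a b} → Adj a b → Adj b a
  Adj-sym {a} {b} p = trans (Graph.sym H b a) p

  ηH : ℕ
  ηH = η H

  Member : Subset q → Colour → Set
  Member A c = memb c A ≡ true

  Member? : ∀ A c → Dec (Member A c)
  Member? A c = Bool._≟_ (memb c A) true

  ∣∣≡# : ∀ A → ∣ A ∣ ≡ # (Member? A)
  ∣∣≡# = go
    where
    go : ∀ {n} (A : Subset n) → ∣ A ∣ ≡ # (λ c → Bool._≟_ (lookup A c) true)
    go []          = refl
    go (b ∷ A) = trans (∣∷∣ b A) (trans (cong₂ _+_ (bit-≟ b) (go A)) (sym (#-suc (λ c → Bool._≟_ (lookup (b ∷ A) c) true))))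

  compl-sound : ∀ {A B} → compl H A B ≡ true → ∀ {a b} → Member A a → Member B b → Adj a b
  compl-sound {A} {B} eq {a} {b} p r = imp-true (all-true _ (allFin q) (all-true _ (allFin q) eq (∈-allFin a)) (∈-allFin b)) (cong₂ _∧_ p r)

  compl-complete : ∀ {A B} → (∀ {a b} → Member A a → Member B b → Adj a b) → compl H A B ≡ true
  compl-complete h = true-all _ (allFin q) (λ a → true-all _ (allFin q) (λ b → true-imp (λ m → h (proj₁ (∧-true m)) (proj₂ (∧-true m)))))

  candidates : List ℕ
  candidates = concatMap (λ A → map (λ B → if compl H A B then ∣ A ∣ * ∣ B ∣ else 0) (allSubsets q)) (allSubsets q)

  η-bound-subsets : ∀ A B → compl H A B ≡ true → ∣ A ∣ * ∣ B ∣ ≤ ηH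
  η-bound-subsets A B c = subst (_≤ ηH) (cong (if_then ∣ A ∣ * ∣ B ∣ else 0) c)
    (∈⇒≤max (∈-concatMap⁺ _ (Any.map (λ { refl → ∈-map⁺ (λ B → if compl H A B then ∣ A ∣ * ∣ B ∣ else 0) (∈-allSubsets B) }) (∈-allSubsets A))))

  η-bound : ∀ {P Q : Colour → Set} (P? : ∀ c → Dec (P c)) (Q? : ∀ c → Dec (Q c)) →
    (∀ {a b} → P a → Q b → Adj a b) → # P? * # Q? ≤ ηH
  η-bound P? Q? h = subst₂ (λ x y → x * y ≤ ηH) (∣tabulate∣ P?) (∣tabulate∣ Q?)
    (η-bound-subsets (tabulate (does ∘ P?)) (tabulate (does ∘ Q?)) (compl-complete {tabulate (does ∘ P?)} {tabulate (does ∘ Q?)} (λ p r → h (member P? p) (member Q? r))))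
    where
    member : ∀ {P : Colour → Set} (P? : ∀ c → Dec (P c)) {c} → Member (tabulate (does ∘ P?)) c → P c
    member P? {c} m with P? c | trans (sym (lookup∘tabulate (does ∘ P?) c)) m
    ... | yes p | _ = p

  empty : Subset q
  empty = Vec.replicate q false

  ∉-empty : ∀ c → ¬ Member empty c
  ∉-empty c c∈ with () ← trans (sym (lookup-replicate c false)) c∈

  #-empty : # (Member? empty) ≡ 0
  #-empty = trans (∑-cong (allFin q) (λ c → 𝟙-no (Member? empty c) (∉-empty c))) (∑-zero (allFin q))

  Attained : ℕ → Set
  Attained t = ∃₂ λ A B → (∀ {a b} → Member A a → Member B b → Adj a b) × # (Member? A) * # (Member? B) ≡ t

  0-attained : Attained 0
  0-attained = empty , empty , (λ {a} a∈ → ⊥-elim (∉-empty a a∈)) , cong (_* # (Member? empty)) #-empty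

  -- The maximum may be the default 0, of the fold or of an incompatible pair; two empty sets attain
  -- that value.
  η-attained : Attained ηH
  η-attained with max-attained candidates
  ... | inj₁ z = subst Attained (sym z) 0-attained
  ... | inj₂ i with A , a ← Any.satisfied (∈-concatMap⁻ _ {xs = allSubsets q} i) with B , _ , eq ← ∈-map⁻ _ a =
        subst Attained (sym eq) value-attained
    where
    value-attained : Attained (if compl H A B then ∣ A ∣ * ∣ B ∣ else 0)
    value-attained with compl H A B in c
    ... | true  = A , B , compl-sound {A} {B} c , cong₂ _*_ (sym (∣∣≡# A)) (sym (∣∣≡# B))
    ... | false = 0-attained

  Co : (Colour → Set) → Colour → Set
  Co P c = ∀ b → P b → Adj c b

  abstract
    Co? : ∀ {P : Colour → Set} → (∀ c → Dec (P c)) → ∀ c → Dec (Co P c)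
    Co? P? c = all? (λ b → P? b →-dec Adj? c b)

  Co-anti : ∀ {P Q : Colour → Set} → (∀ c → P c → Q c) → ∀ c → Co Q c → Co P c
  Co-anti h c co b p = co b (h b p)

  -- Let P and R be the colour sets seen in the past of the lower and the upper end of an edge. The lower end
  -- has its colour in Co P; the upper end, in Co R, is predicted to have it in P. As P ~ Co P, a correct
  -- prediction leaves at most η choices for the two colours.

  Pred : (P R : Colour → Set) → Colour → Set
  Pred P R c = Co R c × P c

  abstract
    Pred? : ∀ {P R : Colour → Set} → (∀ c → Dec (P c)) → (∀ c → Dec (R c)) → ∀ c → Dec (Pred P R c)
    Pred? P? R? c = Co? R? c ×-dec P? c

  size : ∀ {P R : Colour → Set} → (∀ c → Dec (P c)) → (∀ c → Dec (R c)) → ℕ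
  size P? R? = # (Co? P?) * # (Pred? P? R?)

  size≤η : ∀ {P R : Colour → Set} (P? : ∀ c → Dec (P c)) (R? : ∀ c → Dec (R c)) → size P? R? ≤ ηH
  size≤η P? R? = η-bound (Co? P?) (Pred? P? R?) (λ {a} {b} co p → co b (proj₂ p))

  size-cong : ∀ {P R P′ R′ : Colour → Set} (P? : ∀ c → Dec (P c)) (R? : ∀ c → Dec (R c))
    (P′? : ∀ c → Dec (P′ c)) (R′? : ∀ c → Dec (R′ c)) →
    (∀ c → P c → P′ c) → (∀ c → P′ c → P c) → (∀ c → R c → R′ c) → (∀ c → R′ c → R c) → size P? R? ≡ size P′? R′?
  size-cong P? R? P′? R′? f f′ g g′ = cong₂ _*_
    (#-cong (Co? P?) (Co? P′?) (Co-anti f′) (Co-anti f))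
    (#-cong (Pred? P? R?) (Pred? P′? R′?) (λ c (co , p) → Co-anti g′ c co , f c p) (λ c (co , p) → Co-anti g c co , f′ c p))

  module Weight (F : ℕ) where

    -- A failed prediction is cheap, a correct one with fewer than η choices gets the bonus (η+1)/η;
    -- then blockWeight-sum is still dominated by η²F.
    value : {A B : Set} → Dec A → Dec B → ℕ
    value (no _)  _       = 1
    value (yes _) (yes _) = ηH * F
    value (yes _) (no _)  = suc ηH * F

    value-cong : {A B A′ B′ : Set} (a : Dec A) (b : Dec B) (a′ : Dec A′) (b′ : Dec B′) →
      (A → A′) → (A′ → A) → (B → B′) → (B′ → B) → value a b ≡ value a′ b′
    value-cong (no _)  _       (no _)  _       f f′ g g′ = refl
    value-cong (no ¬a) _       (yes a) _       f f′ g g′ = ⊥-elim (¬a (f′ a))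
    value-cong (yes a) _       (no ¬a) _       f f′ g g′ = ⊥-elim (¬a (f a))
    value-cong (yes _) (yes _) (yes _) (yes _) f f′ g g′ = refl
    value-cong (yes _) (no _)  (yes _) (no _)  f f′ g g′ = refl
    value-cong (yes _) (yes b) (yes _) (no ¬b) f f′ g g′ = ⊥-elim (¬b (g b))
    value-cong (yes _) (no ¬b) (yes _) (yes b) f f′ g g′ = ⊥-elim (¬b (g′ b))

    Tight? : ∀ {P R : Colour → Set} (P? : ∀ c → Dec (P c)) (R? : ∀ c → Dec (R c)) → Dec (size P? R? ≡ ηH)
    Tight? P? R? = size P? R? ℕ.≟ ηH

    blockWeight : ∀ {P R : Colour → Set} (P? : ∀ c → Dec (P c)) (R? : ∀ c → Dec (R c)) → Colour → Colour → ℕ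
    blockWeight P? R? a b = 𝟙 (Co? P? a) * (𝟙 (Co? R? b) * value (P? b) (Tight? P? R?))

    blockWeight-allowed : ∀ {P R : Colour → Set} (P? : ∀ c → Dec (P c)) (R? : ∀ c → Dec (R c)) {a b} →
      Co P a → Co R b → blockWeight P? R? a b ≡ value (P? b) (Tight? P? R?)
    blockWeight-allowed P? R? {a} {b} p r = trans
      (cong₂ _*_ (𝟙-yes (Co? P? a) p) (cong (_* value (P? b) (Tight? P? R?)) (𝟙-yes (Co? R? b) r)))
      (trans (*-identityˡ _) (*-identityˡ _))

    blockWeight-cong : ∀ {P R P′ R′ : Colour → Set} (P? : ∀ c → Dec (P c)) (R? : ∀ c → Dec (R c))
      (P′? : ∀ c → Dec (P′ c)) (R′? : ∀ c → Dec (R′ c)) →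
      (∀ c → P c → P′ c) → (∀ c → P′ c → P c) → (∀ c → R c → R′ c) → (∀ c → R′ c → R c) →
      ∀ a b → blockWeight P? R? a b ≡ blockWeight P′? R′? a b
    blockWeight-cong P? R? P′? R′? f f′ g g′ a b = cong₂ _*_
      (𝟙-cong (Co? P? a) (Co? P′? a) (Co-anti f′ a) (Co-anti f a))
      (cong₂ _*_ (𝟙-cong (Co? R? b) (Co? R′? b) (Co-anti g′ b) (Co-anti g b))
        (value-cong (P? b) (Tight? P? R?) (P′? b) (Tight? P′? R′?) (f b) (f′ b)
          (trans (sym sizes)) (trans sizes)))
      where
      sizes : size P? R? ≡ size P′? R′?
      sizes = size-cong P? R? P′? R′? f f′ g g′

    -- Failed predictions contribute at most 1 per colour pair. A tight block has `η` correct pairs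
    -- of weight `η F`; a loose one has at most `η - 1` of weight `(η + 1) F`, and
    -- `(η - 1)(η + 1) ≤ η²`, so the bonus is paid for by the missing choice.
    blockWeight-sum : ∀ {P R : Colour → Set} (P? : ∀ c → Dec (P c)) (R? : ∀ c → Dec (R c)) →
      ∑ (allFin q) (λ a → ∑ (allFin q) (λ b → blockWeight P? R? a b)) ≤ ηH * ηH * F + q * q
    blockWeight-sum P? R? = begin
      ∑ (allFin q) (λ a → ∑ (allFin q) (λ b → blockWeight P? R? a b))
        ≤⟨ ∑-mono (allFin q) (λ a → ∑-mono (allFin q) (pointwise a)) ⟩
      ∑ (allFin q) (λ a → ∑ (allFin q) (λ b → 𝟙 (Co? P? a) * W * 𝟙 (Pred? P? R? b) + 1))
        ≡⟨ ∑-cong (allFin q) (λ a → trans (∑-+ (allFin q) _ _)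
             (cong₂ _+_ (∑-*ˡ (allFin q) (𝟙 (Co? P? a) * W) _) (∑-ones q))) ⟩
      ∑ (allFin q) (λ a → 𝟙 (Co? P? a) * W * # (Pred? P? R?) + q)
        ≡⟨ trans (∑-+ (allFin q) _ _) (cong₂ _+_
             (trans (∑-cong (allFin q) (λ a → r (𝟙 (Co? P? a)) W _)) (∑-*ˡ (allFin q) (W * # (Pred? P? R?)) _))
             (trans (∑-const (allFin q) q) (cong (_* q) (length-allFin q)))) ⟩
      W * # (Pred? P? R?) * # (Co? P?) + q * q
        ≡⟨ cong (_+ q * q) (r′ W (# (Pred? P? R?)) (# (Co? P?))) ⟩
      size P? R? * W + q * q
        ≤⟨ +-monoˡ-≤ (q * q) bound ⟩
      ηH * ηH * F + q * q ∎
      where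
      open ≤-Reasoning
      W : ℕ
      W with Tight? P? R?
      ... | yes _ = ηH * F
      ... | no _  = suc ηH * F
      r : ∀ a b c → a * b * c ≡ b * c * a
      r = solve-∀
      r′ : ∀ a b c → a * b * c ≡ c * b * a
      r′ = solve-∀
      r″ : ∀ a → 1 * (1 * a) ≡ 1 * a * 1
      r″ = solve-∀
      pointwise : ∀ a b → blockWeight P? R? a b ≤ 𝟙 (Co? P? a) * W * 𝟙 (Pred? P? R? b) + 1
      pointwise a b with Co? P? a | Co? R? b | P? b | Tight? P? R?
      ... | no _  | _     | _     | _     = z≤n
      ... | yes _ | no _  | _     | _     = z≤n
      ... | yes _ | yes _ | no _  | _     = m≤n+m 1 _
      ... | yes _ | yes co | yes p | yes _ rewrite 𝟙-yes (Pred? P? R? b) (co , p) = ≤-trans (≤-reflexive (r″ (ηH * F))) (m≤m+n _ 1)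
      ... | yes _ | yes co | yes p | no _  rewrite 𝟙-yes (Pred? P? R? b) (co , p) = ≤-trans (≤-reflexive (r″ (suc ηH * F))) (m≤m+n _ 1)
      bound : size P? R? * W ≤ ηH * ηH * F
      bound with Tight? P? R?
      ... | yes t = ≤-reflexive (trans (cong (_* (ηH * F)) t) (sym (*-assoc ηH ηH F)))
      ... | no ¬t = ≤-trans (≤-reflexive (sym (*-assoc (size P? R?) (suc ηH) F))) (*-monoˡ-≤ F (begin
          size P? R? * suc ηH              ≡⟨ *-suc (size P? R?) ηH ⟩
          size P? R? + size P? R? * ηH     ≤⟨ +-monoˡ-≤ _ (size≤η P? R?) ⟩
          suc (size P? R?) * ηH            ≤⟨ *-monoˡ-≤ ηH (≤∧≢⇒< (size≤η P? R?) ¬t) ⟩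
          ηH * ηH ∎))

-- Filters and permutations of lists

𝟙-¬+𝟙 : {P : Set} (p : Dec P) → 𝟙 (¬? p) + 𝟙 p ≡ 1
𝟙-¬+𝟙 (yes _) = refl
𝟙-¬+𝟙 (no _)  = refl

∑-filter : ∀ {P : A → Set} (P? : ∀ x → Dec (P x)) xs (φ : A → ℕ) →
  ∑ (filter P? xs) φ ≡ ∑ xs (λ x → 𝟙 (P? x) * φ x)
∑-filter P? []       φ = refl
∑-filter P? (x ∷ xs) φ with P? x
... | yes _ = cong₂ _+_ (sym (*-identityˡ (φ x))) (∑-filter P? xs φ)
... | no  _ = ∑-filter P? xs φ

length-∑ : ∀ (xs : List A) → length xs ≡ ∑ xs (λ _ → 1)
length-∑ xs = sym (trans (∑-const xs 1) (*-identityʳ _))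

AllPairs-strengthen : ∀ {P : A → Set} {R : A → A → Set} {xs} → All P xs → AllPairs R xs →
  AllPairs (λ x y → P x × P y × R x y) xs
AllPairs-strengthen []       []       = []
AllPairs-strengthen (p ∷ ps) (r ∷ rs) = All.zipWith (λ { (py , rxy) → p , py , rxy }) (ps , r) ∷ AllPairs-strengthen ps rs

AllPairs-↭ : ∀ {R : A → A → Set} → (∀ {x y} → R x y → R y x) → ∀ {xs ys} → xs ↭ ys → AllPairs R xs → AllPairs R ys
AllPairs-↭ s Perm.refl         rs                    = rs
AllPairs-↭ s (Perm.prep x p)   (r ∷ rs)              = All-resp-↭ p r ∷ AllPairs-↭ s p rs
AllPairs-↭ s (Perm.swap x y p) ((rxy ∷ rx) ∷ ry ∷ rs) = (s rxy ∷ All-resp-↭ p ry) ∷ All-resp-↭ p rx ∷ AllPairs-↭ s p rs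
AllPairs-↭ s (Perm.trans p p′) rs                    = AllPairs-↭ s p′ (AllPairs-↭ s p rs)

-- Extracting a linear inequality from exponents

-- Bernoulli's inequality for `(1 - 1/(2h)) ^ h` with `h = suc k`. The factor `suc (2 * g)` of the
-- weight `F` is chosen to match it.
pow-half : ∀ k → (2 * suc k) ^ suc k ≤ 2 * (suc (2 * k)) ^ suc k
pow-half k = begin
  (2 * h) ^ h              ≡⟨ r₀ k ((2 * h) ^ k) ⟩
  2 * (h * p)              ≤⟨ *-monoʳ-≤ 2 (+-cancelʳ-≤ (h * p) (h * p) (G ^ h) hp≤) ⟩
  2 * G ^ h ∎
  where
  open ≤-Reasoning
  h = suc k
  G = suc (2 * k)
  p = (2 * h) ^ k
  r₀ : ∀ k p → 2 * suc k * p ≡ 2 * (suc k * p)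
  r₀ = solve-∀
  r₁ : ∀ k p → suc k * p + suc k * p + k * (suc (2 * k) * p) ≡ suc k * (suc (2 * k) * p) + p
  r₁ = solve-∀
  r₂ : ∀ k p g → g + k * (2 * suc k * p) + p ≡ g + suc k * p + k * (suc (2 * k) * p)
  r₂ = solve-∀
  hp≤ : h * p + h * p ≤ G ^ h + h * p
  hp≤ = +-cancelʳ-≤ (k * (G * p)) _ _ (begin
    h * p + h * p + k * (G * p)    ≡⟨ r₁ k p ⟩
    h * (G * p) + p                ≤⟨ +-monoˡ-≤ p (young k G (2 * h)) ⟩
    G ^ h + k * (2 * h) ^ h + p    ≡⟨ r₂ k p (G ^ h) ⟩
    G ^ h + h * p + k * (G * p) ∎)

^-exponent-≤ : ∀ {a b} → 2 ^ a ≤ 2 ^ b → a ≤ b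
^-exponent-≤ {a} {b} le with a ℕ.≤? b
... | yes p = p
... | no ¬p = ⊥-elim (<⇒≱ (^-monoʳ-< 2 (s≤s (s≤s z≤n)) (≰⇒> ¬p)) le)

-- Everything is raised to the power (k+1)η, which turns (1+1/η)^η and (1+1/(2k+1))^(k+1) into a factor
-- at least 2 and at most 2 respectively, and then powers of 2 are compared.
linearise : ∀ η q k T NT FL W J → 1 ≤ η → 1 ≤ q →
  η * (q * q * suc (2 * k)) ≤ 2 ^ J →
  η ^ T * W ≤ (η * η * (q * q * suc (2 * k)) + q * q) ^ T →
  (η * (q * q * suc (2 * k))) ^ T * suc η ^ NT ≤ W * η ^ NT * (η * (q * q * suc (2 * k))) ^ FL →
  suc k * NT ≤ η * T + J * (suc k * η) * FL
linearise η@(suc η′) q k T NT FL W J η≥1 q≥1 F≤ hA hB = ^-exponent-≤ (*-cancelˡ-≤ c {{c≢0}} (begin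
    c * 2 ^ (h * NT)
      ≡⟨ r₁ ((G ^ h) ^ (T * η)) ((η ^ η) ^ (h * NT)) (2 ^ (h * NT)) ⟩
    (G ^ h) ^ (T * η) * (2 ^ (h * NT) * (η ^ η) ^ (h * NT))
      ≡⟨ cong ((G ^ h) ^ (T * η) *_) (^-distribʳ-* (h * NT) 2 (η ^ η)) ⟨
    (G ^ h) ^ (T * η) * (2 * η ^ η) ^ (h * NT)
      ≤⟨ *-monoʳ-≤ ((G ^ h) ^ (T * η)) (^-monoˡ-≤ (h * NT) (double-pow η′)) ⟩
    (G ^ h) ^ (T * η) * (suc η ^ η) ^ (h * NT)
      ≡⟨ cong₂ _*_ (swap-exp G h T η) (swap-exp′ (suc η) η h NT) ⟩
    (G ^ T) ^ (h * η) * (suc η ^ NT) ^ (h * η)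
      ≡⟨ ^-distribʳ-* (h * η) (G ^ T) (suc η ^ NT) ⟨
    (G ^ T * suc η ^ NT) ^ (h * η)
      ≤⟨ ^-monoˡ-≤ (h * η) main ⟩
    ((2 * h) ^ T * η ^ NT * (2 ^ J) ^ FL) ^ (h * η)
      ≡⟨ trans (^-distribʳ-* (h * η) ((2 * h) ^ T * η ^ NT) _) (cong (_* ((2 ^ J) ^ FL) ^ (h * η)) (^-distribʳ-* (h * η) ((2 * h) ^ T) (η ^ NT))) ⟩
    ((2 * h) ^ T) ^ (h * η) * (η ^ NT) ^ (h * η) * ((2 ^ J) ^ FL) ^ (h * η)
      ≡⟨ cong₂ _*_ (cong₂ _*_ (sym (swap-exp (2 * h) h T η)) (sym (swap-exp′ η η h NT))) lemJ ⟩
    ((2 * h) ^ h) ^ (T * η) * (η ^ η) ^ (h * NT) * 2 ^ (J * (h * η) * FL)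
      ≤⟨ *-monoˡ-≤ (2 ^ (J * (h * η) * FL)) (*-monoˡ-≤ ((η ^ η) ^ (h * NT)) (^-monoˡ-≤ (T * η) (pow-half k))) ⟩
    (2 * G ^ h) ^ (T * η) * (η ^ η) ^ (h * NT) * 2 ^ (J * (h * η) * FL)
      ≡⟨ cong (λ t → t * (η ^ η) ^ (h * NT) * 2 ^ (J * (h * η) * FL)) (^-distribʳ-* (T * η) 2 (G ^ h)) ⟩
    2 ^ (T * η) * (G ^ h) ^ (T * η) * (η ^ η) ^ (h * NT) * 2 ^ (J * (h * η) * FL)
      ≡⟨ r₂ (2 ^ (T * η)) ((G ^ h) ^ (T * η)) ((η ^ η) ^ (h * NT)) (2 ^ (J * (h * η) * FL)) ⟩
    c * (2 ^ (T * η) * 2 ^ (J * (h * η) * FL))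
      ≡⟨ cong (c *_) (trans (sym (^-distribˡ-+-* 2 (T * η) _)) (cong (λ t → 2 ^ (t + J * (h * η) * FL)) (*-comm T η))) ⟩
    c * 2 ^ (η * T + J * (h * η) * FL) ∎))
  where
  open ≤-Reasoning
  h = suc k
  G = suc (2 * k)
  c = (G ^ h) ^ (T * η) * (η ^ η) ^ (h * NT)
  F = q * q * G
  q≢0 : NonZero q
  q≢0 = >-nonZero q≥1
  c≢0 : NonZero c
  c≢0 = m*n≢0 _ _ {{m^n≢0 _ (T * η) {{m^n≢0 G h}}}} {{m^n≢0 _ (h * NT) {{m^n≢0 η η}}}}
  r₁ : ∀ a b c → a * b * c ≡ a * (c * b)
  r₁ = solve-∀
  r₂ : ∀ a b c d → a * b * c * d ≡ b * c * (a * d)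
  r₂ = solve-∀
  swap-exp : ∀ x h T η → (x ^ h) ^ (T * η) ≡ (x ^ T) ^ (h * η)
  swap-exp x h T η = trans (^-*-assoc x h (T * η)) (trans (cong (x ^_) (r h T η)) (sym (^-*-assoc x T (h * η))))
    where
    r : ∀ h T η → h * (T * η) ≡ T * (h * η)
    r = solve-∀
  swap-exp′ : ∀ x η h NT → (x ^ η) ^ (h * NT) ≡ (x ^ NT) ^ (h * η)
  swap-exp′ x η h NT = trans (^-*-assoc x η (h * NT)) (trans (cong (x ^_) (r η h NT)) (sym (^-*-assoc x NT (h * η))))
    where
    r : ∀ η h NT → η * (h * NT) ≡ NT * (h * η)
    r = solve-∀
  lemJ : ((2 ^ J) ^ FL) ^ (h * η) ≡ 2 ^ (J * (h * η) * FL)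
  lemJ = trans (cong (_^ (h * η)) (^-*-assoc 2 J FL)) (trans (^-*-assoc 2 (J * FL) (h * η)) (cong (2 ^_) (r J FL (h * η))))
    where
    r : ∀ a b c → a * b * c ≡ a * c * b
    r = solve-∀
  D = η * η * (q * q)
  -- Since `η * η * F = D * G` with `G = 2h - 1`, failed predictions inflate the bound on a block by
  -- at most the ratio `2h / (2h - 1)`.
  E≤ : η * η * F + q * q ≤ D * (2 * h)
  E≤ = begin
    η * η * F + q * q                       ≤⟨ +-monoʳ-≤ (η * η * F) (m≤n*m (q * q) (η * η)) ⟩
    η * η * F + η * η * (q * q)             ≡⟨ r η (q * q) k ⟩
    D * (2 * h) ∎
    where
    r : ∀ η p k → η * η * (p * suc (2 * k)) + η * η * p ≡ η * η * p * (2 * suc k)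
    r = solve-∀
  main : G ^ T * suc η ^ NT ≤ (2 * h) ^ T * η ^ NT * (2 ^ J) ^ FL
  main = *-cancelˡ-≤ (D ^ T) {{m^n≢0 D T {{m*n≢0 (η * η) (q * q) {{m*n≢0 η η}} {{m*n≢0 q q {{q≢0}} {{q≢0}}}}}}}} (begin
    D ^ T * (G ^ T * suc η ^ NT)
      ≡⟨ *-assoc (D ^ T) (G ^ T) _ ⟨
    D ^ T * G ^ T * suc η ^ NT
      ≡⟨ cong (_* suc η ^ NT) (trans (sym (^-distribʳ-* T D G)) (trans (cong (_^ T) (r₃ η (q * q) G)) (^-distribʳ-* T η (η * F)))) ⟩
    η ^ T * (η * F) ^ T * suc η ^ NT
      ≡⟨ *-assoc (η ^ T) _ _ ⟩
    η ^ T * ((η * F) ^ T * suc η ^ NT)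
      ≤⟨ *-monoʳ-≤ (η ^ T) hB ⟩
    η ^ T * (W * η ^ NT * (η * F) ^ FL)
      ≡⟨ r₄ (η ^ T) W (η ^ NT) ((η * F) ^ FL) ⟩
    η ^ T * W * (η ^ NT * (η * F) ^ FL)
      ≤⟨ *-mono-≤ (≤-trans hA (^-monoˡ-≤ T E≤)) (*-monoʳ-≤ (η ^ NT) (^-monoˡ-≤ FL F≤)) ⟩
    (D * (2 * h)) ^ T * (η ^ NT * (2 ^ J) ^ FL)
      ≡⟨ cong (_* (η ^ NT * (2 ^ J) ^ FL)) (^-distribʳ-* T D (2 * h)) ⟩
    D ^ T * (2 * h) ^ T * (η ^ NT * (2 ^ J) ^ FL)
      ≡⟨ r₅ (D ^ T) ((2 * h) ^ T) (η ^ NT) ((2 ^ J) ^ FL) ⟩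
    D ^ T * ((2 * h) ^ T * η ^ NT * (2 ^ J) ^ FL) ∎)
    where
    r₃ : ∀ η p g → η * η * p * g ≡ η * (η * (p * g))
    r₃ = solve-∀
    r₄ : ∀ a b c d → a * (b * c * d) ≡ a * b * (c * d)
    r₄ = solve-∀
    r₅ : ∀ a b c d → a * b * (c * d) ≡ a * (b * c * d)
    r₅ = solve-∀

-- Homomorphisms, revealed colours and a lower bound on their number

module Model (H : Graph) (k : ℕ) (ev-m : ev (suc k) ≡ true) (d : ℕ) .{{_ : NonZero (Graph.n H)}} where

  open Colours H public
  open Torus k ev-m d public

  N : ℕ
  N = m ^ d

  Config : Set
  Config = Vec Colour N

  configs : List Config
  configs = vecs N q

  sites : List Site
  sites = allFin N

  abstract
    allMove? : {P : Move → Set} → (∀ δ → Dec (P δ)) → Dec (∀ δ → P δ)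
    allMove? P? = map′
      (λ { h (j , true) → proj₁ (h j) ; h (j , false) → proj₂ (h j) })
      (λ h j → h (j , true) , h (j , false))
      (all? (λ j → P? (j , true) ×-dec P? (j , false)))

  Hom : Config → Set
  Hom f = ∀ x δ → Adj (lookup f x) (lookup f (mv δ x))

  abstract
    Hom? : ∀ f → Dec (Hom f)
    Hom? f = all? (λ x → allMove? (λ δ → Adj? (lookup f x) (lookup f (mv δ x))))

  homs : List Config
  homs = filter Hom? configs

  Z : ℕ
  Z = ∑ configs (λ f → 𝟙 (Hom? f))

  length-homs : length homs ≡ Z
  length-homs = trans (length-∑ homs) (trans (∑-filter Hom? configs _) (∑-cong configs (λ f → *-identityʳ _)))

  Q : Config → Site → Colour → Set
  Q f x c = ∃ λ δ → lookup f (mv δ x) ≡ c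

  abstract
    Q? : ∀ f x c → Dec (Q f x c)
    Q? f x c = anyMove? (λ δ → lookup f (mv δ x) ≟ c)

  K : Config → Site → Colour → Set
  K f x = Co (Q f x)

  abstract
    K? : ∀ f x c → Dec (K f x c)
    K? f x = Co? (Q? f x)

  -- Colours seen by o (by e i o) at the displacements that, seen from s, lead into the past of s.
  X Y : Fin d → Config → Site → Site → Colour → Set
  X i f o s c = ∃ λ δ → rank i (mv δ s) < rank i s × lookup f (mv δ o) ≡ c
  Y i f o s c = ∃ λ δ → rank i (mv δ (e i s)) < rank i s × lookup f (mv δ (e i o)) ≡ c

  abstract
    X? : ∀ i f o s c → Dec (X i f o s c)
    X? i f o s c = anyMove? (λ δ → rank i (mv δ s) ℕ.<? rank i s ×-dec lookup f (mv δ o) ≟ c)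

  abstract
    Y? : ∀ i f o s c → Dec (Y i f o s c)
    Y? i f o s c = anyMove? (λ δ → rank i (mv δ (e i s)) ℕ.<? rank i s ×-dec lookup f (mv δ (e i o)) ≟ c)

  Tight : Fin d → Config → Site → Site → Set
  Tight i f o s = size (X? i f o s) (Y? i f o s) ≡ ηH

  Tight? : ∀ i f o s → Dec (Tight i f o s)
  Tight? i f o s = size (X? i f o s) (Y? i f o s) ℕ.≟ ηH

  -- The failure of the prediction for `e i o`, in the order seen from `s`.
  Flag? : ∀ i f o s → Dec (¬ X i f o s (lookup f (e i o)))
  Flag? i f o s = ¬? (X? i f o s (lookup f (e i o)))

  Loose? : ∀ i f o s → Dec (¬ Tight i f o s × X i f o s (lookup f (e i o)))
  Loose? i f o s = ¬? (Tight? i f o s) ×-dec X? i f o s (lookup f (e i o))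

  X-cong : ∀ i {f g o o′ s} → (∀ δ → rank i (mv δ s) < rank i s → lookup f (mv δ o) ≡ lookup g (mv δ o′)) →
    ∀ c → X i f o s c → X i g o′ s c
  X-cong i h c (δ , lt , eq) = δ , lt , trans (sym (h δ lt)) eq

  Y-cong : ∀ i {f g o o′ s} → (∀ δ → rank i (mv δ (e i s)) < rank i s → lookup f (mv δ (e i o)) ≡ lookup g (mv δ (e i o′))) →
    ∀ c → Y i f o s c → Y i g o′ s c
  Y-cong i h c (δ , lt , eq) = δ , lt , trans (sym (h δ lt)) eq

  -- The bijection `e i` exchanges the two values of `β`. This serves both the lower ends of
  -- direction `i` and the bipartition.
  alternating-half : ∀ i (β : Site → Bool) → (∀ x → β (e i x) ≡ not (β x)) → ∀ b →
    2 * ∑ sites (λ x → 𝟙 (β x Bool.≟ b)) ≡ N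
  alternating-half i β alt b = begin
    2 * S b                        ≡⟨ r (S b) ⟩
    S b + S b                      ≡⟨ cong (S b +_) flip ⟩
    S b + ∑ sites (λ x → 𝟙 (not (β x) Bool.≟ b)) ≡⟨ ∑-+ sites _ _ ⟨
    ∑ sites (λ x → 𝟙 (β x Bool.≟ b) + 𝟙 (not (β x) Bool.≟ b))
                                   ≡⟨ ∑-cong sites (λ x → one (β x) b) ⟩
    ∑ sites (λ _ → 1)              ≡⟨ length-∑ sites ⟨
    length sites                   ≡⟨ length-allFin N ⟩
    N ∎
    where
    open ≡-Reasoning
    S : Bool → ℕ
    S b = ∑ sites (λ x → 𝟙 (β x Bool.≟ b))
    r : ∀ a → 2 * a ≡ a + a
    r = solve-∀
    one : ∀ b c → 𝟙 (b Bool.≟ c) + 𝟙 (not b Bool.≟ c) ≡ 1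
    one true  true  = refl
    one true  false = refl
    one false true  = refl
    one false false = refl
    flip : S b ≡ ∑ sites (λ x → 𝟙 (not (β x) Bool.≟ b))
    flip = trans
      (sym (∑-bijection (Unique.allFin⁺ N) (Unique.allFin⁺ N) ∈-allFin ∈-allFin (mv (i , true)) (mv (i , false))
        (mv-inverse (i , true)) (mv-inverse′ (i , true)) (λ x → 𝟙 (β x Bool.≟ b))))
      (∑-cong sites (λ x → cong (λ t → 𝟙 (t Bool.≟ b)) (alt x)))

  lows-sum : ∀ i → 2 * ∑ sites (λ x → 𝟙 (Low? i x)) ≡ N
  lows-sum i = alternating-half i (λ x → ev (toℕ (coord x i))) (ev-coord-e i) true

  -- For an optimal pair `A ~ B`, any colouring of the even class from `A` and the odd class from
  -- `B` is a homomorphism, and each class has `P` sites.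
  hom-lower : ∀ i P → 2 * P ≡ N → ηH ^ P ≤ Z
  hom-lower i P 2P≡N with A , B , complete , attained ← η-attained = begin
    ηH ^ P                                                  ≡⟨ cong (_^ P) attained ⟨
    (a * b) ^ P                                             ≡⟨ ^-distribʳ-* P a b ⟩
    a ^ P * b ^ P                                           ≡⟨ cong₂ (λ s t → a ^ s * b ^ t) (half true) (half false) ⟩
    a ^ S true * b ^ S false                                ≡⟨ cong₂ _*_ (∏-^ sites a _) (∏-^ sites b _) ⟨
    ∏ sites (λ x → a ^ 𝟙 (par x Bool.≟ true)) * ∏ sites (λ x → b ^ 𝟙 (par x Bool.≟ false))
                                                            ≡⟨ ∏-* sites _ _ ⟨
    ∏ sites (λ x → a ^ 𝟙 (par x Bool.≟ true) * b ^ 𝟙 (par x Bool.≟ false))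
                                                            ≡⟨ ∏-cong sites (λ x → pick (par x)) ⟩
    ∏ sites (λ x → ∑ (allFin q) (g (par x)))                ≡⟨ ∑-vecs-∏ N (λ x → g (par x)) ⟨
    ∑ configs (λ f → ∏ sites (λ x → g (par x) (lookup f x))) ≤⟨ ∑-mono configs hom ⟩
    Z ∎
    where
    open ≤-Reasoning
    a = # (Member? A)
    b = # (Member? B)
    S : Bool → ℕ
    S t = ∑ sites (λ x → 𝟙 (par x Bool.≟ t))
    half : ∀ t → P ≡ S t
    half t = *-cancelˡ-≡ P (S t) 2 (trans 2P≡N (sym (alternating-half i par (λ x → par-mv (i , true) x) t)))
    g : Bool → Colour → ℕ
    g true  c = 𝟙 (Member? A c)
    g false c = 𝟙 (Member? B c)
    pick : ∀ t → a ^ 𝟙 (t Bool.≟ true) * b ^ 𝟙 (t Bool.≟ false) ≡ ∑ (allFin q) (g t)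
    pick true  = trans (*-identityʳ _) (*-identityʳ a)
    pick false = trans (*-identityˡ _) (*-identityʳ b)
    ∏≥1 : ∀ (xs : List Site) (φ : Site → ℕ) → 1 ≤ ∏ xs φ → ∀ {x} → x ∈ xs → 1 ≤ φ x
    ∏≥1 (y ∷ xs) φ le (here refl) with φ y
    ... | suc _ = s≤s z≤n
    ∏≥1 (y ∷ xs) φ le (there i) with ∏ xs φ in eq
    ... | suc _ = ∏≥1 xs φ (subst (1 ≤_) (sym eq) (s≤s z≤n)) i
    ... | zero with () ← subst (1 ≤_) (*-zeroʳ (φ y)) le
    ∏≤1 : ∀ (xs : List Site) (φ : Site → ℕ) → (∀ x → φ x ≤ 1) → ∏ xs φ ≤ 1
    ∏≤1 []       φ h = ≤-refl
    ∏≤1 (x ∷ xs) φ h = *-mono-≤ (h x) (∏≤1 xs φ h)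
    g≤1 : ∀ t c → g t c ≤ 1
    g≤1 true  c = 𝟙≤1 (Member? A c)
    g≤1 false c = 𝟙≤1 (Member? B c)
    unit : ∀ {P : Set} (D : Dec P) → 1 ≤ 𝟙 D → P
    unit (yes p) _ = p
    adjacent : ∀ t c c′ → 1 ≤ g t c → 1 ≤ g (not t) c′ → Adj c c′
    adjacent true  c c′ p r = complete (unit (Member? A c) p) (unit (Member? B c′) r)
    adjacent false c c′ p r = Adj-sym (complete (unit (Member? A c′) r) (unit (Member? B c) p))
    hom : ∀ f → ∏ sites (λ x → g (par x) (lookup f x)) ≤ 𝟙 (Hom? f)
    hom f with 1 ℕ.≤? ∏ sites (λ x → g (par x) (lookup f x))
    ... | no ≱1 = ≤-trans (s≤s⁻¹ (≰⇒> ≱1)) z≤n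
    ... | yes ≥1 = ≤-trans (∏≤1 sites _ (λ x → g≤1 (par x) _)) (≤-reflexive (sym (𝟙-yes (Hom? f) (λ x δ →
            adjacent (par x) _ _ (at x) (subst (λ t → 1 ≤ g t (lookup f (mv δ x))) (par-mv δ x) (at (mv δ x)))))))
      where
      at : ∀ x → 1 ≤ g (par x) (lookup f x)
      at x = ∏≥1 sites (λ x → g (par x) (lookup f x)) ≥1 (∈-allFin x)

-- Translation invariance

module Invariance (H : Graph) (k : ℕ) (ev-m : ev (suc k) ≡ true) (d : ℕ) .{{q≢0 : NonZero (Graph.n H)}} where

  open Model H k ev-m d public

  loose flagged : Fin d → Config → Site → Site → ℕ
  loose   i f o s = 𝟙 (Loose? i f o s)
  flagged i f o s = 𝟙 (Flag? i f o s)

  permute : (Site → Site) → Config → Config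
  permute t f = tabulate (lookup f ∘ t)

  lookup-permute : ∀ t f x → lookup (permute t f) x ≡ lookup f (t x)
  lookup-permute t f x = lookup∘tabulate (lookup f ∘ t) x

  permute-undo : ∀ s t → (∀ x → s (t x) ≡ x) → ∀ f → permute t (permute s f) ≡ f
  permute-undo s t st f = trans (tabulate-cong (λ x → trans (lookup-permute s f (t x)) (cong (lookup f) (st x)))) (tabulate∘lookup f)

  ∑-permute : ∀ o p (Φ : Config → ℕ) → ∑ configs (λ f → Φ (permute (translate o p) f)) ≡ ∑ configs Φ
  ∑-permute o p = ∑-bijection {xs = configs} {ys = configs} (unique-vecs N q) (unique-vecs N q) ∈-vecs ∈-vecs
    (permute (translate o p)) (permute (translate p o))
    (permute-undo (translate o p) (translate p o) (translate-inverse p o))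
    (permute-undo (translate p o) (translate o p) (translate-inverse o p))

  translated : ∀ o p f δ x → lookup (permute (translate o p) f) (mv δ x) ≡ lookup f (mv δ (translate o p x))
  translated o p f δ x = trans (lookup-permute (translate o p) f (mv δ x)) (cong (lookup f) (translate-mv o p δ x))

  Hom-permute : ∀ o p f → Hom f → Hom (permute (translate o p) f)
  Hom-permute o p f hom x δ = subst₂ Adj (sym (lookup-permute (translate o p) f x)) (sym (translated o p f δ x)) (hom (translate o p x) δ)

  Hom-unpermute : ∀ o p f → Hom (permute (translate o p) f) → Hom f
  Hom-unpermute o p f hom x δ = subst₂ Adj
    (trans (lookup-permute (translate o p) f (translate p o x)) (cong (lookup f) (translate-inverse p o x)))
    (trans (translated o p f δ (translate p o x)) (cong (lookup f ∘ mv δ) (translate-inverse p o x)))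
    (hom (translate p o x) δ)

  𝟙-Hom-permute : ∀ o p f → 𝟙 (Hom? (permute (translate o p) f)) ≡ 𝟙 (Hom? f)
  𝟙-Hom-permute o p f = 𝟙-cong (Hom? (permute (translate o p) f)) (Hom? f) (Hom-unpermute o p f) (Hom-permute o p f)

  -- Only the observer moves: colours are read at displacements from it, whereas the order is
  -- consulted at the pattern `s`, which stays.
  Invariant : (Config → Site → Site → ℕ) → Set
  Invariant A = ∀ o p f x s → A (permute (translate o p) f) x s ≡ A f (translate o p x) s

  translate-sum : ∀ A → Invariant A → ∀ o p s →
    ∑ configs (λ f → 𝟙 (Hom? f) * A f p s) ≡ ∑ configs (λ f → 𝟙 (Hom? f) * A f o s)
  translate-sum A inv o p s = begin
    ∑ configs (λ f → 𝟙 (Hom? f) * A f p s)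
      ≡⟨ ∑-cong configs (λ f → cong₂ _*_ (sym (𝟙-Hom-permute o p f)) (trans (cong (λ x → A f x s) (sym (translate-base o p))) (sym (inv o p f o s)))) ⟩
    ∑ configs (λ f → 𝟙 (Hom? (permute (translate o p) f)) * A (permute (translate o p) f) o s)
      ≡⟨ ∑-permute o p (λ f → 𝟙 (Hom? f) * A f o s) ⟩
    ∑ configs (λ f → 𝟙 (Hom? f) * A f o s) ∎
    where open ≡-Reasoning

  -- Averaging over the position u of the observer is the same as averaging over the order of revelation
  -- (through s) with the observer fixed at o.
  diagonal : ∀ A → Invariant A → ∀ o (l : Site → ℕ) →
    ∑ configs (λ f → 𝟙 (Hom? f) * ∑ sites (λ u → l u * A f u u)) ≡ ∑ configs (λ f → 𝟙 (Hom? f) * ∑ sites (λ s → l s * A f o s))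
  diagonal A inv o l = begin
    ∑ configs (λ f → 𝟙 (Hom? f) * ∑ sites (λ u → l u * A f u u))
      ≡⟨ reorder (λ f u → A f u u) ⟩
    ∑ sites (λ u → l u * ∑ configs (λ f → 𝟙 (Hom? f) * A f u u))
      ≡⟨ ∑-cong sites (λ u → cong (l u *_) (translate-sum A inv o u u)) ⟩
    ∑ sites (λ s → l s * ∑ configs (λ f → 𝟙 (Hom? f) * A f o s))
      ≡⟨ reorder (λ f s → A f o s) ⟨
    ∑ configs (λ f → 𝟙 (Hom? f) * ∑ sites (λ s → l s * A f o s)) ∎
    where
    open ≡-Reasoning
    r : ∀ a b c → a * (b * c) ≡ b * (a * c)
    r = solve-∀
    reorder : ∀ (B : Config → Site → ℕ) → ∑ configs (λ f → 𝟙 (Hom? f) * ∑ sites (λ u → l u * B f u)) ≡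
      ∑ sites (λ u → l u * ∑ configs (λ f → 𝟙 (Hom? f) * B f u))
    reorder B = trans
      (∑-cong configs (λ f → trans (sym (∑-*ˡ sites (𝟙 (Hom? f)) _)) (∑-cong sites (λ u → r (𝟙 (Hom? f)) (l u) (B f u)))))
      (trans (∑-swap configs sites _) (∑-cong sites (λ u → ∑-*ˡ configs (l u) _)))

  module _ (i : Fin d) (o p : Site) (f : Config) (x s : Site) where

    private
      f′ = permute (translate o p) f
      x′ = translate o p x
      same : ∀ δ → lookup f′ (mv δ x) ≡ lookup f (mv δ x′)
      same δ = translated o p f δ x
      same-e : ∀ δ → lookup f′ (mv δ (e i x)) ≡ lookup f (mv δ (e i x′))
      same-e δ = trans (translated o p f δ (e i x)) (cong (lookup f ∘ mv δ) (translate-mv o p (i , true) x))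
      here-e : lookup f′ (e i x) ≡ lookup f (e i x′)
      here-e = same (i , true)

    X-permute : ∀ c → X i f′ x s c → X i f x′ s c
    X-permute = X-cong i {f′} {f} {x} {x′} {s} (λ δ _ → same δ)

    X-unpermute : ∀ c → X i f x′ s c → X i f′ x s c
    X-unpermute = X-cong i {f} {f′} {x′} {x} {s} (λ δ _ → sym (same δ))

    seen-permute : X i f′ x s (lookup f′ (e i x)) → X i f x′ s (lookup f (e i x′))
    seen-permute h = subst (X i f x′ s) here-e (X-permute _ h)

    seen-unpermute : X i f x′ s (lookup f (e i x′)) → X i f′ x s (lookup f′ (e i x))
    seen-unpermute h = X-unpermute _ (subst (X i f x′ s) (sym here-e) h)

    size-permute : size (X? i f′ x s) (Y? i f′ x s) ≡ size (X? i f x′ s) (Y? i f x′ s)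
    size-permute = size-cong (X? i f′ x s) (Y? i f′ x s) (X? i f x′ s) (Y? i f x′ s)
      X-permute X-unpermute (Y-cong i {f′} {f} {x} {x′} {s} (λ δ _ → same-e δ)) (Y-cong i {f} {f′} {x′} {x} {s} (λ δ _ → sym (same-e δ)))

  flagged-invariant : ∀ i → Invariant (flagged i)
  flagged-invariant i o p f x s = 𝟙-cong (Flag? i (permute (translate o p) f) x s) (Flag? i f (translate o p x) s)
    (λ ¬h h → ¬h (seen-unpermute i o p f x s h)) (λ ¬h h → ¬h (seen-permute i o p f x s h))

  loose-invariant : ∀ i → Invariant (loose i)
  loose-invariant i o p f x s = 𝟙-cong (Loose? i (permute (translate o p) f) x s) (Loose? i f (translate o p x) s)
    (λ { (¬t , h) → (λ t → ¬t (trans (size-permute i o p f x s) t)) , seen-permute i o p f x s h })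
    (λ { (¬t , h) → (λ t → ¬t (trans (sym (size-permute i o p f x s)) t)) , seen-unpermute i o p f x s h })

-- The coding bound: loose pairs against failed predictions

∏∏-expand : ∀ (xs : List A) (ys : List B) (c a : ℕ) (φ : A → B → ℕ) →
  ∏ xs (λ x → ∏ ys (λ y → c * a ^ φ x y)) ≡ c ^ (length ys * length xs) * a ^ ∑ xs (λ x → ∑ ys (φ x))
∏∏-expand xs ys c a φ = begin
  ∏ xs (λ x → ∏ ys (λ y → c * a ^ φ x y))
    ≡⟨ ∏-cong xs (λ x → trans (∏-* ys _ _) (cong₂ _*_ (∏-const ys c) (∏-^ ys a (φ x)))) ⟩
  ∏ xs (λ x → c ^ length ys * a ^ ∑ ys (φ x))
    ≡⟨ trans (∏-* xs _ _) (cong₂ _*_ (∏-const xs _) (∏-^ xs a _)) ⟩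
  (c ^ length ys) ^ length xs * a ^ ∑ xs (λ x → ∑ ys (φ x))
    ≡⟨ cong (_* a ^ ∑ xs (λ x → ∑ ys (φ x))) (^-*-assoc c (length ys) (length xs)) ⟩
  c ^ (length ys * length xs) * a ^ ∑ xs (λ x → ∑ ys (φ x)) ∎
  where open ≡-Reasoning

∏∏-* : ∀ (xs : List A) (ys : List B) (φ ψ : A → B → ℕ) →
  ∏ xs (λ x → ∏ ys (λ y → φ x y * ψ x y)) ≡ ∏ xs (λ x → ∏ ys (φ x)) * ∏ xs (λ x → ∏ ys (ψ x))
∏∏-* xs ys φ ψ = trans (∏-cong xs (λ x → ∏-* ys (φ x) (ψ x))) (∏-* xs _ _)

∏∏-^ : ∀ (xs : List A) (ys : List B) a (φ : A → B → ℕ) →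
  ∏ xs (λ x → ∏ ys (λ y → a ^ φ x y)) ≡ a ^ ∑ xs (λ x → ∑ ys (φ x))
∏∏-^ xs ys a φ = trans (∏-cong xs (λ x → ∏-^ ys a (φ x))) (∏-^ xs a _)

module Coding (H : Graph) (k : ℕ) (ev-m : ev (suc k) ≡ true) (d : ℕ) .{{q≢0 : NonZero (Graph.n H)}} (g : ℕ) where

  open Invariance H k ev-m d

  F E : ℕ
  F = q * q * suc (2 * g)
  E = ηH * ηH * F + q * q

  open Weight F hiding (Tight?)

  ω : Fin d → Site → Config → ℕ
  ω i u f = blockWeight (X? i f u u) (Y? i f u u) (lookup f u) (lookup f (e i u))

  ω-cong : ∀ i (u : Site) (f f′ : Config) →
    (∀ δ → rank i (mv δ u) < rank i u → lookup f (mv δ u) ≡ lookup f′ (mv δ u)) →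
    (∀ δ → rank i (mv δ (e i u)) < rank i u → lookup f (mv δ (e i u)) ≡ lookup f′ (mv δ (e i u))) →
    ∀ a b → blockWeight (X? i f u u) (Y? i f u u) a b ≡ blockWeight (X? i f′ u u) (Y? i f′ u u) a b
  ω-cong i u f f′ h h′ = blockWeight-cong (X? i f u u) (Y? i f u u) (X? i f′ u u) (Y? i f′ u u)
    (X-cong i {f} {f′} {u} {u} {u} h) (X-cong i {f′} {f} {u} {u} {u} (λ δ lt → sym (h δ lt)))
    (Y-cong i {f} {f′} {u} {u} {u} h′) (Y-cong i {f′} {f} {u} {u} {u} (λ δ lt → sym (h′ δ lt)))

  unaffected : ∀ i (u x : Site) (f : Config) (c : Colour) → ¬ (rank i x < rank i u) → ∀ y → rank i y < rank i u → lookup (f [ x ]≔ c) y ≡ lookup f y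
  unaffected i u x f c ¬lt y lt = lookup∘update′ (λ { refl → ¬lt lt }) f c

  ω-indep : ∀ i u x → x ≢ u → x ≢ e i u → ¬ (rank i x < rank i u) → Indep x (ω i u)
  ω-indep i u x x≢u x≢v ¬lt f c = trans
    (cong₂ (blockWeight (X? i f′ u u) (Y? i f′ u u)) (lookup∘update′ (x≢u ∘ sym) f c) (lookup∘update′ (x≢v ∘ sym) f c))
    (ω-cong i u f′ f (λ δ → unaffected i u x f c ¬lt (mv δ u)) (λ δ → unaffected i u x f c ¬lt (mv δ (e i u)))
      (lookup f u) (lookup f (e i u)))
    where
    f′ : Config
    f′ = f [ x ]≔ c

  ends : Fin d → Site → List Site
  ends i u = u ∷ e i u ∷ []

  -- Neither end precedes `u`, so recolouring both leaves the revealed sets fixed and the sum is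
  -- that of a single block weight.
  ω-sum : ∀ i u → Low i u → ∀ f → ∑upd (ends i u) (ω i u) f ≤ E
  ω-sum i u low f = ≤-trans
    (≤-reflexive (∑-cong (allFin q) (λ c → ∑-cong (allFin q) (λ c′ → trans
      (cong₂ (blockWeight (X? i (new c c′) u u) (Y? i (new c c′) u u))
        (trans (lookup∘update′ (mv≢ (i , true) u ∘ sym) (f [ u ]≔ c) c′) (lookup∘update u f c))
        (lookup∘update (e i u) (f [ u ]≔ c) c′))
      (ω-cong i u (new c c′) f (λ δ → same c c′ (mv δ u)) (λ δ → same c c′ (mv δ (e i u))) c c′)))))
    (blockWeight-sum (X? i f u u) (Y? i f u u))
    where
    new : Colour → Colour → Config
    new c c′ = f [ u ]≔ c [ e i u ]≔ c′
    same : ∀ (c c′ : Colour) y → rank i y < rank i u → lookup (f [ u ]≔ c [ e i u ]≔ c′) y ≡ lookup f y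
    same c c′ y lt = trans
      (unaffected i u (e i u) (f [ u ]≔ c) c′ (≤⇒≯ (rank-e-≥ i u low)) y lt)
      (unaffected i u u f c (<-irrefl refl) y lt)

  -- `eliminate` averages out the head first, and it is the last revealed block that no other weight
  -- sees. Ties are harmless because the past is strict.
  descending : Fin d → DecTotalOrder _ _ _
  descending i = On.decTotalOrder (Flip.decTotalOrder ≤-decTotalOrder) (rank i)

  blocks : Fin d → List Site
  blocks i = Data.List.Sort.sort (descending i) (filter (Low? i) sites)

  blocks-↭ : ∀ i → blocks i ↭ filter (Low? i) sites
  blocks-↭ i = Data.List.Sort.sort-↭ (descending i) (filter (Low? i) sites)

  blocks-sorted : ∀ i → AllPairs (λ u u′ → rank i u′ ≤ rank i u) (blocks i)
  blocks-sorted i = Sorted⇒AllPairs (DecTotalOrder.totalOrder (descending i))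
    (Data.List.Sort.sort-↗ (descending i) (filter (Low? i) sites))

  blocks-low : ∀ i → All (Low i) (blocks i)
  blocks-low i = All-resp-↭ (↭-sym (blocks-↭ i)) (All.all-filter (Low? i) sites)

  blocks-unique : ∀ i → Unique (blocks i)
  blocks-unique i = AllPairs-↭ (λ ne → ne ∘ sym) (↭-sym (blocks-↭ i)) (Unique.filter⁺ (Low? i) (Unique.allFin⁺ N))

  ∑-blocks : ∀ i (φ : Site → ℕ) → ∑ (blocks i) φ ≡ ∑ sites (λ u → 𝟙 (Low? i u) * φ u)
  ∑-blocks i φ = trans (∑-↭ φ (blocks-↭ i)) (∑-filter (Low? i) sites φ)

  length-blocks : ∀ i → 2 * length (blocks i) ≡ N
  length-blocks i = trans (cong (2 *_) (trans (length-∑ (blocks i)) (trans (∑-blocks i _) (∑-cong sites (λ u → *-identityʳ _))))) (lows-sum i)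

  -- A Kraft-type inequality: averaging out a block costs `E / (q * q)`, and the
  -- `(q * q) ^ P = q ^ N` configurations cancel the denominators.
  coding : ∀ i → ∑ configs (λ f → ∏ (blocks i) (λ u → ω i u f)) ≤ E ^ length (blocks i)
  coding i = *-cancelˡ-≤ ((q * q) ^ P) {{m^n≢0 _ P {{m*n≢0 q q}}}} (begin
      (q * q) ^ P * ∑ configs (λ f → ∏ bs (λ u → ω i u f))
        ≡⟨ cong ((q * q) ^ P *_) (∑-cong configs (λ f → *-identityʳ _)) ⟨
      (q * q) ^ P * ∑ configs (λ f → ∏ bs (λ u → ω i u f) * 1)
        ≤⟨ eliminate bs (ends i) (λ _ → 1) (ω i) (q * q) E
             (AllPairs.map indep (AllPairs-strengthen (blocks-low i) (AllPairs.zip (blocks-unique i , blocks-sorted i))))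
             (All.map step (blocks-low i)) ⟩
      E ^ P * ∑ configs (λ _ → 1)
        ≡⟨ cong (E ^ P *_) (trans (length-vecs N q) (trans (cong (q ^_) (sym (length-blocks i))) (trans (sym (^-*-assoc q 2 P)) (cong (λ t → (q * t) ^ P) (*-identityʳ q))))) ⟩
      E ^ P * (q * q) ^ P
        ≡⟨ *-comm (E ^ P) _ ⟩
      (q * q) ^ P * E ^ P ∎)
    where
    open ≤-Reasoning
    bs = blocks i
    P = length bs
    indep : ∀ {u u′} → Low i u × Low i u′ × u ≢ u′ × rank i u′ ≤ rank i u → All (λ x → Indep x (ω i u′)) (ends i u)
    indep {u} {u′} (l , l′ , u≢u′ , le) =
      ω-indep i u′ u u≢u′ (low≢e l l′) (≤⇒≯ le) ∷
      ω-indep i u′ (e i u) (low≢e l′ l ∘ sym) (u≢u′ ∘ mv-injective (i , true)) (≤⇒≯ (≤-trans le (rank-e-≥ i u l))) ∷ []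
      where
      low≢e : ∀ {x y} → Low i x → Low i y → x ≢ e i y
      low≢e {x} {y} lx ly refl = ≢-not true (trans (sym lx) (trans (ev-coord-e i y) (cong not ly)))
    ∑upd-1 : ∀ u f → ∑upd (ends i u) (λ _ → 1) f ≡ q * q
    ∑upd-1 u f = trans (∑-cong (allFin q) (λ c → ∑-ones q))
      (trans (∑-const (allFin q) q) (cong (_* q) (length-allFin q)))
    step : ∀ {u} → Low i u → ∀ f → q * q * ∑upd (ends i u) (λ f → ω i u f * 1) f ≤ E * ∑upd (ends i u) (λ _ → 1) f
    step {u} l f = ≤-trans
      (≤-trans (*-monoʳ-≤ (q * q) (≤-trans (≤-reflexive (∑-cong (allFin q) (λ c → ∑-cong (allFin q) (λ c′ → *-identityʳ _)))) (ω-sum i u l f)))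
        (≤-reflexive (*-comm (q * q) E)))
      (≤-reflexive (cong (E *_) (sym (∑upd-1 u f))))

  failed : ∀ a → a * 1 ≡ 1 * (1 * (a * 1))
  failed = solve-∀

  -- The cases of `value` merged into one formula: relative to `ηH * F`, a loose pair gains
  -- `(η + 1)/η` and a failed prediction loses `ηH * F`. The divisions stand on the other side.
  value-lower : {A B : Set} (x : Dec A) (t : Dec B) → 1 ≤ ηH * F →
    ηH * F * suc ηH ^ 𝟙 (¬? t ×-dec x) ≤ value x t * (ηH ^ 𝟙 (¬? t ×-dec x) * (ηH * F) ^ 𝟙 (¬? x))
  value-lower (no _)  (yes _) _ = ≤-reflexive (failed (ηH * F))
  value-lower (no _)  (no _)  _ = ≤-reflexive (failed (ηH * F))
  value-lower (yes _) (yes _) _ = ≤-refl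
  value-lower (yes _) (no _)  _ = ≤-reflexive (r ηH F)
    where
    r : ∀ a b → a * b * (suc a * 1) ≡ suc a * b * (a * 1 * 1)
    r = solve-∀

  ω-hom : ∀ i f → Hom f → ∀ u → ω i u f ≡ value (X? i f u u (lookup f (e i u))) (Tight? i f u u)
  ω-hom i f hom u = blockWeight-allowed (X? i f u u) (Y? i f u u)
    (λ { b (δ , _ , refl) → hom u δ }) (λ { b (δ , _ , refl) → hom (e i u) δ })

  ω-lower : ∀ i f → Hom f → 1 ≤ ηH * F → ∀ u →
    ηH * F * suc ηH ^ loose i f u u ≤ ω i u f * (ηH ^ loose i f u u * (ηH * F) ^ flagged i f u u)
  ω-lower i f hom le u = subst (λ w → ηH * F * suc ηH ^ loose i f u u ≤ w * (ηH ^ loose i f u u * (ηH * F) ^ flagged i f u u))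
    (sym (ω-hom i f hom u)) (value-lower (X? i f u u (lookup f (e i u))) (Tight? i f u u) le)

  diagonal-total : (Fin d → Config → Site → Site → ℕ) → Fin d → ℕ
  diagonal-total A i = ∑ configs (λ f → 𝟙 (Hom? f) * ∑ sites (λ u → 𝟙 (Low? i u) * A i f u u))

  -- The AM–GM inequality replaces Jensen's: the mean of the logarithm of the weight is at most the logarithm of its mean.
  loose-vs-flagged : ∀ i J → 1 ≤ ηH → ηH * F ≤ 2 ^ J →
    suc g * diagonal-total loose i ≤ ηH * (N * Z) + J * (suc g * ηH) * diagonal-total flagged i
  loose-vs-flagged i J η≥1 F≤ = begin
    suc g * diagonal-total loose i
      ≡⟨ cong (suc g *_) (total loose) ⟨
    suc g * NT
      ≤⟨ linearise ηH q g (P * Z) NT FL W J η≥1 (>-nonZero⁻¹ q) F≤ hA hB ⟩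
    ηH * (P * Z) + J * (suc g * ηH) * FL
      ≤⟨ +-mono-≤ (*-monoʳ-≤ ηH (*-monoˡ-≤ Z (≤-trans (m≤n*m P 2) (≤-reflexive (length-blocks i)))))
           (≤-reflexive (cong (J * (suc g * ηH) *_) (total flagged))) ⟩
    ηH * (N * Z) + J * (suc g * ηH) * diagonal-total flagged i ∎
    where
    open ≤-Reasoning
    bs = blocks i
    P = length bs
    W = ∏ homs (λ f → ∏ bs (λ u → ω i u f))
    NT = ∑ homs (λ f → ∑ bs (λ u → loose i f u u))
    FL = ∑ homs (λ f → ∑ bs (λ u → flagged i f u u))
    total : ∀ A → ∑ homs (λ f → ∑ bs (λ u → A i f u u)) ≡ diagonal-total A i
    total A = trans (∑-filter Hom? configs _) (∑-cong configs (λ f → cong (𝟙 (Hom? f) *_) (∑-blocks i (λ u → A i f u u))))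
    hA : ηH ^ (P * Z) * W ≤ E ^ (P * Z)
    hA = begin
      ηH ^ (P * Z) * W          ≡⟨ cong (_* W) (^-*-assoc ηH P Z) ⟨
      -- The lower bound on `Z` enters here: it keeps the mean weight of a homomorphism below
      -- `(E / η) ^ P`.
      (ηH ^ P) ^ Z * W          ≤⟨ *-monoˡ-≤ W (^-monoˡ-≤ Z (hom-lower i P (length-blocks i))) ⟩
      Z ^ Z * W                 ≡⟨ cong (λ t → t ^ t * W) length-homs ⟨
      length homs ^ length homs * W ≤⟨ am-gm homs (λ f → ∏ bs (λ u → ω i u f)) ⟩
      ∑ homs (λ f → ∏ bs (λ u → ω i u f)) ^ length homs
                                ≡⟨ cong₂ _^_ (∑-filter Hom? configs _) length-homs ⟩
      ∑ configs (λ f → 𝟙 (Hom? f) * ∏ bs (λ u → ω i u f)) ^ Z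
                                ≤⟨ ^-monoˡ-≤ Z (≤-trans (∑-mono configs (λ f → 𝟙*-≤ (Hom? f) _)) (coding i)) ⟩
      (E ^ P) ^ Z               ≡⟨ ^-*-assoc E P Z ⟩
      E ^ (P * Z) ∎
    hB : (ηH * F) ^ (P * Z) * suc ηH ^ NT ≤ W * ηH ^ NT * (ηH * F) ^ FL
    hB = begin
      (ηH * F) ^ (P * Z) * suc ηH ^ NT
        ≡⟨ cong (λ t → (ηH * F) ^ (P * t) * suc ηH ^ NT) length-homs ⟨
      (ηH * F) ^ (P * length homs) * suc ηH ^ NT
        ≡⟨ ∏∏-expand homs bs (ηH * F) (suc ηH) (λ f u → loose i f u u) ⟨
      ∏ homs (λ f → ∏ bs (λ u → ηH * F * suc ηH ^ loose i f u u))
        ≤⟨ ∏-mono-All (All.map (λ {f} hom → ∏-mono bs (ω-lower i f hom ηF≥1)) (All.all-filter Hom? configs)) ⟩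
      ∏ homs (λ f → ∏ bs (λ u → ω i u f * (ηH ^ loose i f u u * (ηH * F) ^ flagged i f u u)))
        ≡⟨ trans (∏∏-* homs bs (λ f u → ω i u f) _) (cong (W *_) (trans (∏∏-* homs bs _ _)
             (cong₂ _*_ (∏∏-^ homs bs ηH (λ f u → loose i f u u)) (∏∏-^ homs bs (ηH * F) (λ f u → flagged i f u u))))) ⟩
      W * (ηH ^ NT * (ηH * F) ^ FL)
        ≡⟨ *-assoc W (ηH ^ NT) _ ⟨
      W * ηH ^ NT * (ηH * F) ^ FL ∎
      where
      ηF≥1 : 1 ≤ ηH * F
      ηF≥1 = *-mono-≤ η≥1 (*-mono-≤ (*-mono-≤ (>-nonZero⁻¹ q) (>-nonZero⁻¹ q)) (s≤s z≤n))

  total : (Fin d → Config → Site → Site → ℕ) → Site → ℕ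
  total A o = ∑ (allFin d) (λ i → ∑ configs (λ f → 𝟙 (Hom? f) * ∑ sites (λ s → 𝟙 (Low? i s) * A i f o s)))

  total-loose-vs-flagged : ∀ o J → 1 ≤ ηH → ηH * F ≤ 2 ^ J →
    suc g * total loose o ≤ ηH * (d * (N * Z)) + J * (suc g * ηH) * total flagged o
  total-loose-vs-flagged o J η≥1 F≤ = begin
    suc g * total loose o
      ≡⟨ ∑-*ˡ (allFin d) (suc g) _ ⟨
    ∑ (allFin d) (λ i → suc g * ∑ configs (λ f → 𝟙 (Hom? f) * ∑ sites (λ s → 𝟙 (Low? i s) * loose i f o s)))
      ≤⟨ ∑-mono (allFin d) each ⟩
    ∑ (allFin d) (λ i → ηH * (N * Z) + J * (suc g * ηH) * ∑ configs (λ f → 𝟙 (Hom? f) * ∑ sites (λ s → 𝟙 (Low? i s) * flagged i f o s)))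
      ≡⟨ trans (∑-+ (allFin d) _ _) (cong₂ _+_ (trans (∑-const (allFin d) _) (trans (cong (_* (ηH * (N * Z))) (length-allFin d)) (r d ηH (N * Z)))) (∑-*ˡ (allFin d) (J * (suc g * ηH)) (λ i → ∑ configs (λ f → 𝟙 (Hom? f) * ∑ sites (λ s → 𝟙 (Low? i s) * flagged i f o s))))) ⟩
    ηH * (d * (N * Z)) + J * (suc g * ηH) * total flagged o ∎
    where
    open ≤-Reasoning
    r : ∀ a b c → a * (b * c) ≡ b * (a * c)
    r = solve-∀
    each : ∀ i → _ ≤ _
    each i = subst₂ (λ x y → suc g * x ≤ ηH * (N * Z) + J * (suc g * ηH) * y)
      (diagonal (loose i) (loose-invariant i) o (λ s → 𝟙 (Low? i s)))
      (diagonal (flagged i) (flagged-invariant i) o (λ s → 𝟙 (Low? i s)))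
      (loose-vs-flagged i J η≥1 F≤)

-- Patterns that force pairs not to be tight

module Patterns (H : Graph) (k : ℕ) (ev-m : ev (suc k) ≡ true) (d : ℕ) .{{q≢0 : NonZero (Graph.n H)}} where

  open Invariance H k ev-m d public

  encode : Vec (Fin m) d → Site
  encode v = point (lookup v)

  coord-encode : ∀ (v : Vec (Fin m) d) j → coord (encode v) j ≡ lookup v j
  coord-encode v j = coord-point (lookup v) j

  ∑-encode : ∀ (Φ : Site → ℕ) → ∑ (vecs d m) (λ v → Φ (encode v)) ≡ ∑ sites Φ
  ∑-encode = ∑-bijection {xs = vecs d m} {ys = sites} (unique-vecs d m) (Unique.allFin⁺ N) ∈-vecs ∈-allFin
    encode (λ x → tabulate (coord x))
    (λ v → trans (tabulate-cong (coord-encode v)) (tabulate∘lookup v))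
    (λ x → site-ext (λ j → trans (coord-encode (tabulate (coord x)) j) (lookup∘tabulate (coord x) j)))

  tops : List (Fin d) → List (Fin d × Fin m)
  tops = map (_, top)

  lookup-tops-keep : ∀ js (s : Vec (Fin m) d) j → lookup s j ≡ top → lookup (sets (tops js) s) j ≡ top
  lookup-tops-keep []        s j eq = eq
  lookup-tops-keep (j′ ∷ js) s j eq = lookup-tops-keep js (s [ j′ ]≔ top) j lemma
    where
    lemma : lookup (s [ j′ ]≔ top) j ≡ top
    lemma with j ≟ j′
    ... | yes refl = lookup∘update j s top
    ... | no  ne   = trans (lookup∘update′ ne s top) eq

  lookup-tops : ∀ js (s : Vec (Fin m) d) {j} → j ∈ js → lookup (sets (tops js) s) j ≡ top
  lookup-tops (j′ ∷ js) s (here refl) = lookup-tops-keep js (s [ j′ ]≔ top) j′ (lookup∘update j′ s top)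
  lookup-tops (j′ ∷ js) s (there i)   = lookup-tops js (s [ j′ ]≔ top) i

  -- A pattern s whose coordinate j is top has both neighbours in direction j in its past.
  prescribe : ∀ (js : List (Fin d)) i b (Φ : Site → ℕ) →
    (∀ s → coord s i ≡ b → (∀ {j} → j ∈ js → j ≢ i → coord s j ≡ top) → 1 ≤ Φ s) →
    N ≤ m ^ suc (length js) * ∑ sites Φ
  prescribe js i b Φ h = begin
    N                                          ≡⟨ length-vecs d m ⟨
    ∑ (vecs d m) (λ _ → 1)                     ≤⟨ ∑-mono (vecs d m) pointwise ⟩
    ∑ (vecs d m) (λ v → Ψ (sets (tops js) v))  ≤⟨ ∑-sets (tops js) Ψ ⟩
    m ^ length (tops js) * ∑ (vecs d m) Ψ      ≤⟨ *-mono-≤ (≤-reflexive (cong (m ^_) (length-map _ js))) (∑-sets ((i , b) ∷ []) (Φ ∘ encode)) ⟩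
    m ^ length js * (m * 1 * ∑ (vecs d m) (Φ ∘ encode))
      ≡⟨ cong (λ t → m ^ length js * (m * 1 * t)) (∑-encode Φ) ⟩
    m ^ length js * (m * 1 * ∑ sites Φ)        ≡⟨ r (m ^ length js) m (∑ sites Φ) ⟩
    m ^ suc (length js) * ∑ sites Φ ∎
    where
    open ≤-Reasoning
    r : ∀ a b c → a * (b * 1 * c) ≡ b * a * c
    r = solve-∀
    Ψ : Vec (Fin m) d → ℕ
    Ψ v = Φ (encode (v [ i ]≔ b))
    pointwise : ∀ v → 1 ≤ Ψ (sets (tops js) v)
    pointwise v = h (encode (w [ i ]≔ b))
      (trans (coord-encode (w [ i ]≔ b) i) (lookup∘update i w b))
      (λ {j} j∈ j≢i → trans (coord-encode (w [ i ]≔ b) j) (trans (lookup∘update′ j≢i w b) (lookup-tops js v j∈)))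
      where
      w : Vec (Fin m) d
      w = sets (tops js) v

  -- The last even residue: it makes `s` low, while `e i s` has coordinate `top` in direction `i`.
  pen : Fin m
  pen = σ⁻ top

  toℕ-pen : suc (toℕ pen) ≡ k
  toℕ-pen with toℕ-cases pen
  ... | inj₁ lt = trans (sym (toℕ-σ-< lt)) (trans (cong toℕ (σσ⁻ top)) toℕ-top)
  ... | inj₂ eq = ⊥-elim (<⇒≢ k≥1 (trans (sym (toℕ-σ-top eq)) (trans (cong toℕ (σσ⁻ top)) toℕ-top)))

  ev-pen : ev (toℕ pen) ≡ true
  ev-pen = trans (ev-shift false top) (cong not (trans (cong ev toℕ-top) ev-k))

  toℕ-coord-top : ∀ {s j} → coord s j ≡ top → toℕ (coord s j) ≡ k
  toℕ-coord-top eq = trans (cong toℕ eq) toℕ-top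

  -- In direction `i` the backward step from `e i o` is `o`. The forward step from `e i s` wraps to
  -- coordinate 0 and falls into the past, except for `m = 2`, where the forward step from `e i o`
  -- is `o` too.
  past-or-return : ∀ i j t s o → coord s i ≡ pen → (j ≢ i → coord s j ≡ top) →
    rank i (mv (j , t) (e i s)) < rank i s ⊎ mv (j , t) (e i o) ≡ o
  past-or-return i j t s o si sj with j ≟ i
  past-or-return i j t s o si sj | no j≢i = inj₁ (top-past-e i j t s (j≢i ∘ sym) (toℕ-coord-top {s} {j} (sj j≢i)))
  past-or-return i j false s o si sj | yes refl = inj₂ (mv-inverse (i , true) o)
  past-or-return i j true  s o si sj | yes refl with m≤n⇒m<n∨m≡n k≥1
  ... | inj₁ k≥2 = inj₁ (pen-past i s (trans (cong (suc ∘ toℕ) si) toℕ-pen) k≥2)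
  ... | inj₂ k≡1 = inj₂ (ee-two (sym k≡1) i o)

  strain : Fin d → Config → Site → Site → ℕ
  strain i f o s = 𝟙 (Low? i s) * loose i f o s + 𝟙 (Low? i s) * flagged i f o s

  -- Looseness includes a correct prediction, so a pair that is not tight is either loose or
  -- flagged. The coding bound controls the first through the second.
  strained : ∀ i f o s → Low i s → ¬ Tight i f o s → 1 ≤ strain i f o s
  strained i f o s low ¬t rewrite 𝟙-yes (Low? i s) low with X? i f o s (lookup f (e i o))
  ... | yes x = ≤-trans (≤-reflexive (sym (trans (*-identityˡ _) (𝟙-yes (¬? (Tight? i f o s) ×-dec yes x) (¬t , x))))) (m≤m+n _ _)
  ... | no ¬x = ≤-trans (s≤s z≤n) (m≤n+m 1 _)

  -- `c` lies in `X` but is excluded from the prediction by `c′`, so the predicted set is a proper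
  -- part of `X`. Already `Co X` and `X` have product at most `η`, and `Co X` contains the colour of
  -- `o`.
  conflict⇒¬Tight : ∀ i f o s {c c′} → Hom f → X i f o s c → Y i f o s c′ → ¬ Adj c c′ → ¬ Tight i f o s
  conflict⇒¬Tight i f o s {c} {c′} hom xc yc′ ¬adj t = <⇒≢ small t
    where
    open ≤-Reasoning
    a = # (Co? (X? i f o s))
    a≥1 : 1 ≤ a
    a≥1 = #≥1 (Co? (X? i f o s)) {lookup f o} (λ { _ (δ , _ , refl) → hom o δ })
    small : size (X? i f o s) (Y? i f o s) < ηH
    small = begin-strict
      a * # (Pred? (X? i f o s) (Y? i f o s))
        <⟨ *-monoʳ-< a {{>-nonZero a≥1}} (#-strict (Pred? (X? i f o s) (Y? i f o s)) (X? i f o s) (λ _ → proj₂) xc (λ p → ¬adj (proj₁ p c′ yc′))) ⟩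
      a * # (X? i f o s)
        ≤⟨ η-bound (Co? (X? i f o s)) (X? i f o s) (λ co x → co _ x) ⟩
      ηH ∎

  NonOptimal : Config → Site → Set
  NonOptimal f o = # (K? f o) * # (Q? f o) < ηH

  NonOptimal? : ∀ f o → Dec (NonOptimal f o)
  NonOptimal? f o = # (K? f o) * # (Q? f o) ℕ.<? ηH

  -- Once all of `Q` is revealed, `Co X` lies in `K`, and predictions lie in `Q` anyway.
  nonOptimal⇒¬Tight : ∀ i f o s → NonOptimal f o → (∀ c → Q f o c → X i f o s c) → ¬ Tight i f o s
  nonOptimal⇒¬Tight i f o s nonopt q⊆x t = <⇒≢ (≤-<-trans (*-mono-≤
    (#-mono (Co? (X? i f o s)) (K? f o) (Co-anti q⊆x))
    (#-mono (Pred? (X? i f o s) (Y? i f o s)) (Q? f o) (λ { c (co , δ , _ , eq) → δ , eq }))) nonopt) t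

  avoiding : ∀ {p} (J : Fin p → Fin d) → p < d → ∃ λ i → ∀ c → J c ≢ i
  avoiding {p} J p<d with any? (λ i → all? (λ c → ¬? (J c ≟ i)))
  ... | yes r = r
  ... | no ¬r = ⊥-elim (<⇒≱ p<d (injective⇒≤ {f = pre} (λ {i} {j} eq → trans (sym (J-pre i)) (trans (cong J eq) (J-pre j)))))
    where
    find : ∀ i → ∃ λ c → J c ≡ i
    find i with any? (λ c → J c ≟ i)
    ... | yes r = r
    ... | no ¬∃ = ⊥-elim (¬r (i , λ c eq → ¬∃ (c , eq)))
    pre : Fin d → Fin p
    pre i = proj₁ (find i)
    J-pre : ∀ i → J (pre i) ≡ i
    J-pre i = proj₂ (find i)

  -- One direction displaying each colour is set to `top`. As `q < d`, a direction `i` remains for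
  -- the pair, with coordinate 0 to make `s` low; this pins `suc q` coordinates.
  nonOptimal-strain : ∀ f o → Hom f → q < d → NonOptimal f o →
    N ≤ m ^ suc q * ∑ (allFin d) (λ i → ∑ sites (strain i f o))
  nonOptimal-strain f o hom q<d nonopt = begin
    N ≤⟨ prescribe (map direction (allFin q)) i zero (strain i f o) pointwise ⟩
    m ^ suc (length (map direction (allFin q))) * ∑ sites (strain i f o)
      ≡⟨ cong (λ t → m ^ suc t * ∑ sites (strain i f o)) (trans (length-map direction (allFin q)) (length-allFin q)) ⟩
    m ^ suc q * ∑ sites (strain i f o)
      ≤⟨ *-monoʳ-≤ (m ^ suc q) (∑-∈ (λ i → ∑ sites (strain i f o)) (∈-allFin i)) ⟩
    m ^ suc q * ∑ (allFin d) (λ i → ∑ sites (strain i f o)) ∎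
    where
    open ≤-Reasoning
    -- A default for the colours that do not occur next to `o`.
    any-direction : Fin d
    any-direction = fromℕ< {0} (≤-<-trans z≤n q<d)
    direction : Colour → Fin d
    direction c with Q? f o c
    ... | yes ((j , _) , _) = j
    ... | no _              = any-direction
    i : Fin d
    i = proj₁ (avoiding direction q<d)
    fresh : ∀ c → direction c ≢ i
    fresh = proj₂ (avoiding direction q<d)
    direction-sees : ∀ c → Q f o c → ∃ λ s → lookup f (mv (direction c , s) o) ≡ c
    direction-sees c qc with Q? f o c
    ... | yes ((_ , s) , eq) = s , eq
    ... | no ¬qc             = ⊥-elim (¬qc qc)
    pointwise : ∀ s → coord s i ≡ zero → (∀ {j} → j ∈ map direction (allFin q) → j ≢ i → coord s j ≡ top) → 1 ≤ strain i f o s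
    pointwise s si sj = strained i f o s (cong (ev ∘ toℕ) si) (nonOptimal⇒¬Tight i f o s nonopt (λ c qc →
      (direction c , proj₁ (direction-sees c qc)) ,
      top-past i (direction c) (proj₁ (direction-sees c qc)) s (toℕ-coord-top {s} {direction c} (sj (∈-map⁺ direction (∈-allFin c)) (fresh c))) ,
      proj₂ (direction-sees c qc)))

  module Threshold (ℓ : ℕ) where

    -- Counts run over forward neighbours: these are `d` distinct sites even for `m = 2`, where
    -- forward and backward steps coincide.
    κ : Config → Site → Colour → ℕ
    κ f o c = ∑ (allFin d) (λ j → 𝟙 (K? f (e j o) c))

    μ : Config → Site → Colour → ℕ
    μ f o c = ∑ (allFin d) (λ j → 𝟙 (lookup f (e j o) ≟ c))

    -- U: c occurs next to o although many neighbours of o cannot take it.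
    -- V: most neighbours of o can take c, but few do.
    U V : Config → Site → Colour → Set
    U f o c = Q f o c × κ f o c + ℓ ≤ d
    V f o c = d < κ f o c + ℓ × μ f o c < ℓ

    abstract
      U? : ∀ f o c → Dec (U f o c)
      U? f o c = Q? f o c ×-dec κ f o c + ℓ ℕ.≤? d

      V? : ∀ f o c → Dec (V f o c)
      V? f o c = d ℕ.<? κ f o c + ℓ ×-dec μ f o c ℕ.<? ℓ

    complement-count : ∀ {P : Fin d → Set} (P? : ∀ j → Dec (P j)) →
      ∑ (allFin d) (λ j → 𝟙 (¬? (P? j))) + ∑ (allFin d) (λ j → 𝟙 (P? j)) ≡ d
    complement-count P? = trans (sym (∑-+ (allFin d) (λ j → 𝟙 (¬? (P? j))) (λ j → 𝟙 (P? j))))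
      (trans (∑-cong (allFin d) (λ j → 𝟙-¬+𝟙 (P? j))) (∑-ones d))

    -- If c is seen at o but is not allowed at e i o, some neighbour of e i o carries a colour not adjacent to c;
    -- the edge {o, e i o} is not tight for the patterns that put both witnesses into the past.
    U-strain : ∀ f o {c} → Hom f → U f o c →
      (ℓ ∸ 1) * N ≤ m ^ 3 * ∑ (allFin d) (λ i → ∑ sites (strain i f o))
    U-strain f o {c} hom (((j₀ , s₀) , seen) , few) = begin
      (ℓ ∸ 1) * N
        ≤⟨ *-monoˡ-≤ N (∸-monoˡ-≤ 1 many) ⟩
      (1 + ∑ (allFin d) (λ i → 𝟙 (good? i)) ∸ 1) * N
        ≡⟨ *-comm _ N ⟩
      N * ∑ (allFin d) (λ i → 𝟙 (good? i))
        ≡⟨ ∑-*ˡ (allFin d) N _ ⟨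
      ∑ (allFin d) (λ i → N * 𝟙 (good? i))
        ≤⟨ ∑-mono (allFin d) each ⟩
      ∑ (allFin d) (λ i → m ^ 3 * ∑ sites (strain i f o))
        ≡⟨ ∑-*ˡ (allFin d) (m ^ 3) _ ⟩
      m ^ 3 * ∑ (allFin d) (λ i → ∑ sites (strain i f o)) ∎
      where
      open ≤-Reasoning
      -- The coordinate in direction `j₀` must be `top` to reveal `c`, so this direction cannot
      -- carry the pair; hence `ℓ ∸ 1`.
      good? : ∀ i → Dec (¬ K f (e i o) c × j₀ ≢ i)
      good? i = ¬? (K? f (e i o) c) ×-dec ¬? (j₀ ≟ i)
      many : ℓ ≤ 1 + ∑ (allFin d) (λ i → 𝟙 (good? i))
      many = +-cancelʳ-≤ (κ f o c) _ _ (begin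
        ℓ + κ f o c ≡⟨ +-comm ℓ _ ⟩
        κ f o c + ℓ ≤⟨ few ⟩
        d           ≡⟨ complement-count (λ j → K? f (e j o) c) ⟨
        ∑ (allFin d) (λ i → 𝟙 (¬? (K? f (e i o) c))) + κ f o c
          ≤⟨ +-monoˡ-≤ (κ f o c) (∑-mono (allFin d) split) ⟩
        ∑ (allFin d) (λ i → 𝟙 (i ≟ j₀) + 𝟙 (good? i)) + κ f o c
          ≡⟨ cong (_+ κ f o c) (trans (∑-+ (allFin d) _ _) (cong (_+ ∑ (allFin d) (λ i → 𝟙 (good? i))) (#-single j₀))) ⟩
        1 + ∑ (allFin d) (λ i → 𝟙 (good? i)) + κ f o c ∎)
        where
        split : ∀ i → 𝟙 (¬? (K? f (e i o) c)) ≤ 𝟙 (i ≟ j₀) + 𝟙 (good? i)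
        split i with i ≟ j₀
        ... | yes _  = ≤-trans (𝟙≤1 (¬? (K? f (e i o) c))) (m≤m+n 1 _)
        ... | no i≢j = 𝟙-mono (¬? (K? f (e i o) c)) (good? i) (λ ¬k → ¬k , i≢j ∘ sym)
      each : ∀ i → N * 𝟙 (good? i) ≤ m ^ 3 * ∑ sites (strain i f o)
      each i with good? i
      ... | no _ = ≤-trans (≤-reflexive (*-zeroʳ N)) z≤n
      ... | yes (¬k , j₀≢i) with any? (λ c′ → Q? f (e i o) c′ ×-dec ¬? (Adj? c c′))
      ...   | no ¬∃ = ⊥-elim (¬k (λ c′ qc′ → decidable-stable (Adj? c c′) (λ ¬adj → ¬∃ (c′ , qc′ , ¬adj))))
      ...   | yes (c′ , ((j₁ , s₁) , seen′) , ¬adj) =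
              ≤-trans (≤-reflexive (*-identityʳ N)) (prescribe (j₀ ∷ j₁ ∷ []) i pen (strain i f o) pointwise)
        where
        pointwise : ∀ s → coord s i ≡ pen → (∀ {j} → j ∈ j₀ ∷ j₁ ∷ [] → j ≢ i → coord s j ≡ top) → 1 ≤ strain i f o s
        pointwise s si sj = strained i f o s (trans (cong (ev ∘ toℕ) si) ev-pen)
          (conflict⇒¬Tight i f o s hom xc yc′ ¬adj)
          where
          xc : X i f o s c
          xc = (j₀ , s₀) , top-past i j₀ s₀ s (toℕ-coord-top {s} {j₀} (sj (here refl) j₀≢i)) , seen
          c~o : Adj (lookup f o) c
          c~o = subst (Adj (lookup f o)) seen (hom o (j₀ , s₀))
          -- The colour of `o` is adjacent to `c`, that of the witness is not.
          not-o : mv (j₁ , s₁) (e i o) ≢ o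
          not-o eq = ¬adj (Adj-sym (subst (λ a → Adj a c) (trans (cong (lookup f) (sym eq)) seen′) c~o))
          past : rank i (mv (j₁ , s₁) (e i s)) < rank i s
          past with past-or-return i j₁ s₁ s o si (sj (there (here refl)))
          ... | inj₁ lt = lt
          ... | inj₂ eq = ⊥-elim (not-o eq)
          yc′ : Y i f o s c′
          yc′ = (j₁ , s₁) , past , seen′

-- The boundedness of `n (k/(k + 1)) ^ n`, which keeps the expected number of failed predictions
-- over all `d` directions bounded.
exponent*power : ∀ k n → n * k ^ n ≤ suc k * suc k ^ n
exponent*power k zero    = z≤n
exponent*power k (suc n) = begin
  suc n * (k * k ^ n)                         ≡⟨ r n k (k ^ n) ⟩
  k * (n * k ^ n) + k * k ^ n                 ≤⟨ +-mono-≤ (*-monoʳ-≤ k (exponent*power k n)) (*-mono-≤ (n≤1+n k) (^-monoˡ-≤ n (n≤1+n k))) ⟩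
  k * (suc k * suc k ^ n) + suc k * suc k ^ n ≡⟨ r′ k (suc k ^ n) ⟩
  suc k * (suc k * suc k ^ n) ∎
  where
  open ≤-Reasoning
  r : ∀ n k p → suc n * (k * p) ≡ k * (n * p) + k * p
  r = solve-∀
  r′ : ∀ k p → k * (suc k * p) + suc k * p ≡ suc k * (suc k * p)
  r′ = solve-∀

-- The exponent contains `g` groups of `k` factors, each gaining 2 by `double-pow`; the remaining
-- `r` factors lose nothing.
power-gap : ∀ k g n → 1 ≤ k → k * g ≤ n → 2 ^ g * k ^ n ≤ suc k ^ n
power-gap (suc k) g n _ le with r , refl ← m≤n⇒∃[o]m+o≡n le = begin
  2 ^ g * suc k ^ (suc k * g + r)              ≡⟨ cong (2 ^ g *_) (^-distribˡ-+-* (suc k) (suc k * g) r) ⟩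
  2 ^ g * (suc k ^ (suc k * g) * suc k ^ r)    ≡⟨ *-assoc (2 ^ g) _ _ ⟨
  2 ^ g * suc k ^ (suc k * g) * suc k ^ r      ≡⟨ cong (λ t → 2 ^ g * t * suc k ^ r) (^-*-assoc (suc k) (suc k) g) ⟨
  2 ^ g * (suc k ^ suc k) ^ g * suc k ^ r      ≡⟨ cong (_* suc k ^ r) (^-distribʳ-* g 2 (suc k ^ suc k)) ⟨
  (2 * suc k ^ suc k) ^ g * suc k ^ r          ≤⟨ *-mono-≤ (^-monoˡ-≤ g (double-pow k)) (^-monoˡ-≤ r (n≤1+n (suc k))) ⟩
  (suc (suc k) ^ suc k) ^ g * suc (suc k) ^ r  ≡⟨ cong (_* suc (suc k) ^ r) (^-*-assoc (suc (suc k)) (suc k) g) ⟩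
  suc (suc k) ^ (suc k * g) * suc (suc k) ^ r  ≡⟨ ^-distribˡ-+-* (suc (suc k)) (suc k * g) r ⟨
  suc (suc k) ^ (suc k * g + r) ∎
  where open ≤-Reasoning

-- Bad sites: failed predictions, resampling and ideal edges

module Rarity (H : Graph) (k : ℕ) (ev-m : ev (suc k) ≡ true) (d : ℕ) .{{q≢0 : NonZero (Graph.n H)}} (ℓ : ℕ) where

  open Patterns H k ev-m d public
  open Threshold ℓ public

  Bad : Config → Site → Set
  Bad f o = (∃ λ c → U f o c) ⊎ (∃ λ c → V f o c)

  abstract
    Bad? : ∀ f o → Dec (Bad f o)
    Bad? f o = any? (U? f o) ⊎-dec any? (V? f o)

  -- A seen colour on fewer than `ℓ` forward neighbours makes `o` bad either way: through `V` if `κ`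
  -- is large, through `U` otherwise.
  frequent : ∀ f o → ¬ Bad f o → ∀ {c} → Q f o c → ℓ ≤ μ f o c
  frequent f o ¬bad {c} qc with ℓ ℕ.≤? μ f o c | d ℕ.<? κ f o c + ℓ
  ... | yes le | _     = le
  ... | no ≰   | yes < = ⊥-elim (¬bad (inj₂ (c , < , ≰⇒> ≰)))
  ... | no ≰   | no ≮  = ⊥-elim (¬bad (inj₁ (c , qc , ≮⇒≥ ≮)))

  abundant : ∀ f o → ¬ Bad f o → ∀ {c} → Q f o c → d < κ f o c + ℓ
  abundant f o ¬bad {c} qc = ≰⇒> (λ le → ¬bad (inj₁ (c , qc , le)))

  -- Failed predictions

  -- The condition that coordinate `j` does not reveal a neighbour coloured `c`. Being
  -- coordinatewise, it lets the patterns missing `c` be counted by a product.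
  miss : Config → Site → Colour → Fin d → Fin m → ℕ
  miss f o c j a = 𝟙 (lookup f (e j o) ≟ c →-dec ¬? (a ≟ top))

  missing : Config → Site → Colour → ℕ
  missing f o c = ∑ sites (λ s → ∏ (allFin d) (λ j → miss f o c j (coord s j)))

  ∏-ones : ∀ {A : Set} (xs : List A) (φ : A → ℕ) → (∀ x → φ x ≡ 1) → ∏ xs φ ≡ 1
  ∏-ones xs φ h = trans (∏-cong xs h) (trans (∏-const xs 1) (^-zeroˡ (length xs)))

  flagged≤miss : ∀ i f o s → flagged i f o s ≤ ∏ (allFin d) (λ j → miss f o (lookup f (e i o)) j (coord s j))
  flagged≤miss i f o s = 𝟙-≤ (Flag? i f o s) (λ ¬x → ≤-reflexive (sym (∏-ones (allFin d) _ (λ j →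
    𝟙-yes (lookup f (e j o) ≟ lookup f (e i o) →-dec ¬? (coord s j ≟ top))
      (λ eq is-top → ¬x ((j , true) , top-past i j true s (toℕ-coord-top {s} {j} is-top) , eq))))))

  count-non-top : ∑ (allFin m) (λ a → 𝟙 (¬? (a ≟ top))) ≡ k
  count-non-top = +-cancelʳ-≡ 1 _ k (trans (cong (∑ (allFin m) (λ a → 𝟙 (¬? (a ≟ top))) +_) (sym (#-single top)))
    (trans (sym (∑-+ (allFin m) (λ a → 𝟙 (¬? (a ≟ top))) (λ a → 𝟙 (a ≟ top)))) (trans (∑-cong (allFin m) (λ a → 𝟙-¬+𝟙 (a ≟ top)))
      (trans (trans (∑-const (allFin m) 1) (*-identityʳ _)) (trans (length-allFin m) (+-comm 1 k))))))

  -- Each of the `μ` directions coloured `c` excludes the value `top` and leaves `k` of `m` values;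
  -- the other coordinates are free.
  missing-size : ∀ f o c → missing f o c * m ^ μ f o c ≡ k ^ μ f o c * N
  missing-size f o c = begin
    missing f o c * m ^ μ f o c
      ≡⟨ cong (_* m ^ μ f o c) (∑-encode _) ⟨
    ∑ (vecs d m) (λ v → ∏ (allFin d) (λ j → miss f o c j (coord (encode v) j))) * m ^ μ f o c
      ≡⟨ cong (_* m ^ μ f o c) (∑-cong (vecs d m) (λ v → ∏-cong (allFin d) (λ j → cong (miss f o c j) (coord-encode v j)))) ⟩
    ∑ (vecs d m) (λ v → ∏ (allFin d) (λ j → miss f o c j (lookup v j))) * m ^ μ f o c
      ≡⟨ cong₂ _*_ (∑-vecs-∏ d (miss f o c)) (sym (∏-^ (allFin d) m _)) ⟩
    ∏ (allFin d) (λ j → ∑ (allFin m) (miss f o c j)) * ∏ (allFin d) (λ j → m ^ 𝟙 (lookup f (e j o) ≟ c))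
      ≡⟨ ∏-* (allFin d) _ _ ⟨
    ∏ (allFin d) (λ j → ∑ (allFin m) (miss f o c j) * m ^ 𝟙 (lookup f (e j o) ≟ c))
      ≡⟨ ∏-cong (allFin d) each ⟩
    ∏ (allFin d) (λ j → k ^ 𝟙 (lookup f (e j o) ≟ c) * m)
      ≡⟨ ∏-* (allFin d) _ _ ⟩
    ∏ (allFin d) (λ j → k ^ 𝟙 (lookup f (e j o) ≟ c)) * ∏ (allFin d) (λ _ → m)
      ≡⟨ cong₂ _*_ (∏-^ (allFin d) k _) (trans (∏-const (allFin d) m) (cong (m ^_) (length-allFin d))) ⟩
    k ^ μ f o c * N ∎
    where
    open ≡-Reasoning
    each : ∀ j → ∑ (allFin m) (miss f o c j) * m ^ 𝟙 (lookup f (e j o) ≟ c) ≡ k ^ 𝟙 (lookup f (e j o) ≟ c) * m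
    each j with lookup f (e j o) ≟ c
    ... | yes p = cong₂ _*_
          (trans (∑-cong (allFin m) (λ a → 𝟙-cong (yes p →-dec ¬? (a ≟ top)) (¬? (a ≟ top)) (λ h → h p) (λ h _ → h)))
            (trans count-non-top (sym (*-identityʳ k))))
          (*-identityʳ m)
    ... | no ¬p = trans (*-identityʳ _) (trans
          (trans (∑-cong (allFin m) (λ a → 𝟙-yes (no ¬p →-dec ¬? (a ≟ top)) (λ p → ⊥-elim (¬p p))))
            (∑-ones m))
          (sym (*-identityˡ m)))

  missing-weighted : ∀ f o c → μ f o c * missing f o c ≤ m * N
  missing-weighted f o c = *-cancelʳ-≤ _ _ (m ^ μ f o c) {{m^n≢0 m (μ f o c)}} (begin
    μ f o c * missing f o c * m ^ μ f o c   ≡⟨ *-assoc (μ f o c) _ _ ⟩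
    μ f o c * (missing f o c * m ^ μ f o c) ≡⟨ cong (μ f o c *_) (missing-size f o c) ⟩
    μ f o c * (k ^ μ f o c * N)             ≡⟨ *-assoc (μ f o c) _ N ⟨
    μ f o c * k ^ μ f o c * N               ≤⟨ *-monoˡ-≤ N (exponent*power k (μ f o c)) ⟩
    m * m ^ μ f o c * N                     ≡⟨ r m (m ^ μ f o c) N ⟩
    m * N * m ^ μ f o c ∎)
    where
    open ≤-Reasoning
    r : ∀ a b c → a * b * c ≡ a * c * b
    r = solve-∀

  missing-rare : ∀ f o c g → k * g ≤ μ f o c → 2 ^ g * missing f o c ≤ N
  missing-rare f o c g le = *-cancelʳ-≤ _ _ (m ^ μ f o c) {{m^n≢0 m (μ f o c)}} (begin
    2 ^ g * missing f o c * m ^ μ f o c   ≡⟨ *-assoc (2 ^ g) _ _ ⟩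
    2 ^ g * (missing f o c * m ^ μ f o c) ≡⟨ cong (2 ^ g *_) (missing-size f o c) ⟩
    2 ^ g * (k ^ μ f o c * N)             ≡⟨ *-assoc (2 ^ g) _ N ⟨
    2 ^ g * k ^ μ f o c * N               ≤⟨ *-monoˡ-≤ N (power-gap k g (μ f o c) k≥1 le) ⟩
    m ^ μ f o c * N                       ≡⟨ *-comm _ N ⟩
    N * m ^ μ f o c ∎)
    where open ≤-Reasoning

  flags : Config → Site → ℕ
  flags f o = ∑ (allFin d) (λ i → ∑ sites (λ s → 𝟙 (Low? i s) * flagged i f o s))

  flags≤missing : ∀ f o → flags f o ≤ ∑ (allFin d) (λ i → missing f o (lookup f (e i o)))
  flags≤missing f o = ∑-mono (allFin d) (λ i → ∑-mono sites (λ s → ≤-trans (𝟙*-≤ (Low? i s) _) (flagged≤miss i f o s)))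

  -- Directions are grouped by the colour of `e i o`, and each colour contributes
  -- `μ * missing ≤ m * N`. The bound is free of `d`; this saving makes the estimate for bad sites
  -- contract.
  flags-crude : ∀ f o → flags f o ≤ q * (m * N)
  flags-crude f o = begin
    flags f o                                              ≤⟨ flags≤missing f o ⟩
    ∑ (allFin d) (λ i → missing f o (lookup f (e i o)))    ≤⟨ ∑-mono (allFin d) (λ i → pick (lookup f (e i o))) ⟩
    ∑ (allFin d) (λ i → ∑ (allFin q) (λ c → missing f o c * 𝟙 (lookup f (e i o) ≟ c)))
                                                           ≡⟨ ∑-swap (allFin d) (allFin q) _ ⟩
    ∑ (allFin q) (λ c → ∑ (allFin d) (λ i → missing f o c * 𝟙 (lookup f (e i o) ≟ c)))
                                                           ≤⟨ ∑-mono (allFin q) (λ c → ≤-trans (≤-reflexive (trans (∑-*ˡ (allFin d) (missing f o c) _) (*-comm (missing f o c) _))) (missing-weighted f o c)) ⟩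
    ∑ (allFin q) (λ c → m * N)                             ≡⟨ trans (∑-const (allFin q) (m * N)) (cong (_* (m * N)) (length-allFin q)) ⟩
    q * (m * N) ∎
    where
    open ≤-Reasoning
    pick : ∀ a → missing f o a ≤ ∑ (allFin q) (λ c → missing f o c * 𝟙 (a ≟ c))
    pick a = ≤-trans (≤-reflexive (sym (trans (cong (missing f o a *_) (𝟙-yes (a ≟ a) refl)) (*-identityʳ _))))
      (∑-∈ (λ c → missing f o c * 𝟙 (a ≟ c)) (∈-allFin a))

  flags-good : ∀ f o g → k * g ≤ ℓ → ¬ Bad f o → 2 ^ g * flags f o ≤ d * N
  flags-good f o g le ¬bad = begin
    2 ^ g * flags f o ≤⟨ *-monoʳ-≤ (2 ^ g) (flags≤missing f o) ⟩
    2 ^ g * ∑ (allFin d) (λ i → missing f o (lookup f (e i o))) ≡⟨ ∑-*ˡ (allFin d) (2 ^ g) _ ⟨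
    ∑ (allFin d) (λ i → 2 ^ g * missing f o (lookup f (e i o)))
      ≤⟨ ∑-mono (allFin d) (λ i → missing-rare f o (lookup f (e i o)) g (≤-trans le (frequent f o ¬bad ((i , true) , refl)))) ⟩
    ∑ (allFin d) (λ _ → N) ≡⟨ trans (∑-const (allFin d) N) (cong (_* N) (length-allFin d)) ⟩
    d * N ∎
    where open ≤-Reasoning

  flags-bound : ∀ f o g → k * g ≤ ℓ → 2 ^ g * flags f o ≤ 𝟙 (Bad? f o) * (2 ^ g * (q * (m * N))) + d * N
  flags-bound f o g le with Bad? f o
  ... | yes _   = ≤-trans (*-monoʳ-≤ (2 ^ g) (flags-crude f o)) (≤-trans (≤-reflexive (sym (*-identityˡ _))) (m≤m+n _ _))
  ... | no ¬bad = flags-good f o g le ¬bad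

  -- Resampling a single site

  recolour-other : ∀ (f : Config) {x y} c → y ≢ x → lookup (f [ x ]≔ c) y ≡ lookup f y
  recolour-other f c y≢x = lookup∘update′ y≢x f c

  K-recolour : ∀ (f : Config) x y c → (∀ δ → mv δ y ≢ x) → ∀ b → K (f [ x ]≔ c) y b → K f y b
  K-recolour f x y c ne b kb a (δ , eq) = kb a (δ , trans (recolour-other f c (ne δ)) eq)

  K-recolour′ : ∀ (f : Config) x y c → (∀ δ → mv δ y ≢ x) → ∀ b → K f y b → K (f [ x ]≔ c) y b
  K-recolour′ f x y c ne b kb a (δ , eq) = kb a (δ , trans (sym (recolour-other f c (ne δ))) eq)

  Hom-recolour : ∀ f x c → Hom f → K f x c → Hom (f [ x ]≔ c)
  Hom-recolour f x c hom kc y δ with y ≟ x | mv δ y ≟ x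
  ... | yes refl | _ = subst₂ Adj (sym (lookup∘update y f c)) (sym (recolour-other f c (mv≢ δ y))) (kc _ (δ , refl))
  ... | no y≢x | yes refl = subst₂ Adj (sym (recolour-other f c y≢x)) (sym (lookup∘update (mv δ y) f c))
          (Adj-sym (kc _ (inverse δ , cong (lookup f) (mv-inverse δ y))))
  ... | no y≢x | no z≢x = subst₂ Adj (sym (recolour-other f c y≢x)) (sym (recolour-other f c z≢x)) (hom y δ)

  -- The colours allowed at `x` do not depend on the colour of `x`, so one admissible colour `a`
  -- suffices, even where `f` itself is no homomorphism.
  Hom-reset : ∀ f x a c → Hom (f [ x ]≔ a) → K f x c → Hom (f [ x ]≔ c)
  Hom-reset f x a c hom kc = subst Hom ([]≔-idempotent f x)
    (Hom-recolour (f [ x ]≔ a) x c hom (K-recolour′ f x x a (λ δ → mv≢ δ x) c kc))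

  module _ (o : Site) (c : Colour) where

    -- The mean of tilt over the colours allowed at e j o is at most 2q, but tilt exceeds 2q
    -- whenever c is allowed there and not taken.
    tilt : {A B : Set} → Dec A → Dec B → ℕ
    tilt (no _)  _       = 2 * q
    tilt (yes _) (yes _) = q
    tilt (yes _) (no _)  = suc (2 * q)

    tilt-cong : {A A′ B B′ : Set} (a : Dec A) (a′ : Dec A′) (b : Dec B) (b′ : Dec B′) →
      (A → A′) → (A′ → A) → (B → B′) → (B′ → B) → tilt a b ≡ tilt a′ b′
    tilt-cong (no _)  (no _)   _       _        f f′ g g′ = refl
    tilt-cong (no ¬a) (yes a)  _       _        f f′ g g′ = ⊥-elim (¬a (f′ a))
    tilt-cong (yes a) (no ¬a)  _       _        f f′ g g′ = ⊥-elim (¬a (f a))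
    tilt-cong (yes _) (yes _)  (yes _) (yes _)  f f′ g g′ = refl
    tilt-cong (yes _) (yes _)  (no _)  (no _)   f f′ g g′ = refl
    tilt-cong (yes _) (yes _)  (yes b) (no ¬b)  f f′ g g′ = ⊥-elim (¬b (g b))
    tilt-cong (yes _) (yes _)  (no ¬b) (yes b)  f f′ g g′ = ⊥-elim (¬b (g′ b))

    tilted : Fin d → Config → ℕ
    tilted j f = tilt (K? f (e j o) c) (lookup f (e j o) ≟ c)

    -- By parity no neighbour of `e j′ o` is again a neighbour of `o`, so recolouring `e j o`
    -- changes neither the colour of `e j′ o` nor what is allowed there.
    tilted-indep : ∀ {j j′} → j ≢ j′ → Indep (e j o) (tilted j′)
    tilted-indep {j} {j′} j≢j′ f a = tilt-cong (K? f′ (e j′ o) c) (K? f (e j′ o) c) (lookup f′ (e j′ o) ≟ c) (lookup f (e j′ o) ≟ c)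
      (K-recolour f (e j o) (e j′ o) a apart c) (K-recolour′ f (e j o) (e j′ o) a apart c)
      (trans (sym same)) (trans same)
      where
      f′ : Config
      f′ = f [ e j o ]≔ a
      apart : ∀ δ → mv δ (e j′ o) ≢ e j o
      apart δ = mv-mv≢mv δ (j′ , true) (j , true) o
      same : lookup f′ (e j′ o) ≡ lookup f (e j′ o)
      same = recolour-other f a (λ eq → j≢j′ (sym (e-distinct o eq)))

    -- If `c` is allowed and `r ≥ 1` colours give homomorphisms, then `c` is one of them, and the
    -- tilts add up to `(2q + 1) r - (q + 1) ≤ 2q r` because `r ≤ q`.
    tilted-mean : ∀ j f → 1 * ∑upd (e j o ∷ []) (λ f → tilted j f * 𝟙 (Hom? f)) f ≤ 2 * q * ∑upd (e j o ∷ []) (λ f → 𝟙 (Hom? f)) f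
    tilted-mean j f = ≤-trans (≤-reflexive (trans (*-identityˡ _) (∑-cong (allFin q) normal))) bound
      where
      open ≤-Reasoning
      x : Site
      x = e j o
      R? : ∀ a → Dec (Hom (f [ x ]≔ a))
      R? a = Hom? (f [ x ]≔ a)
      normal : ∀ a → tilted j (f [ x ]≔ a) * 𝟙 (R? a) ≡ tilt (K? f x c) (a ≟ c) * 𝟙 (R? a)
      normal a = cong (_* 𝟙 (R? a)) (tilt-cong (K? (f [ x ]≔ a) x c) (K? f x c) (lookup (f [ x ]≔ a) x ≟ c) (a ≟ c)
        (K-recolour f x x a (λ δ → mv≢ δ x) c) (K-recolour′ f x x a (λ δ → mv≢ δ x) c)
        (trans (sym (lookup∘update x f a))) (trans (lookup∘update x f a)))
      bound : ∑ (allFin q) (λ a → tilt (K? f x c) (a ≟ c) * 𝟙 (R? a)) ≤ 2 * q * ∑ (allFin q) (λ a → 𝟙 (R? a))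
      bound with K? f x c
      ... | no _   = ≤-reflexive (∑-*ˡ (allFin q) (2 * q) _)
      ... | yes kc with any? R?
      ...   | no ¬∃ = ≤-trans (≤-reflexive (trans (∑-cong (allFin q) (λ a → trans (cong (tilt (yes kc) (a ≟ c) *_) (𝟙-no (R? a) (λ r → ¬∃ (a , r)))) (*-zeroʳ (tilt (yes kc) (a ≟ c))))) (∑-zero (allFin q)))) z≤n
      ...   | yes (a₀ , r₀) = +-cancelʳ-≤ (suc q) _ _ (begin
                ∑ (allFin q) (λ a → tilt (yes kc) (a ≟ c) * 𝟙 (R? a)) + suc q
                  ≡⟨ cong (∑ (allFin q) (λ a → tilt (yes kc) (a ≟ c) * 𝟙 (R? a)) +_)
                       (trans (sym (*-identityʳ (suc q))) (trans (cong (suc q *_) (sym (#-single c))) (sym (∑-*ˡ (allFin q) (suc q) _)))) ⟩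
                ∑ (allFin q) (λ a → tilt (yes kc) (a ≟ c) * 𝟙 (R? a)) + ∑ (allFin q) (λ a → suc q * 𝟙 (a ≟ c))
                  ≡⟨ ∑-+ (allFin q) _ _ ⟨
                ∑ (allFin q) (λ a → tilt (yes kc) (a ≟ c) * 𝟙 (R? a) + suc q * 𝟙 (a ≟ c))
                  ≤⟨ ∑-mono (allFin q) each ⟩
                ∑ (allFin q) (λ a → suc (2 * q) * 𝟙 (R? a))
                  ≡⟨ ∑-*ˡ (allFin q) (suc (2 * q)) _ ⟩
                # R? + 2 * q * # R?
                  ≤⟨ +-monoˡ-≤ (2 * q * # R?) (≤-trans (#≤n R?) (n≤1+n q)) ⟩
                suc q + 2 * q * # R?
                  ≡⟨ +-comm (suc q) _ ⟩
                2 * q * # R? + suc q ∎)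
        where
        rc : Hom (f [ x ]≔ c)
        rc = Hom-reset f x a₀ c r₀ kc
        each : ∀ a → tilt (yes kc) (a ≟ c) * 𝟙 (R? a) + suc q * 𝟙 (a ≟ c) ≤ suc (2 * q) * 𝟙 (R? a)
        each a with a ≟ c
        ... | yes refl rewrite 𝟙-yes (R? a) rc = ≤-reflexive (r q)
          where
          r : ∀ q → q * 1 + suc q * 1 ≡ suc (2 * q) * 1
          r = solve-∀
        ... | no _ = ≤-reflexive (r q (𝟙 (R? a)))
          where
          r : ∀ q t → suc (2 * q) * t + suc q * 0 ≡ suc (2 * q) * t
          r = solve-∀

    tilted-total : ∑ configs (λ f → ∏ (allFin d) (λ j → tilted j f) * 𝟙 (Hom? f)) ≤ (2 * q) ^ d * Z
    tilted-total = begin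
      ∑ configs (λ f → ∏ (allFin d) (λ j → tilted j f) * 𝟙 (Hom? f))
        ≡⟨ trans (cong (_* ∑ configs (λ f → ∏ (allFin d) (λ j → tilted j f) * 𝟙 (Hom? f))) (^-zeroˡ (length (allFin d)))) (*-identityˡ _) ⟨
      1 ^ length (allFin d) * ∑ configs (λ f → ∏ (allFin d) (λ j → tilted j f) * 𝟙 (Hom? f))
        ≤⟨ eliminate (allFin d) (λ j → e j o ∷ []) (λ f → 𝟙 (Hom? f)) tilted 1 (2 * q)
             (AllPairs.map (λ ne → tilted-indep ne ∷ []) (Unique.allFin⁺ d)) (All.universal tilted-mean (allFin d)) ⟩
      (2 * q) ^ length (allFin d) * Z
        ≡⟨ cong (λ t → (2 * q) ^ t * Z) (length-allFin d) ⟩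
      (2 * q) ^ d * Z ∎
      where open ≤-Reasoning

    -- Taking `c` divides the tilt `2q + 1` by at most 3, rounded up to 4 to have a power of 2.
    tilt-lower : {A B : Set} (a : Dec A) (b : Dec B) → suc (2 * q) ^ 𝟙 a * (2 * q) ≤ tilt a b * (4 ^ 𝟙 b * (2 * q) ^ 𝟙 a)
    tilt-lower (no _)  (no _)  = ≤-reflexive (r q)
      where
      r : ∀ q → 1 * (2 * q) ≡ 2 * q * (1 * 1)
      r = solve-∀
    tilt-lower (no _)  (yes _) = ≤-trans (m≤m+n (1 * (2 * q)) (6 * q)) (≤-reflexive (r q))
      where
      r : ∀ q → 1 * (2 * q) + 6 * q ≡ 2 * q * (4 * 1 * 1)
      r = solve-∀
    tilt-lower (yes _) (no _)  = ≤-reflexive (r q)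
      where
      r : ∀ q → suc (2 * q) * 1 * (2 * q) ≡ suc (2 * q) * (1 * (2 * q * 1))
      r = solve-∀
    tilt-lower (yes _) (yes _) = begin
      suc (2 * q) * 1 * (2 * q)       ≤⟨ *-monoˡ-≤ (2 * q) (*-monoˡ-≤ 1 (+-monoˡ-≤ (2 * q) (≤-trans (>-nonZero⁻¹ q) (m≤m+n q (q + 0))))) ⟩
      (2 * q + 2 * q) * 1 * (2 * q)   ≡⟨ r q ⟩
      q * (4 * 1 * (2 * q * 1)) ∎
      where
      open ≤-Reasoning
      r : ∀ q → (2 * q + 2 * q) * 1 * (2 * q) ≡ q * (4 * 1 * (2 * q * 1))
      r = solve-∀

    -- The origin of `6q + 1`: more than `d - ℓ ≥ 6qℓ` neighbours allow `c`, and their gains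
    -- `1 + 1/(2q)` multiply to at least `2 ^ (3ℓ)`; fewer than `ℓ` of them lose a factor 4, which
    -- leaves `2 ^ ℓ`.
    tilted-lower : ∀ f → (6 * q + 1) * ℓ ≤ d → V f o c → 2 ^ ℓ * (2 * q) ^ d ≤ ∏ (allFin d) (λ j → tilted j f)
    tilted-lower f d≥ (many , few) = *-cancelʳ-≤ _ _ (4 ^ ℓ * (2 * q) ^ K#) {{m*n≢0 _ _ {{m^n≢0 4 ℓ}} {{m^n≢0 (2 * q) K# {{m*n≢0 2 q}}}}}} (begin
      2 ^ ℓ * (2 * q) ^ d * (4 ^ ℓ * (2 * q) ^ K#)
        ≡⟨ r (2 ^ ℓ) ((2 * q) ^ d) (4 ^ ℓ) ((2 * q) ^ K#) ⟩
      2 ^ ℓ * 4 ^ ℓ * (2 * q) ^ K# * (2 * q) ^ d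
        ≡⟨ cong (λ t → t * (2 * q) ^ K# * (2 * q) ^ d) (trans (sym (^-distribʳ-* ℓ 2 4)) (^-*-assoc 2 3 ℓ)) ⟩
      2 ^ (3 * ℓ) * (2 * q) ^ K# * (2 * q) ^ d
        ≤⟨ *-monoˡ-≤ ((2 * q) ^ d) (power-gap (2 * q) (3 * ℓ) K# (≤-trans (>-nonZero⁻¹ q) (m≤m+n q (q + 0))) K#≥) ⟩
      suc (2 * q) ^ K# * (2 * q) ^ d
        ≡⟨ cong₂ _*_ (sym (∏-^ (allFin d) (suc (2 * q)) _)) (trans (cong ((2 * q) ^_) (sym (length-allFin d))) (sym (∏-const (allFin d) (2 * q)))) ⟩
      ∏ (allFin d) (λ j → suc (2 * q) ^ 𝟙 (K? f (e j o) c)) * ∏ (allFin d) (λ _ → 2 * q)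
        ≡⟨ ∏-* (allFin d) _ _ ⟨
      ∏ (allFin d) (λ j → suc (2 * q) ^ 𝟙 (K? f (e j o) c) * (2 * q))
        ≤⟨ ∏-mono (allFin d) (λ j → tilt-lower (K? f (e j o) c) (lookup f (e j o) ≟ c)) ⟩
      ∏ (allFin d) (λ j → tilted j f * (4 ^ 𝟙 (lookup f (e j o) ≟ c) * (2 * q) ^ 𝟙 (K? f (e j o) c)))
        ≡⟨ trans (∏-* (allFin d) (λ j → tilted j f) _) (cong (T *_) (trans (∏-* (allFin d) _ _) (cong₂ _*_ (∏-^ (allFin d) 4 _) (∏-^ (allFin d) (2 * q) _)))) ⟩
      T * (4 ^ μ f o c * (2 * q) ^ K#)
        ≤⟨ *-monoʳ-≤ T (*-monoˡ-≤ ((2 * q) ^ K#) (^-monoʳ-≤ 4 (<⇒≤ few))) ⟩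
      T * (4 ^ ℓ * (2 * q) ^ K#) ∎)
      where
      open ≤-Reasoning
      K# = κ f o c
      T = ∏ (allFin d) (λ j → tilted j f)
      r : ∀ a b c d → a * b * (c * d) ≡ a * c * d * b
      r = solve-∀
      r′ : ∀ q ℓ → 2 * q * (3 * ℓ) + ℓ ≡ (6 * q + 1) * ℓ
      r′ = solve-∀
      K#≥ : 2 * q * (3 * ℓ) ≤ K#
      K#≥ = +-cancelʳ-≤ ℓ _ _ (≤-trans (≤-reflexive (r′ q ℓ)) (≤-trans d≥ (<⇒≤ many)))

    -- Markov's inequality for the product of the tilts.
    V-rare : (6 * q + 1) * ℓ ≤ d → 2 ^ ℓ * ∑ configs (λ f → 𝟙 (Hom? f) * 𝟙 (V? f o c)) ≤ Z
    V-rare d≥ = *-cancelˡ-≤ ((2 * q) ^ d) {{m^n≢0 (2 * q) d {{m*n≢0 2 q}}}} (begin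
      (2 * q) ^ d * (2 ^ ℓ * ∑ configs (λ f → 𝟙 (Hom? f) * 𝟙 (V? f o c)))
        ≡⟨ trans (sym (*-assoc ((2 * q) ^ d) (2 ^ ℓ) _)) (sym (∑-*ˡ configs ((2 * q) ^ d * 2 ^ ℓ) (λ f → 𝟙 (Hom? f) * 𝟙 (V? f o c)))) ⟩
      ∑ configs (λ f → (2 * q) ^ d * 2 ^ ℓ * (𝟙 (Hom? f) * 𝟙 (V? f o c)))
        ≤⟨ ∑-mono configs each ⟩
      ∑ configs (λ f → ∏ (allFin d) (λ j → tilted j f) * 𝟙 (Hom? f))
        ≤⟨ tilted-total ⟩
      (2 * q) ^ d * Z ∎)
      where
      open ≤-Reasoning
      each : ∀ f → (2 * q) ^ d * 2 ^ ℓ * (𝟙 (Hom? f) * 𝟙 (V? f o c)) ≤ ∏ (allFin d) (λ j → tilted j f) * 𝟙 (Hom? f)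
      each f with V? f o c
      ... | no _  = ≤-trans (≤-reflexive (trans (cong ((2 * q) ^ d * 2 ^ ℓ *_) (*-zeroʳ (𝟙 (Hom? f)))) (*-zeroʳ ((2 * q) ^ d * 2 ^ ℓ)))) z≤n
      ... | yes v = ≤-trans (≤-reflexive (cong₂ _*_ (*-comm ((2 * q) ^ d) (2 ^ ℓ)) (*-identityʳ (𝟙 (Hom? f)))))
                      (*-monoˡ-≤ (𝟙 (Hom? f)) (tilted-lower f d≥ v))

  -- From good sites to ideal edges

  -- Each e j v coloured a, being adjacent to e j u, forbids there any b not adjacent to a.
  neighbours-adjacent : ∀ f u ε → ℓ ≤ d → Hom f → ¬ Bad f u → ¬ Bad f (mv ε u) →
    ∀ {a b} → Q f (mv ε u) a → Q f u b → Adj a b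
  neighbours-adjacent f u ε ℓ≤d hom ¬bad-u ¬bad-v {a} {b} qa qb = decidable-stable (Adj? a b) (λ ¬adj →
    <⇒≱ (abundant f u ¬bad-u qb) (begin
      κ f u b + ℓ             ≤⟨ +-monoʳ-≤ (κ f u b) (frequent f v ¬bad-v qa) ⟩
      κ f u b + μ f v a       ≡⟨ ∑-+ (allFin d) _ _ ⟨
      ∑ (allFin d) (λ j → 𝟙 (K? f (e j u) b) + 𝟙 (lookup f (e j v) ≟ a)) ≤⟨ ∑-mono (allFin d) (exclusive ¬adj) ⟩
      ∑ (allFin d) (λ _ → 1)  ≡⟨ ∑-ones d ⟩
      d ∎))
    where
    open ≤-Reasoning
    v : Site
    v = mv ε u
    exclusive : ¬ Adj a b → ∀ j → 𝟙 (K? f (e j u) b) + 𝟙 (lookup f (e j v) ≟ a) ≤ 1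
    exclusive ¬adj j with K? f (e j u) b | lookup f (e j v) ≟ a
    ... | no _   | no _     = z≤n
    ... | no _   | yes _    = ≤-refl
    ... | yes _  | no _     = ≤-refl
    ... | yes kb | yes refl = ⊥-elim (¬adj (Adj-sym (kb _ (ε , cong (lookup f) (mv-comm ε (j , true) u)))))

  Unseen : Config → Site → Site → Set
  Unseen f u v = ∃ λ c → K f u c × ¬ Q f v c

  Ideal : Config → Site → Site → Set
  Ideal f u v = (∀ {a b} → Q f v a → Q f u b → Adj a b) × # (Q? f v) * # (Q? f u) ≡ ηH

  -- Every colour allowed at `u` is seen at `v`, so `Q f v` is at least as large as `K f u`, whose
  -- product with `Q f u` reaches `η`. Adjacency gives the opposite bound.
  good⇒Ideal : ∀ f u ε → ℓ ≤ d → Hom f → ¬ Bad f u → ¬ Bad f (mv ε u) → ¬ NonOptimal f u → ¬ Unseen f u (mv ε u) → Ideal f u (mv ε u)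
  good⇒Ideal f u ε ℓ≤d hom ¬bad-u ¬bad-v optimal seen = adjacent , ≤-antisym
    (η-bound (Q? f (mv ε u)) (Q? f u) adjacent)
    (≤-trans (≮⇒≥ optimal) (*-monoˡ-≤ (# (Q? f u)) (#-mono (K? f u) (Q? f (mv ε u))
      (λ c kc → decidable-stable (Q? f (mv ε u) c) (λ ¬qc → seen (c , kc , ¬qc))))))
    where
    adjacent : ∀ {a b} → Q f (mv ε u) a → Q f u b → Adj a b
    adjacent = neighbours-adjacent f u ε ℓ≤d hom ¬bad-u ¬bad-v

  -- After the recolouring `u` is the only neighbour of `v` with colour `c`: seen, but at most once
  -- among forward neighbours. The size of `κ` decides between `U` and `V`, the latter using
  -- `2 ≤ ℓ`.
  recoloured-Bad : ∀ f u ε c → 2 ≤ ℓ → ¬ Q f (mv ε u) c → Bad (f [ u ]≔ c) (mv ε u)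
  recoloured-Bad f u ε c ℓ≥2 ¬qc with κ f′ v c + ℓ ℕ.≤? d
    where
    f′ : Config
    f′ = f [ u ]≔ c
    v : Site
    v = mv ε u
  ... | yes le = inj₁ (c , (inverse ε , trans (cong (lookup (f [ u ]≔ c)) (mv-inverse ε u)) (lookup∘update u f c)) , le)
  ... | no ≰  = inj₂ (c , ≰⇒> ≰ , ≤-trans (s≤s single) ℓ≥2)
    where
    open ≤-Reasoning
    v : Site
    v = mv ε u
    at-u : ∀ j → lookup (f [ u ]≔ c) (e j v) ≡ c → e j v ≡ u
    at-u j eq with e j v ≟ u
    ... | yes p = p
    ... | no ne = ⊥-elim (¬qc ((j , true) , trans (sym (recolour-other f c ne)) eq))
    single : μ (f [ u ]≔ c) v c ≤ 1
    single with any? (λ j → e j v ≟ u)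
    ... | no ¬∃ = ≤-trans (≤-reflexive (trans (∑-cong (allFin d) (λ j → 𝟙-no (lookup (f [ u ]≔ c) (e j v) ≟ c) (λ eq → ¬∃ (j , at-u j eq)))) (∑-zero (allFin d)))) z≤n
    ... | yes (j₀ , eq₀) = ≤-trans (∑-mono (allFin d) (λ j → 𝟙-mono (lookup (f [ u ]≔ c) (e j v) ≟ c) (j ≟ j₀)
                             (λ eq → e-distinct v (trans (at-u j eq) (sym eq₀)))))
                             (≤-reflexive (#-single j₀))

  Unseen? : ∀ f u v → Dec (Unseen f u v)
  Unseen? f u v = any? (λ c → K? f u c ×-dec ¬? (Q? f v c))

  -- Recolouring `u` by the unseen colour yields a homomorphism that is bad at `v`; at most `q`
  -- configurations, differing only at `u`, share an image.
  Unseen-rare : ∀ u ε → 2 ≤ ℓ →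
    ∑ configs (λ f → 𝟙 (Hom? f) * 𝟙 (Unseen? f u (mv ε u))) ≤ q * ∑ configs (λ f → 𝟙 (Hom? f) * 𝟙 (Bad? f (mv ε u)))
  Unseen-rare u ε ℓ≥2 = begin
    ∑ configs (λ f → 𝟙 (Hom? f) * 𝟙 (Unseen? f u v))
      ≤⟨ ∑-mono configs each ⟩
    ∑ configs (λ f → ∑ (allFin q) (λ c → bad (f [ u ]≔ c)))
      ≡⟨ exchange u bad ⟨
    q * ∑ configs bad ∎
    where
    open ≤-Reasoning
    v : Site
    v = mv ε u
    bad : Config → ℕ
    bad f = 𝟙 (Hom? f) * 𝟙 (Bad? f v)
    each : ∀ f → 𝟙 (Hom? f) * 𝟙 (Unseen? f u v) ≤ ∑ (allFin q) (λ c → bad (f [ u ]≔ c))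
    each f with Hom? f | Unseen? f u v
    ... | no _    | _    = z≤n
    ... | yes _   | no _ = z≤n
    ... | yes hom | yes (c , kc , ¬qc) = ≤-trans (≤-reflexive (sym (cong₂ _*_
            (𝟙-yes (Hom? (f [ u ]≔ c)) (Hom-recolour f u c hom kc))
            (𝟙-yes (Bad? (f [ u ]≔ c) v) (recoloured-Bad f u ε c ℓ≥2 ¬qc)))))
            (∑-∈ (λ c → bad (f [ u ]≔ c)) (∈-allFin c))

∑-positive : ∀ {A : Set} (xs : List A) (φ : A → ℕ) → 1 ≤ ∑ xs φ → ∃ λ x → 1 ≤ φ x
∑-positive (x ∷ xs) φ le with φ x in eq
... | suc _ = x , subst (1 ≤_) (sym eq) (s≤s z≤n)
... | zero  = ∑-positive xs φ le

-- The inequalities between the frequencies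

-- `LT` and `FT` count loose and flagged pairs over homomorphisms, directions and patterns; `UT`,
-- `VT`, `BT` count homomorphisms. `G` is `2 ^ g`. The inputs are the coding bound `hA`, the count
-- of failures `hB`, the strain of `U`-sites `hC` and the rarity of `V`-sites `hD`.
module Solve (G N Z η q m d J ℓ LT FT UT VT BT : ℕ) (N≥1 : 1 ≤ N) (d≥1 : 1 ≤ d)
  (hA : G * LT ≤ η * (d * (N * Z)) + J * (G * η) * FT)
  (hB : G * FT ≤ G * (q * (m * N)) * BT + d * (N * Z))
  (hC : (ℓ ∸ 1) * N * UT ≤ m ^ 3 * (LT + FT))
  (hD : G * VT ≤ q * Z)
  (hBT : BT ≤ UT + VT)
  (hJ : J * η + 1 ≤ d)
  (hℓ : m ^ 3 * (J * η + 1) * (q * m) + 1 ≤ ℓ ∸ 1) where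

  open ≤-Reasoning

  private
    N≢0 : NonZero N
    N≢0 = >-nonZero N≥1

  d≤d² : ∀ a → a * d ≤ a * (d * d)
  d≤d² a = *-monoʳ-≤ a (m≤n*m d d {{>-nonZero d≥1}})

  LF : G * (LT + FT) ≤ η * (d * (N * Z)) + (J * η + 1) * (G * FT)
  LF = begin
    G * (LT + FT)                                       ≡⟨ *-distribˡ-+ G LT FT ⟩
    G * LT + G * FT                                     ≤⟨ +-monoˡ-≤ (G * FT) hA ⟩
    η * (d * (N * Z)) + J * (G * η) * FT + G * FT       ≡⟨ r (η * (d * (N * Z))) J G η FT ⟩
    η * (d * (N * Z)) + (J * η + 1) * (G * FT) ∎
    where
    r : ∀ a J G η F → a + J * (G * η) * F + G * F ≡ a + (J * η + 1) * (G * F)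
    r = solve-∀

  FB : G * FT ≤ N * (q * m * (G * UT) + q * m * (q * Z) + d * Z)
  FB = begin
    G * FT                                              ≤⟨ hB ⟩
    G * (q * (m * N)) * BT + d * (N * Z)                ≤⟨ +-monoˡ-≤ (d * (N * Z)) (*-monoʳ-≤ (G * (q * (m * N))) hBT) ⟩
    G * (q * (m * N)) * (UT + VT) + d * (N * Z)         ≡⟨ r G q m N UT VT d Z ⟩
    N * (q * m * (G * UT) + q * m * (G * VT) + d * Z)   ≤⟨ *-monoʳ-≤ N (+-monoˡ-≤ (d * Z) (+-monoʳ-≤ (q * m * (G * UT)) (*-monoʳ-≤ (q * m) hD))) ⟩
    N * (q * m * (G * UT) + q * m * (q * Z) + d * Z) ∎
    where
    r : ∀ G q m N U V d Z → G * (q * (m * N)) * (U + V) + d * (N * Z) ≡ N * (q * m * (G * U) + q * m * (G * V) + d * Z)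
    r = solve-∀

  C₁ C₂ C₃ C₄ : ℕ
  C₁ = m ^ 3 * (η + q * q * m + 1)
  C₂ = C₁ + q
  C₃ = q * m * C₁ + q * q * m + 1
  C₄ = η + C₃

  -- `hC`, `LF` and `FB` bound `UT` by itself: the coefficient is `Y` on the right and at least
  -- `Y + 1` on the left by `hℓ`, so the self-reference is absorbed and the remainder carries no
  -- factor `G`.
  U-bound : G * UT ≤ C₁ * (d * d) * Z
  U-bound = begin
    G * UT
      ≤⟨ +-cancelʳ-≤ (Y * (G * UT)) _ _ (*-cancelˡ-≤ N {{N≢0}} scaled) ⟩
    m ^ 3 * (η * (d * Z)) + m ^ 3 * (J * η + 1) * (q * m * (q * Z) + d * Z)
      ≤⟨ +-monoʳ-≤ (m ^ 3 * (η * (d * Z))) (*-monoˡ-≤ (q * m * (q * Z) + d * Z) (*-monoʳ-≤ (m ^ 3) hJ)) ⟩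
    m ^ 3 * (η * (d * Z)) + m ^ 3 * d * (q * m * (q * Z) + d * Z)
      ≡⟨ r₁ (m ^ 3) η d Z q m ⟩
    m ^ 3 * ((η + q * q * m) * d + d * d) * Z
      ≤⟨ *-monoˡ-≤ Z (*-monoʳ-≤ (m ^ 3) (+-monoˡ-≤ (d * d) (d≤d² (η + q * q * m)))) ⟩
    m ^ 3 * ((η + q * q * m) * (d * d) + d * d) * Z
      ≡⟨ r₂ (m ^ 3) (η + q * q * m) (d * d) Z ⟩
    C₁ * (d * d) * Z ∎
    where
    Y : ℕ
    Y = m ^ 3 * (J * η + 1) * (q * m)
    r₁ : ∀ M η d Z q m → M * (η * (d * Z)) + M * d * (q * m * (q * Z) + d * Z) ≡ M * ((η + q * q * m) * d + d * d) * Z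
    r₁ = solve-∀
    r₂ : ∀ M a b Z → M * (a * b + b) * Z ≡ M * (a + 1) * b * Z
    r₂ = solve-∀
    scaled : N * (G * UT + Y * (G * UT)) ≤ N * (m ^ 3 * (η * (d * Z)) + m ^ 3 * (J * η + 1) * (q * m * (q * Z) + d * Z) + Y * (G * UT))
    scaled = begin
      N * (G * UT + Y * (G * UT))             ≡⟨ r₃ N G UT Y ⟩
      G * ((Y + 1) * N * UT)                  ≤⟨ *-monoʳ-≤ G (*-monoˡ-≤ UT (*-monoˡ-≤ N hℓ)) ⟩
      G * ((ℓ ∸ 1) * N * UT)                  ≤⟨ *-monoʳ-≤ G hC ⟩
      G * (m ^ 3 * (LT + FT))                 ≡⟨ r₄ G (m ^ 3) (LT + FT) ⟩
      m ^ 3 * (G * (LT + FT))                 ≤⟨ *-monoʳ-≤ (m ^ 3) LF ⟩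
      m ^ 3 * (η * (d * (N * Z)) + (J * η + 1) * (G * FT))
                                              ≤⟨ *-monoʳ-≤ (m ^ 3) (+-monoʳ-≤ (η * (d * (N * Z))) (*-monoʳ-≤ (J * η + 1) FB)) ⟩
      m ^ 3 * (η * (d * (N * Z)) + (J * η + 1) * (N * (q * m * (G * UT) + q * m * (q * Z) + d * Z)))
                                              ≡⟨ r₅ (m ^ 3) η d N Z (J * η + 1) (q * m) (G * UT) q ⟩
      N * (m ^ 3 * (η * (d * Z)) + m ^ 3 * (J * η + 1) * (q * m * (q * Z) + d * Z) + Y * (G * UT)) ∎
      where
      r₃ : ∀ N G U Y → N * (G * U + Y * (G * U)) ≡ G * ((Y + 1) * N * U)
      r₃ = solve-∀
      r₄ : ∀ a b c → a * (b * c) ≡ b * (a * c)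
      r₄ = solve-∀
      r₅ : ∀ M η d N Z j p U q → M * (η * (d * (N * Z)) + j * (N * (p * U + p * (q * Z) + d * Z))) ≡
        N * (M * (η * (d * Z)) + M * j * (p * (q * Z) + d * Z) + M * j * p * U)
      r₅ = solve-∀

  B-bound : G * BT ≤ C₂ * (d * d) * Z
  B-bound = begin
    G * BT                          ≤⟨ *-monoʳ-≤ G hBT ⟩
    G * (UT + VT)                   ≡⟨ *-distribˡ-+ G UT VT ⟩
    G * UT + G * VT                 ≤⟨ +-mono-≤ U-bound hD ⟩
    C₁ * (d * d) * Z + q * Z        ≡⟨ cong (λ t → C₁ * (d * d) * Z + t * Z) (*-identityʳ q) ⟨
    C₁ * (d * d) * Z + q * 1 * Z    ≤⟨ +-monoʳ-≤ (C₁ * (d * d) * Z) (*-monoˡ-≤ Z (*-monoʳ-≤ q (*-mono-≤ d≥1 d≥1))) ⟩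
    C₁ * (d * d) * Z + q * (d * d) * Z ≡⟨ r C₁ q (d * d) Z ⟩
    C₂ * (d * d) * Z ∎
    where
    r : ∀ a b c Z → a * c * Z + b * c * Z ≡ (a + b) * c * Z
    r = solve-∀

  F-bound : G * FT ≤ N * (C₃ * (d * d) * Z)
  F-bound = ≤-trans FB (*-monoʳ-≤ N (begin
    q * m * (G * UT) + q * m * (q * Z) + d * Z
      ≤⟨ +-monoˡ-≤ (d * Z) (+-monoˡ-≤ (q * m * (q * Z)) (*-monoʳ-≤ (q * m) U-bound)) ⟩
    q * m * (C₁ * (d * d) * Z) + q * m * (q * Z) + d * Z
      ≡⟨ r₁ q m C₁ d Z ⟩
    q * m * C₁ * (d * d) * Z + q * q * m * 1 * Z + 1 * d * Z
      ≤⟨ +-mono-≤ (+-monoʳ-≤ (q * m * C₁ * (d * d) * Z) (*-monoˡ-≤ Z (*-monoʳ-≤ (q * q * m) (*-mono-≤ d≥1 d≥1)))) (*-monoˡ-≤ Z (d≤d² 1)) ⟩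
    q * m * C₁ * (d * d) * Z + q * q * m * (d * d) * Z + 1 * (d * d) * Z
      ≡⟨ r₂ (q * m * C₁) (q * q * m) (d * d) Z ⟩
    C₃ * (d * d) * Z ∎))
    where
    r₁ : ∀ q m C d Z → q * m * (C * (d * d) * Z) + q * m * (q * Z) + d * Z ≡ q * m * C * (d * d) * Z + q * q * m * 1 * Z + 1 * d * Z
    r₁ = solve-∀
    r₂ : ∀ a b c Z → a * c * Z + b * c * Z + 1 * c * Z ≡ (a + b + 1) * c * Z
    r₂ = solve-∀

  LF-bound : G * (LT + FT) ≤ N * (C₄ * (d * d * d) * Z)
  LF-bound = begin
    G * (LT + FT)                                          ≤⟨ LF ⟩
    η * (d * (N * Z)) + (J * η + 1) * (G * FT)             ≤⟨ +-monoʳ-≤ _ (*-mono-≤ hJ F-bound) ⟩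
    η * (d * (N * Z)) + d * (N * (C₃ * (d * d) * Z))       ≡⟨ r₁ η d N Z C₃ ⟩
    N * ((η * d + C₃ * (d * d * d)) * Z)                   ≤⟨ *-monoʳ-≤ N (*-monoˡ-≤ Z (+-monoˡ-≤ (C₃ * (d * d * d)) (*-monoʳ-≤ η (m≤n*m d (d * d) {{m*n≢0 d d {{d≢0}} {{d≢0}}}})))) ⟩
    N * ((η * (d * d * d) + C₃ * (d * d * d)) * Z)         ≡⟨ cong (λ t → N * (t * Z)) (*-distribʳ-+ (d * d * d) η C₃) ⟨
    N * (C₄ * (d * d * d) * Z) ∎
    where
    d≢0 : NonZero d
    d≢0 = >-nonZero d≥1
    r₁ : ∀ η d N Z C → η * (d * (N * Z)) + d * (N * (C * (d * d) * Z)) ≡ N * ((η * d + C * (d * d * d)) * Z)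
    r₁ = solve-∀

-- The coefficient `q + 2` collects badness once at `u` and `1 + q` times at `v`, where unseen
-- colours cost `q`; the last summand is the share of nonoptimal sites.
nonidealConstant : (η q m : ℕ) → ℕ
nonidealConstant η q m = (q + 2) * (C₁ + q) + m ^ suc q * (η + (q * m * C₁ + q * q * m + 1))
  where
  C₁ : ℕ
  C₁ = m ^ 3 * (η + q * q * m + 1)

-- Bounds for a single edge

module Assembly (H : Graph) (k : ℕ) (ev-m : ev (suc k) ≡ true) (d : ℕ) .{{q≢0 : NonZero (Graph.n H)}} (g g′ ℓ J : ℕ)
  (g′-def : suc g′ ≡ 2 ^ g)
  (hF : η H * (Graph.n H * Graph.n H * suc (2 * g′)) ≤ 2 ^ J)
  (kg≤ℓ : k * g ≤ ℓ) (g≤ℓ : g ≤ ℓ)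
  (hℓ : suc k ^ 3 * (J * η H + 1) * (Graph.n H * suc k) + 2 ≤ ℓ)
  (hd : (6 * Graph.n H + 1) * ℓ ≤ d) where

  open Rarity H k ev-m d ℓ
  -- The parameter of the code is exponential in `g`, which makes the additive error of order
  -- `2^(-g)`; a failed prediction is charged `J` bits.
  module Code = Coding H k ev-m d g′

  LT FT : Site → ℕ
  LT o = ∑ configs (λ f → 𝟙 (Hom? f) * ∑ (allFin d) (λ i → ∑ sites (λ s → 𝟙 (Low? i s) * loose i f o s)))
  FT o = ∑ configs (λ f → 𝟙 (Hom? f) * flags f o)

  count : {P : Config → Set} → (∀ f → Dec (P f)) → ℕ
  count P? = ∑ configs (λ f → 𝟙 (Hom? f) * 𝟙 (P? f))

  anyU? : ∀ f o → Dec (∃ λ c → U f o c)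
  anyU? f o = any? (U? f o)

  anyV? : ∀ f o → Dec (∃ λ c → V f o c)
  anyV? f o = any? (V? f o)

  total≡ : ∀ (A : Fin d → Config → Site → Site → ℕ) o → Code.total A o ≡
    ∑ configs (λ f → 𝟙 (Hom? f) * ∑ (allFin d) (λ i → ∑ sites (λ s → 𝟙 (Low? i s) * A i f o s)))
  total≡ A o = trans (∑-swap (allFin d) configs (λ i f → 𝟙 (Hom? f) * ∑ sites (λ s → 𝟙 (Low? i s) * A i f o s)))
    (∑-cong configs (λ f → ∑-*ˡ (allFin d) (𝟙 (Hom? f)) (λ i → ∑ sites (λ s → 𝟙 (Low? i s) * A i f o s))))

  ℓ≥2 : 2 ≤ ℓ
  ℓ≥2 = ≤-trans (m≤n+m 2 _) hℓ

  ℓ≤d : ℓ ≤ d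
  ℓ≤d = ≤-trans (≤-trans (≤-reflexive (sym (*-identityˡ ℓ))) (*-monoˡ-≤ ℓ (m≤n+m 1 (6 * q)))) hd

  q<d : q < d
  q<d = ≤-trans (≤-trans (≤-reflexive (+-comm 1 q)) (≤-trans (+-monoˡ-≤ 1 (m≤n*m q 6)) (m≤m*n (6 * q + 1) ℓ {{>-nonZero (≤-trans (s≤s z≤n) ℓ≥2)}}))) hd

  N≥1 : 1 ≤ N
  N≥1 = m^n>0 m d

  Jη+1≤d : J * ηH + 1 ≤ d
  Jη+1≤d = begin
    J * ηH + 1                              ≤⟨ m≤n*m (J * ηH + 1) (m ^ 3) {{m^n≢0 m 3}} ⟩
    m ^ 3 * (J * ηH + 1)                    ≤⟨ m≤m*n (m ^ 3 * (J * ηH + 1)) (q * m) {{m*n≢0 q m}} ⟩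
    m ^ 3 * (J * ηH + 1) * (q * m)          ≤⟨ m≤m+n _ 2 ⟩
    m ^ 3 * (J * ηH + 1) * (q * m) + 2      ≤⟨ ≤-trans hℓ ℓ≤d ⟩
    d ∎
    where open ≤-Reasoning

  hℓ′ : m ^ 3 * (J * ηH + 1) * (q * m) + 1 ≤ ℓ ∸ 1
  hℓ′ = ≤-trans (≤-reflexive (sym (m+n∸n≡m (m ^ 3 * (J * ηH + 1) * (q * m) + 1) 1)))
    (∸-monoˡ-≤ 1 (≤-trans (≤-reflexive (+-assoc (m ^ 3 * (J * ηH + 1) * (q * m)) 1 1)) hℓ))

  weighted-mono : ∀ {φ ψ : Config → ℕ} → (∀ f → Hom f → φ f ≤ ψ f) →
    ∑ configs (λ f → 𝟙 (Hom? f) * φ f) ≤ ∑ configs (λ f → 𝟙 (Hom? f) * ψ f)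
  weighted-mono h = ∑-mono configs (λ f → 𝟙-*-mono (Hom? f) (h f))

  weighted-scale : ∀ a (φ : Config → ℕ) → ∑ configs (λ f → 𝟙 (Hom? f) * (a * φ f)) ≡ a * ∑ configs (λ f → 𝟙 (Hom? f) * φ f)
  weighted-scale a φ = trans (∑-cong configs (λ f → r (𝟙 (Hom? f)) a (φ f))) (∑-*ˡ configs a (λ f → 𝟙 (Hom? f) * φ f))
    where
    r : ∀ a b c → a * (b * c) ≡ b * (a * c)
    r = solve-∀

  weighted-+ : ∀ (φ ψ : Config → ℕ) → ∑ configs (λ f → 𝟙 (Hom? f) * (φ f + ψ f)) ≡
    ∑ configs (λ f → 𝟙 (Hom? f) * φ f) + ∑ configs (λ f → 𝟙 (Hom? f) * ψ f)
  weighted-+ φ ψ = trans (∑-cong configs (λ f → *-distribˡ-+ (𝟙 (Hom? f)) (φ f) (ψ f)))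
    (∑-+ configs (λ f → 𝟙 (Hom? f) * φ f) (λ f → 𝟙 (Hom? f) * ψ f))

  strain-total : ∀ o → ∑ configs (λ f → 𝟙 (Hom? f) * ∑ (allFin d) (λ i → ∑ sites (strain i f o))) ≡ LT o + FT o
  strain-total o = trans
    (∑-cong configs (λ f → cong (𝟙 (Hom? f) *_) (trans
      (∑-cong (allFin d) (λ i → ∑-+ sites (λ s → 𝟙 (Low? i s) * loose i f o s) (λ s → 𝟙 (Low? i s) * flagged i f o s)))
      (∑-+ (allFin d) (λ i → ∑ sites (λ s → 𝟙 (Low? i s) * loose i f o s)) (λ i → ∑ sites (λ s → 𝟙 (Low? i s) * flagged i f o s))))))
    (weighted-+ (λ f → ∑ (allFin d) (λ i → ∑ sites (λ s → 𝟙 (Low? i s) * loose i f o s))) (λ f → flags f o))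

  -- Markov's inequality for the strain, summed over directions and patterns.
  by-strain : ∀ {P : Config → Set} (P? : ∀ f → Dec (P f)) o a b →
    (∀ f → Hom f → P f → a ≤ b * ∑ (allFin d) (λ i → ∑ sites (strain i f o))) → a * count P? ≤ b * (LT o + FT o)
  by-strain P? o a b h = begin
    a * count P?
      ≡⟨ weighted-scale a (λ f → 𝟙 (P? f)) ⟨
    ∑ configs (λ f → 𝟙 (Hom? f) * (a * 𝟙 (P? f)))
      ≤⟨ weighted-mono each ⟩
    ∑ configs (λ f → 𝟙 (Hom? f) * (b * ∑ (allFin d) (λ i → ∑ sites (strain i f o))))
      ≡⟨ weighted-scale b _ ⟩
    b * ∑ configs (λ f → 𝟙 (Hom? f) * ∑ (allFin d) (λ i → ∑ sites (strain i f o)))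
      ≡⟨ cong (b *_) (strain-total o) ⟩
    b * (LT o + FT o) ∎
    where
    open ≤-Reasoning
    each : ∀ f → Hom f → a * 𝟙 (P? f) ≤ b * ∑ (allFin d) (λ i → ∑ sites (strain i f o))
    each f hom with P? f
    ... | yes p = ≤-trans (≤-reflexive (*-identityʳ a)) (h f hom p)
    ... | no _  = ≤-trans (≤-reflexive (*-zeroʳ a)) z≤n

  module _ (o : Site) (η≥1 : 1 ≤ ηH) where

    UT VT BT OT : ℕ
    UT = count (λ f → anyU? f o)
    VT = count (λ f → anyV? f o)
    BT = count (λ f → Bad? f o)
    OT = count (λ f → NonOptimal? f o)

    hA : 2 ^ g * LT o ≤ ηH * (d * (N * Z)) + J * (2 ^ g * ηH) * FT o
    hA = subst₂ (λ x y → 2 ^ g * x ≤ ηH * (d * (N * Z)) + J * (2 ^ g * ηH) * y) (total≡ loose o) (total≡ flagged o)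
      (subst (λ t → t * Code.total loose o ≤ ηH * (d * (N * Z)) + J * (t * ηH) * Code.total flagged o) g′-def
        (Code.total-loose-vs-flagged o J η≥1 hF))

    hB : 2 ^ g * FT o ≤ 2 ^ g * (q * (m * N)) * BT + d * (N * Z)
    hB = begin
      2 ^ g * FT o
        ≡⟨ weighted-scale (2 ^ g) (λ f → flags f o) ⟨
      ∑ configs (λ f → 𝟙 (Hom? f) * (2 ^ g * flags f o))
        ≤⟨ weighted-mono (λ f _ → ≤-trans (flags-bound f o g kg≤ℓ) (≤-reflexive (r (𝟙 (Bad? f o)) (2 ^ g * (q * (m * N))) (d * N)))) ⟩
      ∑ configs (λ f → 𝟙 (Hom? f) * (2 ^ g * (q * (m * N)) * 𝟙 (Bad? f o) + d * N * 1))
        ≡⟨ trans (weighted-+ _ (λ _ → d * N * 1)) (cong₂ _+_ (weighted-scale (2 ^ g * (q * (m * N))) (λ f → 𝟙 (Bad? f o))) (weighted-scale (d * N) (λ _ → 1))) ⟩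
      2 ^ g * (q * (m * N)) * BT + d * N * ∑ configs (λ f → 𝟙 (Hom? f) * 1)
        ≡⟨ cong (2 ^ g * (q * (m * N)) * BT +_) (trans (cong (d * N *_) (∑-cong configs (λ f → *-identityʳ _))) (*-assoc d N Z)) ⟩
      2 ^ g * (q * (m * N)) * BT + d * (N * Z) ∎
      where
      open ≤-Reasoning
      r : ∀ a b c → a * b + c ≡ b * a + c * 1
      r = solve-∀

    hC : (ℓ ∸ 1) * N * UT ≤ m ^ 3 * (LT o + FT o)
    hC = by-strain (λ f → anyU? f o) o ((ℓ ∸ 1) * N) (m ^ 3) (λ { f hom (c , u) → U-strain f o hom u })

    hD : 2 ^ g * VT ≤ q * Z
    hD = begin
      2 ^ g * VT
        ≤⟨ *-mono-≤ (^-monoʳ-≤ 2 g≤ℓ) (weighted-mono (λ f _ → 𝟙-≤ (anyV? f o) (λ { (c , v) →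
             ≤-trans (≤-reflexive (sym (𝟙-yes (V? f o c) v))) (∑-∈ (λ c → 𝟙 (V? f o c)) (∈-allFin c)) }))) ⟩
      2 ^ ℓ * ∑ configs (λ f → 𝟙 (Hom? f) * ∑ (allFin q) (λ c → 𝟙 (V? f o c)))
        ≡⟨ cong (2 ^ ℓ *_) (trans (∑-cong configs (λ f → sym (∑-*ˡ (allFin q) (𝟙 (Hom? f)) (λ c → 𝟙 (V? f o c)))))
             (∑-swap configs (allFin q) (λ f c → 𝟙 (Hom? f) * 𝟙 (V? f o c)))) ⟩
      2 ^ ℓ * ∑ (allFin q) (λ c → count (λ f → V? f o c))
        ≡⟨ ∑-*ˡ (allFin q) (2 ^ ℓ) (λ c → count (λ f → V? f o c)) ⟨
      ∑ (allFin q) (λ c → 2 ^ ℓ * count (λ f → V? f o c))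
        ≤⟨ ∑-mono (allFin q) (λ c → V-rare o c hd) ⟩
      ∑ (allFin q) (λ _ → Z)
        ≡⟨ trans (∑-const (allFin q) Z) (cong (_* Z) (length-allFin q)) ⟩
      q * Z ∎
      where open ≤-Reasoning

    hBT : BT ≤ UT + VT
    hBT = ≤-trans (weighted-mono (λ f _ → 𝟙-≤ (Bad? f o) (λ
      { (inj₁ u) → ≤-trans (≤-reflexive (sym (𝟙-yes (anyU? f o) u))) (m≤m+n _ _)
      ; (inj₂ v) → ≤-trans (≤-reflexive (sym (𝟙-yes (anyV? f o) v))) (m≤n+m _ _) })))
      (≤-reflexive (weighted-+ (λ f → 𝟙 (anyU? f o)) (λ f → 𝟙 (anyV? f o))))

    open Solve (2 ^ g) N Z ηH q m d J ℓ (LT o) (FT o) UT VT BT N≥1 (≤-trans (s≤s z≤n) q<d) hA hB hC hD hBT Jη+1≤d hℓ′ public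

    O-bound : 2 ^ g * OT ≤ m ^ suc q * (C₄ * (d * d * d) * Z)
    O-bound = *-cancelˡ-≤ N {{>-nonZero N≥1}} (begin
      N * (2 ^ g * OT)                        ≡⟨ r N (2 ^ g) OT ⟩
      2 ^ g * (N * OT)                        ≤⟨ *-monoʳ-≤ (2 ^ g) (by-strain (λ f → NonOptimal? f o) o N (m ^ suc q)
                                                   (λ f hom no → nonOptimal-strain f o hom q<d no)) ⟩
      2 ^ g * (m ^ suc q * (LT o + FT o))     ≡⟨ r (2 ^ g) (m ^ suc q) (LT o + FT o) ⟩
      m ^ suc q * (2 ^ g * (LT o + FT o))     ≤⟨ *-monoʳ-≤ (m ^ suc q) LF-bound ⟩
      m ^ suc q * (N * (C₄ * (d * d * d) * Z)) ≡⟨ r (m ^ suc q) N _ ⟩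
      N * (m ^ suc q * (C₄ * (d * d * d) * Z)) ∎)
      where
      open ≤-Reasoning
      r : ∀ a b c → a * (b * c) ≡ b * (a * c)
      r = solve-∀

  C₁′ C₂′ C₄′ : ℕ
  C₁′ = m ^ 3 * (ηH + q * q * m + 1)
  C₂′ = C₁′ + q
  C₄′ = ηH + (q * m * C₁′ + q * q * m + 1)

  -- A union bound over the four obstructions in `good⇒Ideal`, the last of them charged to bad sites
  -- at `v`.
  nonideal-bound : ∀ u ε → 1 ≤ ηH → {P : Config → Set} (P? : ∀ f → Dec (P f)) →
    (∀ f → Hom f → P f → ¬ Ideal f u (mv ε u)) → 2 ^ g * count P? ≤ nonidealConstant ηH q m * (d * d * d) * Z
  nonideal-bound u ε η≥1 {P} P? h = begin
    2 ^ g * count P?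
      ≤⟨ *-monoʳ-≤ (2 ^ g) union ⟩
    2 ^ g * (BT u η≥1 + (BT v η≥1 + (OT u η≥1 + q * BT v η≥1)))
      ≡⟨ r₁ (2 ^ g) (BT u η≥1) (BT v η≥1) (OT u η≥1) q ⟩
    2 ^ g * BT u η≥1 + ((1 + q) * (2 ^ g * BT v η≥1) + 2 ^ g * OT u η≥1)
      ≤⟨ +-mono-≤ (B-bound u η≥1) (+-mono-≤ (*-monoʳ-≤ (1 + q) (B-bound v η≥1)) (O-bound u η≥1)) ⟩
    C₂′ * (d * d) * Z + ((1 + q) * (C₂′ * (d * d) * Z) + m ^ suc q * (C₄′ * (d * d * d) * Z))
      ≡⟨ r₂ C₂′ (d * d) Z q (m ^ suc q * (C₄′ * (d * d * d) * Z)) ⟩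
    (q + 2) * C₂′ * (d * d) * Z + m ^ suc q * (C₄′ * (d * d * d) * Z)
      ≤⟨ +-monoˡ-≤ _ (*-monoˡ-≤ Z (*-monoʳ-≤ ((q + 2) * C₂′) (m≤m*n (d * d) d {{>-nonZero (≤-trans (s≤s z≤n) q<d)}}))) ⟩
    (q + 2) * C₂′ * (d * d * d) * Z + m ^ suc q * (C₄′ * (d * d * d) * Z)
      ≡⟨ r₃ ((q + 2) * C₂′) (d * d * d) Z (m ^ suc q) C₄′ ⟩
    nonidealConstant ηH q m * (d * d * d) * Z ∎
    where
    open ≤-Reasoning
    v : Site
    v = mv ε u
    r₁ : ∀ G a b c q → G * (a + (b + (c + q * b))) ≡ G * a + ((1 + q) * (G * b) + G * c)
    r₁ = solve-∀
    r₂ : ∀ a b Z q X → a * b * Z + ((1 + q) * (a * b * Z) + X) ≡ (q + 2) * a * b * Z + X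
    r₂ = solve-∀
    r₃ : ∀ a b Z M c → a * b * Z + M * (c * b * Z) ≡ (a + M * c) * b * Z
    r₃ = solve-∀
    cover : ∀ f → Hom f → P f → 1 ≤ 𝟙 (Bad? f u) + (𝟙 (Bad? f v) + (𝟙 (NonOptimal? f u) + 𝟙 (Unseen? f u v)))
    cover f hom p with Bad? f u | Bad? f v | NonOptimal? f u | Unseen? f u v
    ... | yes _ | _     | _     | _     = s≤s z≤n
    ... | no _  | yes _ | _     | _     = s≤s z≤n
    ... | no _  | no _  | yes _ | _     = s≤s z≤n
    ... | no _  | no _  | no _  | yes _ = s≤s z≤n
    ... | no a  | no b  | no c  | no e′ = ⊥-elim (h f hom p (good⇒Ideal f u ε ℓ≤d hom a b c e′))
    union : count P? ≤ BT u η≥1 + (BT v η≥1 + (OT u η≥1 + q * BT v η≥1))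
    union = ≤-trans (weighted-mono (λ f hom → 𝟙-≤ (P? f) (cover f hom))) (≤-trans
      (≤-reflexive (trans (weighted-+ _ _) (cong (BT u η≥1 +_) (trans (weighted-+ _ _) (cong (BT v η≥1 +_) (weighted-+ _ _))))))
      (+-monoʳ-≤ (BT u η≥1) (+-monoʳ-≤ (BT v η≥1) (+-monoʳ-≤ (OT u η≥1) (Unseen-rare u ε ℓ≥2)))))

-- Transfer to the Boolean definitions

length-boolFilter : ∀ {A : Set} (p : A → Bool) xs → length (boolFilter p xs) ≡ ∑ xs (λ x → bit (p x))
length-boolFilter p []       = refl
length-boolFilter p (x ∷ xs) with p x
... | true  = cong suc (length-boolFilter p xs)
... | false = length-boolFilter p xs

∑-boolFilter : ∀ {A : Set} (p : A → Bool) xs (φ : A → ℕ) → ∑ (boolFilter p xs) φ ≡ ∑ xs (λ x → bit (p x) * φ x)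
∑-boolFilter p []       φ = refl
∑-boolFilter p (x ∷ xs) φ with p x
... | true  = cong₂ _+_ (sym (*-identityˡ (φ x))) (∑-boolFilter p xs φ)
... | false = ∑-boolFilter p xs φ

∑-allFuns : ∀ N k (Ψ : Vec (Fin k) N → ℕ) → ∑ (allFuns N k) (λ g → Ψ (tabulate g)) ≡ ∑ (vecs N k) Ψ
∑-allFuns zero    k Ψ = refl
∑-allFuns (suc N) k Ψ = trans (∑-concatMap _ (allFin k) (λ g → Ψ (tabulate g)))
  (trans (∑-cong (allFin k) (λ a → trans (∑-map _ (allFuns N k) (λ g → Ψ (tabulate g))) (∑-allFuns N k (λ v → Ψ (a ∷ v)))))
    (sym (∑-vecs-suc N k Ψ)))

bit-𝟙 : ∀ {P : Set} b (P? : Dec P) → (b ≡ true → P) → (P → b ≡ true) → bit b ≡ 𝟙 P?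
bit-𝟙 true  P? f g = sym (𝟙-yes P? (f refl))
bit-𝟙 false P? f g = sym (𝟙-no P? (λ p → false≢true (g p)))
  where
  false≢true : false ≢ true
  false≢true ()

bit≤𝟙 : ∀ {P : Set} b (P? : Dec P) → (b ≡ true → P) → bit b ≤ 𝟙 P?
bit≤𝟙 true  P? f = ≤-reflexive (sym (𝟙-yes P? (f refl)))
bit≤𝟙 false P? f = z≤n

≡ᵇ-true : ∀ {a b} → (a ≡ᵇ b) ≡ true → a ≡ b
≡ᵇ-true {a} {b} eq = ≡ᵇ⇒≡ a b (Equivalence.from T-≡ eq)

true-≡ᵇ : ∀ {a b} → a ≡ b → (a ≡ᵇ b) ≡ true
true-≡ᵇ {a} {b} eq = Equivalence.to T-≡ (≡⇒≡ᵇ a b eq)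

eqF-sound : ∀ {p} {a b : Fin p} → eqF a b ≡ true → a ≡ b
eqF-sound {a = a} {b} eq with a ≟ b
... | yes p = p

eqF-complete : ∀ {p} {a b : Fin p} → a ≡ b → eqF a b ≡ true
eqF-complete {a = a} {b} eq with a ≟ b
... | yes _ = refl
... | no ne = ⊥-elim (ne eq)

∨-true : ∀ {a b} → a ∨ b ≡ true → a ≡ true ⊎ b ≡ true
∨-true {true}  _  = inj₁ refl
∨-true {false} eq = inj₂ eq

not-both : ∀ {b} → not b ≡ true → b ≢ true
not-both {false} _  ()
not-both {true}  () _

module Transfer (H : Graph) (k : ℕ) (ev-m : ev (suc k) ≡ true) (d : ℕ) .{{q≢0 : NonZero (Graph.n H)}} (ℓ : ℕ) where

  open Rarity H k ev-m d ℓ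

  Vertex : Set
  Vertex = Vtx m d

  succMod-sound : ∀ {a b : Fin m} → succMod m a b ≡ true → a ≡ σ b
  succMod-sound eq = toℕ-injective (trans (sym (≡ᵇ-true eq)) (sym (toℕ-fromℕ< _)))

  succMod-complete : ∀ {a b : Fin m} → a ≡ σ b → succMod m a b ≡ true
  succMod-complete {a} {b} refl = true-≡ᵇ {(toℕ b + 1) % m} {toℕ (σ b)} (sym (toℕ-fromℕ< _))

  diff1-sound : ∀ {a b : Fin m} → diff1 m a b ≡ true → ∃ λ s → b ≡ shift s a
  diff1-sound {a} {b} eq with ∨-true eq
  ... | inj₁ p = false , trans (sym (σ⁻σ b)) (cong σ⁻ (sym (succMod-sound {a} {b} p)))
  ... | inj₂ p = true , succMod-sound {b} {a} p

  diff1-complete : ∀ s (a : Fin m) → diff1 m a (shift s a) ≡ true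
  diff1-complete true  a = trans (cong (succMod m a (σ a) ∨_) (succMod-complete {σ a} {a} refl)) (∨-zeroʳ _)
  diff1-complete false a = cong (_∨ succMod m (σ⁻ a) a) (succMod-complete {a} {σ⁻ a} (sym (σσ⁻ a)))

  adjT-sound : ∀ (u v : Vertex) → adjT m d u v ≡ true → ∃ λ ε → point v ≡ mv ε (point u)
  adjT-sound u v eq with i , p ← any-true (λ i → diff1 m (u i) (v i) ∧ all (λ j → eqF j i ∨ eqF (u j) (v j)) (allFin d)) (allFin d) eq
    with p₁ , p₂ ← ∧-true {diff1 m (u i) (v i)} p
    with s , vi ← diff1-sound {u i} {v i} p₁ =
    (i , s) , mv-char i s (point u) (point v)
      (trans (coord-point v i) (trans vi (cong (shift s) (sym (coord-point u i)))))
      (λ j j≢i → trans (coord-point v j) (trans (other j j≢i) (sym (coord-point u j))))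
    where
    other : ∀ j → j ≢ i → v j ≡ u j
    other j j≢i with ∨-true {eqF j i} (all-true (λ j → eqF j i ∨ eqF (u j) (v j)) (allFin d) p₂ (∈-allFin j))
    ... | inj₁ e₁ = ⊥-elim (j≢i (eqF-sound e₁))
    ... | inj₂ e₂ = sym (eqF-sound e₂)

  adjT-complete : ∀ (u : Vertex) ε → adjT m d u (coord (mv ε (point u))) ≡ true
  adjT-complete u (i , s) = true-any _ (allFin d) (∈-allFin i) (cong₂ _∧_
    (subst (λ t → diff1 m (u i) t ≡ true) (sym (trans (coord-mv-same i s (point u)) (cong (shift s) (coord-point u i)))) (diff1-complete s (u i)))
    (true-all _ (allFin d) agree))
    where
    agree : ∀ j → eqF j i ∨ eqF (u j) (coord (mv (i , s) (point u)) j) ≡ true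
    agree j with j ≟ i
    ... | yes _  = refl
    ... | no j≢i = eqF-complete (sym (trans (coord-mv-other i s (point u) j≢i) (coord-point u j)))

  module _ (g : Site → Colour) where

    f : Vertex → Colour
    f x = g (point x)

    f-coord : ∀ x → f (coord x) ≡ lookup (tabulate g) x
    f-coord x = trans (cong g (funToFin-finToFin {d} {m} x)) (sym (lookup∘tabulate g x))

    coord∈allVtx : ∀ x → coord x ∈ allVtx m d
    coord∈allVtx x = ∈-map⁺ finToFun (∈-allFin x)

    isHom-sound : isHom H m d f ≡ true → Hom (tabulate g)
    isHom-sound eq x δ = subst₂ Adj (f-coord x) (f-coord (mv δ x))
      (imp-true (all-true _ (allVtx m d) (all-true _ (allVtx m d) eq (coord∈allVtx x)) (coord∈allVtx (mv δ x)))
        (subst (λ y → adjT m d (coord x) (coord (mv δ y)) ≡ true) (funToFin-finToFin {d} {m} x) (adjT-complete (coord x) δ)))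

    isHom-complete : Hom (tabulate g) → isHom H m d f ≡ true
    isHom-complete hom = true-all _ (allVtx m d) (λ u → true-all _ (allVtx m d) (λ v → true-imp (adjacent u v)))
      where
      adjacent : ∀ u v → adjT m d u v ≡ true → adj H (f u) (f v) ≡ true
      adjacent u v eq with ε , pv ← adjT-sound u v eq = subst₂ Adj (lookup∘tabulate g (point u))
        (trans (lookup∘tabulate g (mv ε (point u))) (cong g (sym pv))) (hom (point u) ε)

    imgN-sound : ∀ x c → memb c (imgN H m d f x) ≡ true → Q (tabulate g) (point x) c
    imgN-sound x c eq with w , p ← any-true (λ w → adjT m d x w ∧ eqF (f w) c) (allVtx m d) (trans (sym (lookup∘tabulate _ c)) eq)
      with p₁ , p₂ ← ∧-true {adjT m d x w} p
      with ε , pw ← adjT-sound x w p₁ = ε , trans (lookup∘tabulate g _) (trans (cong g (sym pw)) (eqF-sound p₂))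

    imgN-complete : ∀ x c → Q (tabulate g) (point x) c → memb c (imgN H m d f x) ≡ true
    imgN-complete x c (ε , eq) = trans (lookup∘tabulate _ c)
      (true-any (λ w → adjT m d x w ∧ eqF (f w) c) (allVtx m d) (coord∈allVtx (mv ε (point x)))
        (cong₂ _∧_ (adjT-complete x ε) (eqF-complete (trans (f-coord (mv ε (point x))) eq))))

    ideal-complete : ∀ u v → Ideal (tabulate g) (point u) (point v) → ideal H m d f u v ≡ true
    ideal-complete u v (adjacent , product) = cong₂ _∧_
      (compl-complete {imgN H m d f v} {imgN H m d f u} (λ p r → adjacent (imgN-sound v _ p) (imgN-sound u _ r)))
      (true-≡ᵇ (trans (cong₂ _*_ (size≡ v) (size≡ u)) product))
      where
      size≡ : ∀ x → ∣ imgN H m d f x ∣ ≡ # (Q? (tabulate g) (point x))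
      size≡ x = trans (∣∣≡# (imgN H m d f x)) (#-cong (Member? (imgN H m d f x)) (Q? (tabulate g) (point x)) (imgN-sound x) (imgN-complete x))

  Ideal? : ∀ f u v → Dec (Ideal f u v)
  Ideal? f u v = map′ (λ h {a} {b} → h a b) (λ h a b → h {a} {b}) (all? (λ a → all? (λ b → Q? f v a →-dec (Q? f u b →-dec Adj? a b))))
    ×-dec (# (Q? f v) * # (Q? f u) ℕ.≟ ηH)

  numHom≡Z : numHom H m d ≡ Z
  numHom≡Z = begin
    numHom H m d
      ≡⟨ length-boolFilter (isHom H m d) (allMaps m d q) ⟩
    ∑ (allMaps m d q) (λ f → bit (isHom H m d f))
      ≡⟨ ∑-map (λ g x → g (funToFin x)) (allFuns N q) (λ f → bit (isHom H m d f)) ⟩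
    ∑ (allFuns N q) (λ g → bit (isHom H m d (f g)))
      ≡⟨ ∑-cong (allFuns N q) (λ g → bit-𝟙 (isHom H m d (f g)) (Hom? (tabulate g)) (isHom-sound g) (isHom-complete g)) ⟩
    ∑ (allFuns N q) (λ g → 𝟙 (Hom? (tabulate g)))
      ≡⟨ ∑-allFuns N q (λ f → 𝟙 (Hom? f)) ⟩
    Z ∎
    where open ≡-Reasoning

  numNonIdeal≤ : ∀ u v → numNonIdeal H m d u v ≤ ∑ configs (λ f → 𝟙 (Hom? f) * 𝟙 (¬? (Ideal? f (point u) (point v))))
  numNonIdeal≤ u v = begin
    numNonIdeal H m d u v
      ≡⟨ trans (length-boolFilter (λ f → not (ideal H m d f u v)) (Homs H m d)) (∑-boolFilter (isHom H m d) (allMaps m d q) _) ⟩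
    ∑ (allMaps m d q) (λ f → bit (isHom H m d f) * bit (not (ideal H m d f u v)))
      ≡⟨ ∑-map (λ g x → g (funToFin x)) (allFuns N q) (λ f → bit (isHom H m d f) * bit (not (ideal H m d f u v))) ⟩
    ∑ (allFuns N q) (λ g → bit (isHom H m d (f g)) * bit (not (ideal H m d (f g) u v)))
      ≤⟨ ∑-mono (allFuns N q) (λ g → *-mono-≤ (bit≤𝟙 (isHom H m d (f g)) (Hom? (tabulate g)) (isHom-sound g))
           (bit≤𝟙 (not (ideal H m d (f g) u v)) (¬? (Ideal? (tabulate g) (point u) (point v))) (not-ideal g))) ⟩
    ∑ (allFuns N q) (λ g → 𝟙 (Hom? (tabulate g)) * 𝟙 (¬? (Ideal? (tabulate g) (point u) (point v))))
      ≡⟨ ∑-allFuns N q (λ f → 𝟙 (Hom? f) * 𝟙 (¬? (Ideal? f (point u) (point v)))) ⟩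
    ∑ configs (λ f → 𝟙 (Hom? f) * 𝟙 (¬? (Ideal? f (point u) (point v)))) ∎
    where
    open ≤-Reasoning
    not-ideal : ∀ g → not (ideal H m d (f g) u v) ≡ true → ¬ Ideal (tabulate g) (point u) (point v)
    not-ideal g eq isIdeal = not-both eq (ideal-complete g u v isIdeal)

  -- The two ends of any edge are mapped to an adjacent pair of singletons.
  η≥1 : Move → 1 ≤ Z → 1 ≤ ηH
  η≥1 ε Z≥1 with f , le ← ∑-positive configs (λ f → 𝟙 (Hom? f)) Z≥1 = witness (Hom? f) le
    where
    witness : (h : Dec (Hom f)) → 1 ≤ 𝟙 h → 1 ≤ ηH
    witness (yes hom) _ = subst (_≤ ηH) (cong₂ _*_ (#-single (lookup f x)) (#-single (lookup f (mv ε x))))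
      (η-bound (λ c → c ≟ lookup f x) (λ c → c ≟ lookup f (mv ε x)) (λ { refl refl → hom x ε }))
      where
      x : Site
      x = point (λ _ → top)

-- Choice of the parameters

suc≤2^ : ∀ n → suc n ≤ 2 ^ n
suc≤2^ zero    = ≤-refl
suc≤2^ (suc n) = ≤-trans (+-mono-≤ (m^n>0 2 n) (suc≤2^ n)) (≤-reflexive (cong (2 ^ n +_) (sym (+-identityʳ _))))

-- For d between W y and W (y+1): g = 5y, of which 4y absorbs the polynomial factor C d³ and y remains.
module Parameters (H : Graph) (k : ℕ) (ev-m : ev (suc k) ≡ true) .{{q≢0 : NonZero (Graph.n H)}} where

  q m η₀ j : ℕ
  q = Graph.n H
  m = suc k
  η₀ = η H
  j = η₀ * (q * q)

  -- With `ℓ = R y`, the part `R₀` meets `hℓ` through `bits ≤ (j + 6) y`, the part `5 * m` meets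
  -- `k * g ≤ ℓ` for `g = 5 y`, and `W` is what `hd` then asks of `d / y`.
  R₀ R W C : ℕ
  R₀ = m ^ 3 * ((j + 6) * η₀ + 1) * (q * m) + 2
  R = R₀ + 5 * m
  W = (6 * q + 1) * R
  C = nonidealConstant η₀ q m

  R≢0 : NonZero R
  R≢0 = >-nonZero (≤-trans (s≤s z≤n) (m≤n+m (5 * m) R₀))

  W≢0 : NonZero W
  W≢0 = m*n≢0 (6 * q + 1) R {{>-nonZero (m≤n+m 1 (6 * q))}} {{R≢0}}

  module At (d y : ℕ) (y≥1 : 1 ≤ y) (y-large : C * (W * W * W) ≤ y) (Wy≤d : W * y ≤ d) (d≤ : d ≤ W * suc y) where

    g g′ ℓ bits : ℕ
    g = 5 * y
    g′ = pred (2 ^ g)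
    ℓ = R * y
    -- `2 ^ j` covers `η q²` and `2 ^ (1 + g)` covers `suc (2 * g′)`.
    bits = j + 1 + g

    open ≤-Reasoning

    g′-def : suc g′ ≡ 2 ^ g
    g′-def = suc-pred (2 ^ g) {{m^n≢0 2 g}}

    hF : η H * (Graph.n H * Graph.n H * suc (2 * g′)) ≤ 2 ^ bits
    hF = begin
      η₀ * (q * q * suc (2 * g′))   ≡⟨ *-assoc η₀ (q * q) _ ⟨
      j * suc (2 * g′)              ≤⟨ *-mono-≤ (≤-trans (n≤1+n j) (suc≤2^ j)) (≤-trans (n≤1+n _) (≤-reflexive (r g′))) ⟩
      2 ^ j * (2 * suc g′)          ≡⟨ cong (λ t → 2 ^ j * (2 * t)) g′-def ⟩
      2 ^ j * 2 ^ (1 + g)           ≡⟨ ^-distribˡ-+-* 2 j (1 + g) ⟨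
      2 ^ (j + (1 + g))             ≡⟨ cong (2 ^_) (+-assoc j 1 g) ⟨
      2 ^ bits ∎
      where
      r : ∀ a → suc (suc (2 * a)) ≡ 2 * suc a
      r = solve-∀

    5my≤ℓ : 5 * m * y ≤ ℓ
    5my≤ℓ = *-monoˡ-≤ y (m≤n+m (5 * m) R₀)

    kg≤ℓ : k * g ≤ ℓ
    kg≤ℓ = ≤-trans (*-monoˡ-≤ g (n≤1+n k)) (≤-trans (≤-reflexive (r m y)) 5my≤ℓ)
      where
      r : ∀ m y → m * (5 * y) ≡ 5 * m * y
      r = solve-∀

    g≤ℓ : g ≤ ℓ
    g≤ℓ = ≤-trans (*-monoˡ-≤ y (m≤m*n 5 m)) 5my≤ℓ

    hℓ : suc k ^ 3 * (bits * η H + 1) * (Graph.n H * suc k) + 2 ≤ ℓ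
    hℓ = begin
      m ^ 3 * (bits * η₀ + 1) * (q * m) + 2
        ≤⟨ +-monoˡ-≤ 2 (*-monoˡ-≤ (q * m) (*-monoʳ-≤ (m ^ 3) Jη≤)) ⟩
      m ^ 3 * (((j + 6) * η₀ + 1) * y) * (q * m) + 2
        ≤⟨ +-monoʳ-≤ (m ^ 3 * (((j + 6) * η₀ + 1) * y) * (q * m)) (≤-trans (*-monoʳ-≤ 2 y≥1) (m≤m+n (2 * y) (5 * m * y))) ⟩
      m ^ 3 * (((j + 6) * η₀ + 1) * y) * (q * m) + (2 * y + 5 * m * y)
        ≡⟨ r (m ^ 3) ((j + 6) * η₀ + 1) y (q * m) (5 * m) ⟩
      R * y ∎
      where
      r : ∀ a b y c e → a * (b * y) * c + (2 * y + e * y) ≡ (a * b * c + 2 + e) * y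
      r = solve-∀
      r′ : ∀ j y → j * y + y + 5 * y ≡ (j + 6) * y
      r′ = solve-∀
      r″ : ∀ a y η → a * y * η + y ≡ (a * η + 1) * y
      r″ = solve-∀
      J≤ : bits ≤ (j + 6) * y
      J≤ = ≤-trans (+-monoˡ-≤ g (+-mono-≤ (m≤m*n j y {{>-nonZero y≥1}}) y≥1)) (≤-reflexive (r′ j y))
      Jη≤ : bits * η₀ + 1 ≤ ((j + 6) * η₀ + 1) * y
      Jη≤ = ≤-trans (+-mono-≤ (*-monoˡ-≤ η₀ J≤) y≥1) (≤-reflexive (r″ (j + 6) y η₀))

    hd : (6 * Graph.n H + 1) * ℓ ≤ d
    hd = ≤-trans (≤-reflexive (sym (*-assoc (6 * q + 1) R y))) Wy≤d

    open Rarity H k ev-m d ℓ using (Z; mv; Hom?; configs; point; Move)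
    open Transfer H k ev-m d ℓ
    module Bounds = Assembly H k ev-m d g g′ ℓ bits g′-def hF kg≤ℓ g≤ℓ hℓ hd

    -- The lower bound on `y` turns the constant into a fourth factor `suc y` beside the three from
    -- `d`; hence the exponent `4 * y`.
    polynomial : C * (d * d * d) ≤ 2 ^ (4 * y)
    polynomial = begin
      C * (d * d * d)                           ≤⟨ *-monoʳ-≤ C (*-mono-≤ (*-mono-≤ d≤ d≤) d≤) ⟩
      C * (W * suc y * (W * suc y) * (W * suc y)) ≡⟨ r C W (suc y) ⟩
      C * (W * W * W) * (suc y * suc y * suc y) ≤⟨ *-monoˡ-≤ (suc y * suc y * suc y) (≤-trans y-large (n≤1+n y)) ⟩
      suc y * (suc y * suc y * suc y)           ≡⟨ r′ (suc y) ⟩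
      suc y ^ 4                                 ≤⟨ ^-monoˡ-≤ 4 (suc≤2^ y) ⟩
      (2 ^ y) ^ 4                               ≡⟨ trans (^-*-assoc 2 y 4) (cong (2 ^_) (*-comm y 4)) ⟩
      2 ^ (4 * y) ∎
      where
      r : ∀ C W s → C * (W * s * (W * s) * (W * s)) ≡ C * (W * W * W) * (s * s * s)
      r = solve-∀
      r′ : ∀ s → s * (s * s * s) ≡ s * (s * (s * (s * 1)))
      r′ = solve-∀

    exponentially-rare : ∀ u v → adjT m d u v ≡ true → 2 ^ y * numNonIdeal H m d u v ≤ numHom H m d
    exponentially-rare u v uv with ε , pv ← adjT-sound u v uv = subst (2 ^ y * numNonIdeal H m d u v ≤_) (sym numHom≡Z)
      (≤-trans (*-monoʳ-≤ (2 ^ y) (numNonIdeal≤ u v)) (bound (1 ℕ.≤? Z)))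
      where
      count : ℕ
      count = ∑ configs (λ f → 𝟙 (Hom? f) * 𝟙 (¬? (Ideal? f (point u) (point v))))
      count≤Z : count ≤ Z
      count≤Z = ∑-mono configs (λ f → ≤-trans (*-monoʳ-≤ (𝟙 (Hom? f)) (𝟙≤1 (¬? (Ideal? f (point u) (point v))))) (≤-reflexive (*-identityʳ _)))
      bound : Dec (1 ≤ Z) → 2 ^ y * count ≤ Z
      bound (no Z≱1) = ≤-trans (≤-reflexive (trans (cong (2 ^ y *_) (n≤0⇒n≡0 (≤-trans count≤Z (s≤s⁻¹ (≰⇒> Z≱1))))) (*-zeroʳ (2 ^ y)))) z≤n
      bound (yes Z≥1) = *-cancelˡ-≤ (2 ^ (4 * y)) {{m^n≢0 2 (4 * y)}} (begin
        2 ^ (4 * y) * (2 ^ y * count) ≡⟨ *-assoc (2 ^ (4 * y)) (2 ^ y) count ⟨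
        2 ^ (4 * y) * 2 ^ y * count   ≡⟨ cong (_* count) (trans (sym (^-distribˡ-+-* 2 (4 * y) y)) (cong (2 ^_) (+-comm (4 * y) y))) ⟩
        2 ^ g * count                 ≤⟨ Bounds.nonideal-bound (point u) ε (η≥1 ε Z≥1) (λ f → ¬? (Ideal? f (point u) (point v)))
                                           (λ f _ ¬ideal ideal → ¬ideal (subst (Rarity.Ideal H k ev-m d ℓ f (point u)) (sym pv) ideal)) ⟩
        C * (d * d * d) * Z           ≤⟨ *-monoˡ-≤ Z polynomial ⟩
        2 ^ (4 * y) * Z ∎)

  -- The gain `2 ^ y` becomes exponential in `d` by `d ≤ W (y + 1) ≤ 2 W y ≤ y K`; raising to the
  -- power `K` avoids the fractional exponent `d / K`.
  main : (d : ℕ) → W * (C * (W * W * W) + 1) ≤ d → (u v : Vtx m d) → adjT m d u v ≡ true →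
    numNonIdeal H m d u v ^ suc (2 * W) * 2 ^ d ≤ numHom H m d ^ suc (2 * W)
  main d d≥ u v uv = begin
    x ^ K * 2 ^ d           ≤⟨ *-monoʳ-≤ (x ^ K) (^-monoʳ-≤ 2 d≤yK) ⟩
    x ^ K * 2 ^ (y * K)     ≡⟨ cong (x ^ K *_) (^-*-assoc 2 y K) ⟨
    x ^ K * (2 ^ y) ^ K     ≡⟨ *-comm (x ^ K) _ ⟩
    (2 ^ y) ^ K * x ^ K     ≡⟨ ^-distribʳ-* K (2 ^ y) x ⟨
    (2 ^ y * x) ^ K         ≤⟨ ^-monoˡ-≤ K (At.exponentially-rare d y y≥1 y-large Wy≤d d≤ u v uv) ⟩
    numHom H m d ^ K ∎
    where
    open ≤-Reasoning
    K x y : ℕ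
    K = suc (2 * W)
    x = numNonIdeal H m d u v
    y = (d / W) {{W≢0}}
    Wy≤d : W * y ≤ d
    Wy≤d = ≤-trans (≤-reflexive (*-comm W y)) (m/n*n≤m d W {{W≢0}})
    d< : d < W * suc y
    d< = ≤-trans (s≤s (≤-reflexive (m≡m%n+[m/n]*n d W {{W≢0}}))) (≤-trans (+-monoˡ-≤ (y * W) (m%n<n d W {{W≢0}})) (≤-reflexive (r W y)))
      where
      r : ∀ W y → W + y * W ≡ W * suc y
      r = solve-∀
    d≤ : d ≤ W * suc y
    d≤ = <⇒≤ d<
    y-bound : C * (W * W * W) + 1 ≤ y
    y-bound = s≤s⁻¹ (*-cancelˡ-< W _ _ (≤-<-trans d≥ d<))
    y≥1 : 1 ≤ y
    y≥1 = ≤-trans (m≤n+m 1 _) y-bound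
    y-large : C * (W * W * W) ≤ y
    y-large = ≤-trans (m≤m+n _ 1) y-bound
    d≤yK : d ≤ y * K
    d≤yK = begin
      d                 ≤⟨ d≤ ⟩
      W * suc y         ≤⟨ *-monoʳ-≤ W (+-monoˡ-≤ y y≥1) ⟩
      W * (y + y)       ≤⟨ m≤m+n _ y ⟩
      W * (y + y) + y   ≡⟨ r W y ⟩
      y * K ∎
      where
      r : ∀ W y → W * (y + y) + y ≡ y * suc (2 * W)
      r = solve-∀

-- Targets without vertices, and the conclusion

no-colours : ∀ {A : Set} {n} (p : (A → Fin n) → Bool) (xs : List (A → Fin n)) → A → n ≡ 0 → length (boolFilter p xs) ≡ 0
no-colours p []       a refl = refl
no-colours p (f ∷ xs) a refl with () ← f a

ev-%2 : ∀ n → n % 2 ≡ 0 → ev n ≡ true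
ev-%2 zero          _  = refl
ev-%2 (suc zero)    ()
ev-%2 (suc (suc n)) eq = trans (not-involutive (ev n)) (ev-%2 n eq)

theorem1p4 : (H : Graph) (m : ℕ) → 2 ≤ m → m % 2 ≡ 0 →
    Σ ℕ λ k → Σ ℕ λ d₀ → (d : ℕ) → d₀ ≤ d →
    (u v : Vtx m d) → isEven u ≡ true → adjT m d u v ≡ true →
    numNonIdeal H m d u v ^ suc k * 2 ^ d ≤ numHom H m d ^ suc k
theorem1p4 H zero    () m%2≡0
theorem1p4 H (suc k) 2≤m m%2≡0 with Graph.n H ℕ.≟ 0
-- The vertex `u` would need a colour, so no map exists; the general argument divides by `q`.
... | yes q≡0 = 0 , 0 , λ d _ u v _ _ → ≤-trans
        (≤-reflexive (cong (λ t → t ^ 1 * 2 ^ d) (no-colours (λ f → not (ideal H (suc k) d f u v)) (Homs H (suc k) d) u q≡0))) z≤n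
... | no q≢0 = 2 * W , W * (C * (W * W * W) + 1) , λ d d≥ u v _ uv → main d d≥ u v uv
  where
  open Parameters H k (ev-%2 (suc k) m%2≡0) {{≢-nonZero q≢0}}
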